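{- Let $n \geq 2$ and $r \geq 1$ be integers. Let $\Sigma_n$ be the symmetric group acting on the right on the $n$-element set $\Sigma_{n-1}\backslash\Sigma_n \cong \{1,\dots,n\}$, and let $\Pi^*_n$ be the $\Sigma_n$-poset of all partitions of this set other than the discrete partition $\widehat 0$ and the indiscrete partition $\widehat 1$. Then the $r$th reduced equivariant Euler characteristic of $\Pi^*_n$ is \[ \widetilde{\chi}_r(\Pi^*_n,\Sigma_n) = \frac{1}{n}(a \ast b_r)(n), \] where $(a\ast b_r)(n) = \sum_{d_1 d_2 = n} a(d_1) b_r(d_2)$ is the Dirichlet convolution of the multiplicative arithmetic functions \[ a(n) = (-1)^{n+1}, \qquad b_r(n) = \prod_p (-1)^{n_p} p^{\binom{n_p}{2}} \binom{r}{n_p}_p , \] with $n = \prod_p p^{n_p}$ the prime factorization of $n$.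
   Context: Partitions of a set are ordered by refinement; $\Sigma_n$ acts on partitions via its action on the underlying set. For a finite poset $P$, $\widetilde\chi(P)$ denotes the reduced Euler characteristic of (the order complex of) $P$, i.e. Euler characteristic minus $1$ (so $\widetilde\chi(\emptyset)=-1$). For a finite group $G$ and finite $G$-poset $\Pi$, $C_r(G)$ is the set of $r$-tuples $X=(x_1,\dots,x_r)$ of pairwise commuting elements of $G$, $\Pi^X$ is the subposet of elements fixed by all $x_i$, and the $r$th reduced equivariant Euler characteristic is $\widetilde\chi_r(\Pi,G) = \frac{1}{|G|}\sum_{X\in C_r(G)} \widetilde\chi(\Pi^X)$. The $p$-binomial coefficient is $\binom{r}{d}_p = \frac{(p^r-1)(p^r-p)\cdots(p^r-p^{d-1})}{(p^d-1)(p^d-p)\cdots(p^d-p^{d-1})}$, the number of $d$-dimensional subspaces of $\mathbf{F}_p^r$ (it is $0$ for $d>r$ and $1$ for $d=0$). -}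

module Defs where

open import Data.Bool using (Bool; true; false; _∧_; _∨_; not; if_then_else_)
open import Data.Nat using (ℕ; zero; suc; _^_; _∸_)
import Data.Nat as ℕ
open import Data.Nat.Divisibility using (_∣?_)
open import Data.Nat.Primality using (prime?)
open import Data.Nat.Combinatorics using (_C_)
open import Data.Nat.DivMod using (_/_)
open import Data.Integer using (ℤ; +_; -_)
import Data.Integer as ℤ
open import Data.Rational using (ℚ; 0ℚ)
import Data.Rational as ℚ
open import Data.Fin using (Fin)
import Data.Fin as Fin
open import Data.List using (List; []; _∷_; [_]; map; concatMap; length; upTo; allFin)
open import Data.Bool.ListAction using (and)
open import Data.Nat.ListAction using (product)
open import Data.Vec using (Vec; lookup; toList)
import Data.Vec as Vec
open import Relation.Nullary.Decidable using (⌊_⌋)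

all : ∀ {A : Set} → (A → Bool) → List A → Bool
all p xs = and (map p xs)

filterB : ∀ {A : Set} → (A → Bool) → List A → List A
filterB p [] = []
filterB p (x ∷ xs) = if p x then x ∷ filterB p xs else filterB p xs

vecs : ∀ {A : Set} → List A → (k : ℕ) → List (Vec A k)
vecs xs zero = Vec.[] ∷ []
vecs xs (suc k) = concatMap (λ x → map (x Vec.∷_) (vecs xs k)) xs

_⇒_ : Bool → Bool → Bool
a ⇒ b = not a ∨ b

_==B_ : Bool → Bool → Bool
a ==B b = (a ⇒ b) ∧ (b ⇒ a)

_==F_ : ∀ {n} → Fin n → Fin n → Bool
i ==F j = ⌊ i Fin.≟ j ⌋

sumℤ : List ℤ → ℤ
sumℤ [] = + 0
sumℤ (x ∷ xs) = x ℤ.+ sumℤ xs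

prodℤ : List ℤ → ℤ
prodℤ [] = + 1
prodℤ (x ∷ xs) = x ℤ.* prodℤ xs

sign : ℕ → ℤ
sign zero = + 1
sign (suc k) = - sign k

range1 : ℕ → List ℕ
range1 m = map suc (upTo m)

-- natural division, with the (never used) convention m / 0 = 0
divℕ : ℕ → ℕ → ℕ
divℕ m zero = 0
divℕ m (suc k) = m / suc k

-- rational z / d, with the (never used) convention z / 0 = 0
divℚ : ℤ → ℕ → ℚ
divℚ z zero = 0ℚ
divℚ z (suc k) = z ℚ./ suc k

-- Reduced Euler characteristic of the order complex of a finite poset,
-- given by a duplicate-free list of its elements and a boolean strict order.

-- chains with exactly k elements, listed as strictly decreasing lists
-- x₁ > x₂ > ... (head is the largest element)
chains : ∀ {A : Set} → List A → (A → A → Bool) → ℕ → List (List A)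
chains els lt zero = [] ∷ []
chains els lt (suc k) = concatMap extend (chains els lt k)
  where
  extend : _ → _
  extend [] = map [_] els
  extend (x ∷ c) = concatMap (λ y → if lt x y then (y ∷ x ∷ c) ∷ [] else []) els

-- χ̃ = -1 + Σ_{k≥1} (-1)^(k-1) #(chains with k elements)
--   = - Σ_{k=0}^{|P|} (-1)^k #(chains with k elements)
redEuler : ∀ {A : Set} → List A → (A → A → Bool) → ℤ
redEuler els lt =
  - sumℤ (map (λ k → sign k ℤ.* + length (chains els lt k)) (upTo (suc (length els))))

Perm : ℕ → Set
Perm n = Vec (Fin n) n

app : ∀ {n} → Perm n → Fin n → Fin n
app σ i = lookup σ i

isBijective : ∀ {n} → Perm n → Bool
isBijective {n} σ =
  all (λ i → all (λ j → (app σ i ==F app σ j) ⇒ (i ==F j)) (allFin n)) (allFin n)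

perms : (n : ℕ) → List (Perm n)
perms n = filterB isBijective (vecs (allFin n) n)

commute : ∀ {n} → Perm n → Perm n → Bool
commute {n} σ τ = all (λ k → app σ (app τ k) ==F app τ (app σ k)) (allFin n)

pairwiseCommuting : ∀ {n} → List (Perm n) → Bool
pairwiseCommuting xs = all (λ σ → all (λ τ → commute σ τ) xs) xs

commutingTuples : (n r : ℕ) → List (Vec (Perm n) r)
commutingTuples n r = filterB (λ X → pairwiseCommuting (toList X)) (vecs (perms n) r)

-- Partitions of Fin n, represented by their equivalence relations
-- (i ~ j iff i and j lie in the same block).

Rel : ℕ → Set
Rel n = Vec (Vec Bool n) n

rel : ∀ {n} → Rel n → Fin n → Fin n → Bool
rel R i j = lookup (lookup R i) j

isEquivalence : ∀ {n} → Rel n → Bool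
isEquivalence {n} R =
  all (λ i → rel R i i) (allFin n)
  ∧ all (λ i → all (λ j → rel R i j ⇒ rel R j i) (allFin n)) (allFin n)
  ∧ all (λ i → all (λ j → all (λ k → (rel R i j ∧ rel R j k) ⇒ rel R i k)
      (allFin n)) (allFin n)) (allFin n)

isDiscrete : ∀ {n} → Rel n → Bool
isDiscrete {n} R = all (λ i → all (λ j → rel R i j ==B (i ==F j)) (allFin n)) (allFin n)

isIndiscrete : ∀ {n} → Rel n → Bool
isIndiscrete {n} R = all (λ i → all (λ j → rel R i j) (allFin n)) (allFin n)

refines : ∀ {n} → Rel n → Rel n → Bool
refines {n} R S = all (λ i → all (λ j → rel R i j ⇒ rel S i j) (allFin n)) (allFin n)

strictlyRefines : ∀ {n} → Rel n → Rel n → Bool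
strictlyRefines R S = refines R S ∧ not (refines S R)

partitions : (n : ℕ) → List (Rel n)
partitions n = filterB isEquivalence (vecs (vecs (true ∷ false ∷ []) n) n)

properPartitions : (n : ℕ) → List (Rel n)
properPartitions n = filterB (λ R → not (isDiscrete R) ∧ not (isIndiscrete R)) (partitions n)

fixedBy : ∀ {n} → Perm n → Rel n → Bool
fixedBy {n} σ R =
  all (λ i → all (λ j → rel R (app σ i) (app σ j) ==B rel R i j) (allFin n)) (allFin n)

fixedPoints : ∀ {n r} → Vec (Perm n) r → List (Rel n)
fixedPoints {n} X = filterB (λ R → all (λ σ → fixedBy σ R) (toList X)) (properPartitions n)

equivEulerPartitions : (r n : ℕ) → ℚ
equivEulerPartitions r n =
  divℚ (sumℤ (map (λ X → redEuler (fixedPoints X) strictlyRefines) (commutingTuples n r)))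
       (length (perms n))

val : ℕ → ℕ → ℕ
val p m = length (filterB (λ e → ⌊ (p ^ e) ∣? m ⌋) (range1 m))

pBinom : ℕ → ℕ → ℕ → ℕ
pBinom p r d =
  divℕ (product (map (λ i → p ^ r ∸ p ^ i) (upTo d)))
       (product (map (λ i → p ^ d ∸ p ^ i) (upTo d)))

aFun : ℕ → ℤ
aFun m = sign (suc m)

-- b_r(m) = ∏_p (-1)^(m_p) p^(C(m_p,2)) (r choose m_p)_p  (product over primes p ≤ m;
-- primes not dividing m contribute the factor 1)
bFun : ℕ → ℕ → ℤ
bFun r m = prodℤ (map factor (filterB (λ p → ⌊ prime? p ⌋) (range1 m)))
  where
  factor : ℕ → ℤ
  factor p = sign (val p m) ℤ.* + (p ^ (val p m C 2)) ℤ.* + pBinom p r (val p m)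

convAB : ℕ → ℕ → ℤ
convAB r n = sumℤ (concatMap (λ d₁ → map (λ d₂ →
  if ⌊ d₁ ℕ.* d₂ ℕ.≟ n ⌋ then aFun d₁ ℤ.* bFun r d₂ else + 0) (range1 n)) (range1 n))

{-# OPTIONS --safe #-}
module Submission where

-- For a commuting tuple X, the Euler characteristic in question is μ_X(0,1), where μ_X is the Möbius function
-- of the lattice of X-invariant partitions.  If Z is a set with an action of ℤ^r, then Σ_θ μ_X(0,θ) #Hom_X(S/θ, Z)
-- is the number of equivariant injections S → Z, because Σ_{θ ≤ κ} μ_X(0,θ) = [κ = 0]; and summed over X it is the
-- number of injections whose image is invariant, since such an injection determines X.
--
-- Take Z = t copies of a transitive set Y = ℤ/e₁ × … × ℤ/e_r on which the generators act by translations through a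
-- unitriangular matrix, and weight Y by μ(e₁)⋯μ(e_r).  Up to multiples of t², the weighted number of pointed
-- equivariant maps S/θ → Z is t when θ = 1 and 0 otherwise: disconnected quotients contribute multiples of t², and
-- Σ_{e ∣ u} μ(e) = [u = 1] successively eliminates the cycle of length u traced by each generator.  Invariant
-- subsets of Z are unions of copies of Y, so the count of injections is (n−1)! m (t choose m) ≡ t (n−1)! (−1)^(m−1)
-- mod t² with m |Y| = n.  Comparing coefficients of t gives (n−1)! Σ_{md=n} a(m) Σ_{|Y|=d} μ(e₁)⋯μ(e_r), and the
-- inner sum is b_r(d) because b_{r+1} is the Dirichlet convolution of b_r with μ(e) e^r (the q-Pascal rule).

open import Defs
open import Data.Bool using (Bool; true; false; _∧_; _∨_; not; if_then_else_)
import Data.Bool as Bool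
open import Data.Nat using (ℕ; zero; suc; _≤_; _<_; z≤n; s≤s; _∸_; NonZero; _!; _^_)
open import Data.Integer using (ℤ; +_; -_; _+_; _-_; _*_; 0ℤ; 1ℤ)
open import Data.Fin using (Fin; zero; suc; toℕ)
open import Data.List using (List; []; _∷_; map; concatMap; length; upTo; allFin; _++_; tabulate; applyUpTo)
open import Data.Vec using (Vec; []; _∷_; lookup; toList)
open import Data.Product using (∃; _×_; _,_; proj₁; proj₂)
open import Data.Sum using (_⊎_; inj₁; inj₂)
open import Data.Empty using (⊥; ⊥-elim)
open import Function using (_∘_; id)
open import Relation.Nullary using (¬_; Dec; yes; no; does)
open import Relation.Nullary.Decidable using (⌊_⌋; dec-true; dec-false; _×-dec_; _→-dec_; map′)
open import Relation.Binary.Definitions using (DecidableEquality)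
open import Relation.Binary.PropositionalEquality using (_≡_; _≢_; refl; sym; trans; cong; cong₂; subst; subst₂; module ≡-Reasoning)
open import Data.Integer.Tactic.RingSolver using (solve-∀)
import Data.Nat as ℕ
import Data.Nat.Properties as ℕₚ
import Data.Integer.Properties as ℤₚ
import Data.Fin as Fin
import Data.Fin.Properties as Finₚ
import Data.Vec as Vec
import Data.Vec.Properties as Vecₚ
import Data.List.Properties as Listₚ
import Data.Product.Properties as Productₚ
open import Data.List.Membership.Propositional using (_∈_)
open import Data.List.Relation.Unary.Any using (here; there)
import Data.Nat.DivMod as DM
import Data.Nat.Divisibility as Dv
open Dv using (_∣_; _∣?_)
import Data.Fin.Permutation.Components as PC
import Data.Integer as ℤ
import Data.Nat.Combinatorics as Comb
open Comb using (_C_)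
open import Data.Nat.Primality using (Prime; prime?; euclidsLemma; prime⇒nonTrivial; prime⇒nonZero; prime⇒irreducible)
open import Data.Nat.Primality.Factorisation using (factorise)
open import Data.List.Relation.Unary.All using ([]; _∷_)
open import Data.Nat.Induction using (<-rec)
open import Data.Nat.ListAction using (product)
import Data.Rational.Properties as ℚₚ
import Data.Rational.Unnormalised as ℚᵘ

open ≡-Reasoning

-- The value wanted sits at the top of each lattice, while maps S/θ → Z see every θ; the weights are
-- chosen to make all other θ drop out. With one generator, a cycle of length u has one pointed map
-- to a cycle of length e if e divides u, and none otherwise. With several, the remaining generators
-- move the cycle of the first by some number of steps: the off-diagonal matrix entries record these
-- steps, and summing over all of them leaves exactly one choice of entries that fits, so the same
-- divisor sum applies. Pointing, that is, sending one fixed point of S to a base point, keeps the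
-- count at one per cycle instead of e; it also makes (n-1)! appear in place of n!, and so the
-- factor 1/n. These weights say nothing about disconnected quotients, which is why Z consists of t
-- copies: the parts of such a quotient can be relabelled independently, and t² splits off. Here t
-- is a number and not an indeterminate, so the coefficient of t is recovered from congruences
-- modulo t²: a single t exceeding the difference of two candidates already forces them to be equal.

⟦_⟧ : Bool → ℤ
⟦ true ⟧ = 1ℤ
⟦ false ⟧ = 0ℤ

⟦∧⟧ : ∀ a b → ⟦ a ∧ b ⟧ ≡ ⟦ a ⟧ * ⟦ b ⟧
⟦∧⟧ true b = sym (ℤₚ.*-identityˡ ⟦ b ⟧)
⟦∧⟧ false b = refl

*-swapˡ : ∀ a b c → a * (b * c) ≡ b * (a * c)
*-swapˡ = solve-∀

-- Reflection of boolean tests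

true≢false : ∀ {b} → b ≡ true → b ≡ false → ⊥
true≢false refl ()

bool-ext : ∀ {a b} → (a ≡ true → b ≡ true) → (b ≡ true → a ≡ true) → a ≡ b
bool-ext {true} f g = sym (f refl)
bool-ext {false} {true} f g = g refl
bool-ext {false} {false} f g = refl

≢true⇒≡false : ∀ {b} → ¬ b ≡ true → b ≡ false
≢true⇒≡false {true} f = ⊥-elim (f refl)
≢true⇒≡false {false} f = refl

not-true : ∀ {b} → not b ≡ true → b ≡ false
not-true {false} _ = refl

∧-true : ∀ {a b} → a ∧ b ≡ true → a ≡ true × b ≡ true
∧-true {true} {true} _ = refl , refl

∧-intro : ∀ {a b} → a ≡ true → b ≡ true → a ∧ b ≡ true
∧-intro refl refl = refl

⇒-true : ∀ {a b} → a ⇒ b ≡ true → a ≡ true → b ≡ true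
⇒-true p refl = p

⇒-intro : ∀ {a b} → (a ≡ true → b ≡ true) → a ⇒ b ≡ true
⇒-intro {true} f = f refl
⇒-intro {false} f = refl

==B-true : ∀ {a b} → a ==B b ≡ true → a ≡ b
==B-true {true} {true} _ = refl
==B-true {false} {false} _ = refl

==B-refl : ∀ a → a ==B a ≡ true
==B-refl true = refl
==B-refl false = refl

does-true : ∀ {P : Set} (d : Dec P) → does d ≡ true → P
does-true (yes p) _ = p

⌊⌋-true : ∀ {P : Set} (d : Dec P) → ⌊ d ⌋ ≡ true → P
⌊⌋-true (yes p) _ = p

⌊⌋-intro : ∀ {P : Set} (d : Dec P) → P → ⌊ d ⌋ ≡ true
⌊⌋-intro (yes _) p = refl
⌊⌋-intro (no ¬p) p = ⊥-elim (¬p p)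

==F-true : ∀ {n} {i j : Fin n} → i ==F j ≡ true → i ≡ j
==F-true {i = i} {j} = ⌊⌋-true (i Fin.≟ j)

==F-refl : ∀ {n} (i : Fin n) → i ==F i ≡ true
==F-refl i = ⌊⌋-intro (i Fin.≟ i) refl

does-⇔ : ∀ {P Q : Set} (d : Dec P) (e : Dec Q) → (P → Q) → (Q → P) → does d ≡ does e
does-⇔ d e f g = bool-ext (λ p → dec-true e (f (does-true d p))) (λ q → dec-true d (g (does-true e q)))

⟦⟧-supported : ∀ {b} z → (b ≡ true → ⊥) → ⟦ b ⟧ * z ≡ 0ℤ
⟦⟧-supported {true} z f = ⊥-elim (f refl)
⟦⟧-supported {false} z f = refl

-- Lets a condition tested by an indicator be assumed while rewriting the term that the indicator
-- multiplies.
⟦⟧-cong : ∀ {b x y} → (b ≡ true → x ≡ y) → ⟦ b ⟧ * x ≡ ⟦ b ⟧ * y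
⟦⟧-cong {true} f = cong (1ℤ *_) (f refl)
⟦⟧-cong {false} f = refl

⟦⟧-true : ∀ {b} z → b ≡ true → ⟦ b ⟧ * z ≡ z
⟦⟧-true z refl = ℤₚ.*-identityˡ z

-- Finite sums over lists

∑ : ∀ {A : Set} → List A → (A → ℤ) → ℤ
∑ [] f = 0ℤ
∑ (x ∷ xs) f = f x + ∑ xs f

sumℤ-map : ∀ {A : Set} (f : A → ℤ) xs → sumℤ (map f xs) ≡ ∑ xs f
sumℤ-map f [] = refl
sumℤ-map f (x ∷ xs) = cong (_+_ (f x)) (sumℤ-map f xs)

∑-cong : ∀ {A : Set} (xs : List A) {f g : A → ℤ} → (∀ x → f x ≡ g x) → ∑ xs f ≡ ∑ xs g
∑-cong [] h = refl
∑-cong (x ∷ xs) h = cong₂ _+_ (h x) (∑-cong xs h)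

∑-zero : ∀ {A : Set} (xs : List A) {f : A → ℤ} → (∀ x → f x ≡ 0ℤ) → ∑ xs f ≡ 0ℤ
∑-zero [] h = refl
∑-zero (x ∷ xs) h = cong₂ _+_ (h x) (∑-zero xs h)

∑-+ : ∀ {A : Set} (xs : List A) (f g : A → ℤ) → ∑ xs (λ x → f x + g x) ≡ ∑ xs f + ∑ xs g
∑-+ [] f g = refl
∑-+ (x ∷ xs) f g = trans (cong (_+_ (f x + g x)) (∑-+ xs f g)) (lem (f x) (g x) (∑ xs f) (∑ xs g))
  where
  lem : ∀ a b c d → a + b + (c + d) ≡ a + c + (b + d)
  lem = solve-∀

∑-*ˡ : ∀ {A : Set} (xs : List A) c (f : A → ℤ) → ∑ xs (λ x → c * f x) ≡ c * ∑ xs f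
∑-*ˡ [] c f = sym (ℤₚ.*-zeroʳ c)
∑-*ˡ (x ∷ xs) c f = trans (cong (_+_ (c * f x)) (∑-*ˡ xs c f)) (sym (ℤₚ.*-distribˡ-+ c (f x) (∑ xs f)))

∑-*ʳ : ∀ {A : Set} (xs : List A) c (f : A → ℤ) → ∑ xs (λ x → f x * c) ≡ ∑ xs f * c
∑-*ʳ xs c f = trans (∑-cong xs (λ x → ℤₚ.*-comm (f x) c)) (trans (∑-*ˡ xs c f) (ℤₚ.*-comm c (∑ xs f)))

∑-swap : ∀ {A B : Set} (xs : List A) (ys : List B) (f : A → B → ℤ) →
  ∑ xs (λ x → ∑ ys (f x)) ≡ ∑ ys (λ y → ∑ xs (λ x → f x y))
∑-swap [] ys f = sym (∑-zero ys (λ _ → refl))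
∑-swap (x ∷ xs) ys f = trans (cong (_+_ (∑ ys (f x))) (∑-swap xs ys f)) (sym (∑-+ ys (f x) _))

∑-++ : ∀ {A : Set} (xs ys : List A) (f : A → ℤ) → ∑ (xs ++ ys) f ≡ ∑ xs f + ∑ ys f
∑-++ [] ys f = sym (ℤₚ.+-identityˡ _)
∑-++ (x ∷ xs) ys f = trans (cong (_+_ (f x)) (∑-++ xs ys f)) (sym (ℤₚ.+-assoc (f x) _ _))

∑-map : ∀ {A B : Set} (h : A → B) xs (f : B → ℤ) → ∑ (map h xs) f ≡ ∑ xs (f ∘ h)
∑-map h [] f = refl
∑-map h (x ∷ xs) f = cong (_+_ (f (h x))) (∑-map h xs f)

∑-concatMap : ∀ {A B : Set} (h : A → List B) xs (f : B → ℤ) → ∑ (concatMap h xs) f ≡ ∑ xs (λ x → ∑ (h x) f)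
∑-concatMap h [] f = refl
∑-concatMap h (x ∷ xs) f = trans (∑-++ (h x) _ f) (cong (_+_ (∑ (h x) f)) (∑-concatMap h xs f))

∑-filterB : ∀ {A : Set} (p : A → Bool) xs (f : A → ℤ) → ∑ (filterB p xs) f ≡ ∑ xs (λ x → ⟦ p x ⟧ * f x)
∑-filterB p [] f = refl
∑-filterB p (x ∷ xs) f with p x
... | true = cong₂ _+_ (sym (ℤₚ.*-identityˡ (f x))) (∑-filterB p xs f)
... | false = trans (∑-filterB p xs f) (sym (ℤₚ.+-identityˡ _))

∑-length : ∀ {A : Set} (xs : List A) → + length xs ≡ ∑ xs (λ _ → 1ℤ)
∑-length [] = refl
∑-length (x ∷ xs) = cong (_+_ 1ℤ) (∑-length xs)

∑-vecs-suc : ∀ {A : Set} (xs : List A) k (f : Vec A (suc k) → ℤ) →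
  ∑ (vecs xs (suc k)) f ≡ ∑ xs (λ x → ∑ (vecs xs k) (λ v → f (x ∷ v)))
∑-vecs-suc xs k f = trans (∑-concatMap _ xs f) (∑-cong xs (λ x → ∑-map (x ∷_) (vecs xs k) f))

-- Enumerated types

record Enum {A : Set} (xs : List A) : Set where
  field
    _≟_ : DecidableEquality A
    -- Applied to point masses, this says that every element is listed exactly once. The sifting
    -- form combines completeness and absence of duplicates, and passes directly to vectors and
    -- pairs.
    ∑-point : ∀ y (g : A → ℤ) → (∀ x → x ≢ y → g x ≡ 0ℤ) → ∑ xs g ≡ g y

open Enum public using (∑-point)

∑-tabulate : ∀ {A : Set} n (h : Fin n → A) (f : A → ℤ) → ∑ (tabulate h) f ≡ ∑ (allFin n) (f ∘ h)
∑-tabulate zero h f = refl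
∑-tabulate (suc n) h f = cong (_+_ (f (h zero)))
  (trans (∑-tabulate n (h ∘ suc) f) (sym (∑-tabulate n suc (f ∘ h))))

allFin-enum : ∀ n → Enum (allFin n)
allFin-enum n = record { _≟_ = Fin._≟_ ; ∑-point = point n }
  where
  point : ∀ n (y : Fin n) (g : Fin n → ℤ) → (∀ x → x ≢ y → g x ≡ 0ℤ) → ∑ (allFin n) g ≡ g y
  point (suc n) zero g h = trans (cong (_+_ (g zero))
    (trans (∑-tabulate n suc g) (∑-zero (allFin n) (λ x → h (suc x) λ ())))) (ℤₚ.+-identityʳ _)
  point (suc n) (suc y) g h = trans (cong₂ _+_ (h zero λ ())
    (trans (∑-tabulate n suc g) (point n y (g ∘ suc) (λ x x≢y → h (suc x) (x≢y ∘ Finₚ.suc-injective))))) (ℤₚ.+-identityˡ _)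

bools : List Bool
bools = true ∷ false ∷ []

bools-enum : Enum bools
bools-enum = record { _≟_ = Bool._≟_ ; ∑-point = point }
  where
  point : ∀ y (g : Bool → ℤ) → (∀ x → x ≢ y → g x ≡ 0ℤ) → ∑ bools g ≡ g y
  point true g h = trans (cong (λ z → g true + (z + 0ℤ)) (h false λ ())) (ℤₚ.+-identityʳ _)
  point false g h = trans (cong₂ _+_ (h true λ ()) (ℤₚ.+-identityʳ (g false))) (ℤₚ.+-identityˡ _)

vecs-enum : ∀ {A : Set} {xs : List A} → Enum xs → ∀ k → Enum (vecs xs k)
vecs-enum {A} {xs} e k = record { _≟_ = Vecₚ.≡-dec (Enum._≟_ e) ; ∑-point = point k }
  where
  point : ∀ k (y : Vec A k) (g : Vec A k → ℤ) → (∀ x → x ≢ y → g x ≡ 0ℤ) → ∑ (vecs xs k) g ≡ g y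
  point zero [] g h = ℤₚ.+-identityʳ _
  point (suc k) (y ∷ ys) g h = trans (∑-vecs-suc xs k g)
    (trans (∑-point e y _ (λ x x≢y → ∑-zero (vecs xs k) (λ v → h (x ∷ v) (x≢y ∘ Vecₚ.∷-injectiveˡ))))
           (point k ys _ (λ v v≢ys → h (y ∷ v) (v≢ys ∘ Vecₚ.∷-injectiveʳ))))

pairs : ∀ {A B : Set} → List A → List B → List (A × B)
pairs xs ys = concatMap (λ x → map (x ,_) ys) xs

∑-pairs : ∀ {A B : Set} (xs : List A) (ys : List B) (f : A × B → ℤ) →
  ∑ (pairs xs ys) f ≡ ∑ xs (λ x → ∑ ys (λ y → f (x , y)))
∑-pairs xs ys f = trans (∑-concatMap _ xs f) (∑-cong xs (λ x → ∑-map (x ,_) ys f))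

pairs-enum : ∀ {A B : Set} {xs : List A} {ys : List B} → Enum xs → Enum ys → Enum (pairs xs ys)
pairs-enum {A} {B} {xs} {ys} e e′ = record
  { _≟_ = Productₚ.≡-dec (Enum._≟_ e) (Enum._≟_ e′)
  ; ∑-point = λ (x₀ , y₀) g h → trans (∑-pairs xs ys g)
      (trans (∑-point e x₀ _ (λ x x≢ → ∑-zero ys (λ y → h (x , y) (x≢ ∘ cong proj₁))))
             (∑-point e′ y₀ _ (λ y y≢ → h (x₀ , y) (y≢ ∘ cong proj₂)))) }

-- Maps into a product are pairs of maps; this is how maps into an extended test set are separated
-- into their two coordinates.
∑-vecs-pairs : ∀ {A B : Set} (xs : List A) (ys : List B) k (f : Vec (A × B) k → ℤ) →
  ∑ (vecs (pairs xs ys) k) f ≡ ∑ (vecs xs k) (λ u → ∑ (vecs ys k) (λ v → f (Vec.zip u v)))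
∑-vecs-pairs xs ys zero f = sym (ℤₚ.+-identityʳ _)
∑-vecs-pairs xs ys (suc k) f = begin
  ∑ (vecs (pairs xs ys) (suc k)) f
    ≡⟨ trans (∑-vecs-suc (pairs xs ys) k f) (∑-pairs xs ys _) ⟩
  ∑ xs (λ x → ∑ ys (λ y → ∑ (vecs (pairs xs ys) k) (λ w → f ((x , y) ∷ w))))
    ≡⟨ ∑-cong xs (λ x → trans (∑-cong ys (λ y → ∑-vecs-pairs xs ys k _)) (∑-swap ys (vecs xs k) _)) ⟩
  ∑ xs (λ x → ∑ (vecs xs k) (λ u → ∑ ys (λ y → ∑ (vecs ys k) (λ v → f ((x , y) ∷ Vec.zip u v)))))
    ≡⟨ ∑-cong xs (λ x → ∑-cong (vecs xs k) (λ u → sym (∑-vecs-suc ys k (λ v → f (Vec.zip (x ∷ u) v))))) ⟩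
  ∑ xs (λ x → ∑ (vecs xs k) (λ u → ∑ (vecs ys (suc k)) (λ v → f (Vec.zip (x ∷ u) v))))
    ≡⟨ sym (∑-vecs-suc xs k _) ⟩
  ∑ (vecs xs (suc k)) (λ u → ∑ (vecs ys (suc k)) (λ v → f (Vec.zip u v))) ∎

allv : ∀ {A : Set} {k} → (A → Bool) → Vec A k → Bool
allv p [] = true
allv p (x ∷ v) = p x ∧ allv p v

allv-true : ∀ {A : Set} {k} {p : A → Bool} (v : Vec A k) → allv p v ≡ true → ∀ i → p (lookup v i) ≡ true
allv-true (x ∷ v) h zero = proj₁ (∧-true h)
allv-true (x ∷ v) h (suc i) = allv-true v (proj₂ (∧-true h)) i

allv-intro : ∀ {A : Set} {k} {p : A → Bool} (v : Vec A k) → (∀ i → p (lookup v i) ≡ true) → allv p v ≡ true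
allv-intro [] h = refl
allv-intro (x ∷ v) h = ∧-intro (h zero) (allv-intro v (h ∘ suc))

-- Moves a filter on the entries into an indicator, so that tuples of permutations can be summed
-- over all tuples of vectors, where `Enum` is available.
∑-vecs-filterB : ∀ {A : Set} (p : A → Bool) (xs : List A) k (f : Vec A k → ℤ) →
  ∑ (vecs (filterB p xs) k) f ≡ ∑ (vecs xs k) (λ v → ⟦ allv p v ⟧ * f v)
∑-vecs-filterB p xs zero f = cong (_+ 0ℤ) (sym (ℤₚ.*-identityˡ (f [])))
∑-vecs-filterB p xs (suc k) f = begin
  ∑ (vecs (filterB p xs) (suc k)) f
    ≡⟨ trans (∑-vecs-suc (filterB p xs) k f) (∑-filterB p xs _) ⟩
  ∑ xs (λ x → ⟦ p x ⟧ * ∑ (vecs (filterB p xs) k) (λ v → f (x ∷ v)))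
    ≡⟨ ∑-cong xs (λ x → trans (cong (⟦ p x ⟧ *_) (∑-vecs-filterB p xs k _)) (sym (∑-*ˡ (vecs xs k) ⟦ p x ⟧ (λ v → ⟦ allv p v ⟧ * f (x ∷ v))))) ⟩
  ∑ xs (λ x → ∑ (vecs xs k) (λ v → ⟦ p x ⟧ * (⟦ allv p v ⟧ * f (x ∷ v))))
    ≡⟨ ∑-cong xs (λ x → ∑-cong (vecs xs k) (λ v → trans (sym (ℤₚ.*-assoc ⟦ p x ⟧ ⟦ allv p v ⟧ (f (x ∷ v))))
         (cong (_* f (x ∷ v)) (sym (⟦∧⟧ (p x) (allv p v)))))) ⟩
  ∑ xs (λ x → ∑ (vecs xs k) (λ v → ⟦ allv p (x ∷ v) ⟧ * f (x ∷ v)))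
    ≡⟨ sym (∑-vecs-suc xs k _) ⟩
  ∑ (vecs xs (suc k)) (λ v → ⟦ allv p v ⟧ * f v) ∎

all⇒∑ : ∀ {A : Set} (p : A → Bool) xs → all p xs ≡ true → ∑ xs (λ x → ⟦ not (p x) ⟧) ≡ 0ℤ
all⇒∑ p [] h = refl
all⇒∑ p (x ∷ xs) h with p x
... | true = trans (ℤₚ.+-identityˡ _) (all⇒∑ p xs h)

all-intro : ∀ {A : Set} {p : A → Bool} xs → (∀ x → p x ≡ true) → all p xs ≡ true
all-intro [] h = refl
all-intro (x ∷ xs) h = ∧-intro (h x) (all-intro xs h)

-- A failure at y would be seen by the sum of the point mass at y.
all-true : ∀ {A : Set} {p : A → Bool} {xs} → Enum xs → all p xs ≡ true → ∀ y → p y ≡ true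
all-true {A} {p} {xs} e h y with p y in eq
... | true = refl
... | false = ⊥-elim (absurd (trans (sym (trans (∑-point e y g supp) gy)) (zero-on xs h)))
  where
  g : A → ℤ
  g x = ⟦ does (Enum._≟_ e x y) ⟧
  supp : ∀ x → x ≢ y → g x ≡ 0ℤ
  supp x x≢y = cong ⟦_⟧ (dec-false (Enum._≟_ e x y) x≢y)
  gy : g y ≡ 1ℤ
  gy = cong ⟦_⟧ (dec-true (Enum._≟_ e y y) refl)
  zero-on : ∀ xs → all p xs ≡ true → ∑ xs g ≡ 0ℤ
  zero-on [] h = refl
  zero-on (x ∷ xs) h with ∧-true {p x} h
  ... | px , pxs = cong₂ _+_ (supp x (λ { refl → true≢false px eq })) (zero-on xs pxs)
  absurd : 1ℤ ≢ 0ℤ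
  absurd ()

all-Fin : ∀ {n} {p : Fin n → Bool} → all p (allFin n) ≡ true → ∀ i → p i ≡ true
all-Fin = all-true (allFin-enum _)

search : ∀ {A : Set} {xs : List A} → Enum xs → (p : A → Bool) → (∃ λ x → p x ≡ true) ⊎ (∀ x → p x ≡ false)
search {A} {xs} e p with go xs
  where
  go : ∀ ys → (∃ λ x → p x ≡ true) ⊎ all (not ∘ p) ys ≡ true
  go [] = inj₂ refl
  go (y ∷ ys) with p y in eq
  ... | true = inj₁ (y , eq)
  ... | false = go ys
... | inj₁ w = inj₁ w
... | inj₂ h = inj₂ (λ x → not-true (all-true e h x))

∑-unique : ∀ {A : Set} {xs : List A} → Enum xs → (p : A → Bool) (f : A → ℤ) → ∀ y → p y ≡ true →
  (∀ x → p x ≡ true → x ≡ y) → ∑ xs (λ x → ⟦ p x ⟧ * f x) ≡ f y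
∑-unique {xs = xs} e p f y py u = trans (∑-point e y _ (λ x x≢y → ⟦⟧-supported (f x) (x≢y ∘ u x))) (⟦⟧-true (f y) py)

∑-unique₁ : ∀ {A : Set} {xs : List A} → Enum xs → (p : A → Bool) → ∀ y → p y ≡ true →
  (∀ x → p x ≡ true → x ≡ y) → ∑ xs (λ x → ⟦ p x ⟧) ≡ 1ℤ
∑-unique₁ {xs = xs} e p y py u = trans (∑-cong xs (λ x → sym (ℤₚ.*-identityʳ ⟦ p x ⟧))) (∑-unique e p (λ _ → 1ℤ) y py u)

-- By uniqueness each side is 0 or 1, so only the existence of witnesses has to be compared.
∑-∃! : ∀ {A B : Set} {xs : List A} {ys : List B} → Enum xs → Enum ys → (p : A → Bool) (q : B → Bool) →
  (∀ x → p x ≡ true → ∃ λ y → q y ≡ true) → (∀ y → q y ≡ true → ∃ λ x → p x ≡ true) →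
  (∀ x x′ → p x ≡ true → p x′ ≡ true → x ≡ x′) → (∀ y y′ → q y ≡ true → q y′ ≡ true → y ≡ y′) →
  ∑ xs (λ x → ⟦ p x ⟧) ≡ ∑ ys (λ y → ⟦ q y ⟧)
∑-∃! {xs = xs} {ys} e e′ p q f g u v with search e p
... | inj₁ (x , px) with f x px
...   | y , qy = trans (∑-unique₁ e p x px (λ x′ px′ → u x′ x px′ px))
                   (sym (∑-unique₁ e′ q y qy (λ y′ qy′ → v y′ y qy′ qy)))
∑-∃! {xs = xs} {ys} e e′ p q f g u v | inj₂ h =
  trans (∑-zero xs (λ x → cong ⟦_⟧ (h x))) (sym (∑-zero ys (λ y → cong ⟦_⟧ (≢true⇒≡false (λ qy →
    true≢false (proj₂ (g y qy)) (h _))))))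

-- Both sides evaluate the double sum over the graph `y = σ x`, summed in the two possible orders.
∑-bij : ∀ {A : Set} {xs : List A} → Enum xs → (σ τ : A → A) → (∀ x → σ (τ x) ≡ x) → (∀ x → τ (σ x) ≡ x) →
  (f : A → ℤ) → ∑ xs (f ∘ σ) ≡ ∑ xs f
∑-bij {A} {xs} e σ τ στ τσ f = begin
  ∑ xs (f ∘ σ)
    ≡⟨ ∑-cong xs (λ x → sym (∑-unique e (λ y → does (Enum._≟_ e y (σ x))) f (σ x)
         (dec-true (Enum._≟_ e (σ x) (σ x)) refl) (λ y → does-true (Enum._≟_ e y (σ x))))) ⟩
  ∑ xs (λ x → ∑ xs (λ y → ⟦ does (Enum._≟_ e y (σ x)) ⟧ * f y))
    ≡⟨ ∑-swap xs xs _ ⟩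
  ∑ xs (λ y → ∑ xs (λ x → ⟦ does (Enum._≟_ e y (σ x)) ⟧ * f y))
    ≡⟨ ∑-cong xs (λ y → ∑-unique e (λ x → does (Enum._≟_ e y (σ x))) (λ _ → f y) (τ y)
         (dec-true (Enum._≟_ e y (σ (τ y))) (sym (στ y)))
         (λ x h → trans (sym (τσ x)) (cong τ (sym (does-true (Enum._≟_ e y (σ x)) h))))) ⟩
  ∑ xs f ∎

-- Sums over initial segments

∑-applyUpTo : ∀ {A : Set} (h : ℕ → A) m (f : A → ℤ) → ∑ (applyUpTo h m) f ≡ ∑ (upTo m) (f ∘ h)
∑-applyUpTo h zero f = refl
∑-applyUpTo h (suc m) f = cong (_+_ (f (h 0)))
  (trans (∑-applyUpTo (h ∘ suc) m f) (sym (∑-applyUpTo suc m (f ∘ h))))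

∑-upTo-suc : ∀ m (f : ℕ → ℤ) → ∑ (upTo (suc m)) f ≡ f 0 + ∑ (upTo m) (f ∘ suc)
∑-upTo-suc m f = cong (_+_ (f 0)) (∑-applyUpTo suc m f)

∑-upTo-last : ∀ m (f : ℕ → ℤ) → ∑ (upTo (suc m)) f ≡ ∑ (upTo m) f + f m
∑-upTo-last zero f = ℤₚ.+-comm (f 0) 0ℤ
∑-upTo-last (suc m) f = begin
  ∑ (upTo (suc (suc m))) f                      ≡⟨ ∑-upTo-suc (suc m) f ⟩
  f 0 + ∑ (upTo (suc m)) (f ∘ suc)              ≡⟨ cong (_+_ (f 0)) (∑-upTo-last m (f ∘ suc)) ⟩
  f 0 + (∑ (upTo m) (f ∘ suc) + f (suc m))      ≡⟨ sym (ℤₚ.+-assoc (f 0) _ _) ⟩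
  f 0 + ∑ (upTo m) (f ∘ suc) + f (suc m)        ≡⟨ cong (_+ f (suc m)) (sym (∑-upTo-suc m f)) ⟩
  ∑ (upTo (suc m)) f + f (suc m) ∎

∑-cong∈ : ∀ {A : Set} (xs : List A) {f g : A → ℤ} → (∀ x → x ∈ xs → f x ≡ g x) → ∑ xs f ≡ ∑ xs g
∑-cong∈ [] h = refl
∑-cong∈ (x ∷ xs) h = cong₂ _+_ (h x (here refl)) (∑-cong∈ xs (λ y y∈ → h y (there y∈)))

-- Counting list entries

count : ∀ {A : Set} → (A → Bool) → List A → ℕ
count p xs = length (filterB p xs)

count≤length : ∀ {A : Set} (p : A → Bool) xs → count p xs ≤ length xs
count≤length p [] = z≤n
count≤length p (x ∷ xs) with p x
... | true = s≤s (count≤length p xs)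
... | false = ℕₚ.m≤n⇒m≤1+n (count≤length p xs)

count-mono : ∀ {A : Set} {p q : A → Bool} → (∀ x → p x ≡ true → q x ≡ true) → ∀ xs → count p xs ≤ count q xs
count-mono h [] = z≤n
count-mono {p = p} {q} h (x ∷ xs) with p x in px | q x in qx
... | true | true = s≤s (count-mono h xs)
... | true | false = ⊥-elim (true≢false (h x px) qx)
... | false | true = ℕₚ.m≤n⇒m≤1+n (count-mono h xs)
... | false | false = count-mono h xs

count-strict : ∀ {A : Set} {p q : A → Bool} → (∀ x → p x ≡ true → q x ≡ true) →
  ∀ {y xs} → y ∈ xs → p y ≡ false → q y ≡ true → count p xs < count q xs
count-strict {p = p} {q} h {y} {.y ∷ xs} (here refl) py qy rewrite py | qy = s≤s (count-mono h xs)
count-strict {p = p} {q} h {y} {x ∷ xs} (there y∈) py qy with p x in px | q x in qx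
... | true | true = s≤s (count-strict h y∈ py qy)
... | true | false = ⊥-elim (true≢false (h x px) qx)
... | false | true = s≤s (ℕₚ.<⇒≤ (count-strict h y∈ py qy))
... | false | false = count-strict h y∈ py qy

count<length : ∀ {A : Set} (p : A → Bool) {y xs} → y ∈ xs → p y ≡ false → count p xs < length xs
count<length p {xs = x ∷ xs} (here refl) py rewrite py = s≤s (count≤length p xs)
count<length p {xs = x ∷ xs} (there y∈) py with p x
... | true = s≤s (count<length p y∈ py)
... | false = ℕₚ.m≤n⇒m≤1+n (count<length p y∈ py)

-- Euler characteristics of order complexes

module OrderComplex {A : Set} (els : List A) (lt : A → A → Bool)
  (lt-trans : ∀ {x y z} → lt x y ≡ true → lt y z ≡ true → lt x z ≡ true)
  (lt-irrefl : ∀ x → lt x x ≡ false) where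

  N : ℕ
  N = length els

  -- The number of `k`-element chains lying strictly below `y`, hence of chains with `k + 1`
  -- elements and top `y` when `y` is listed.
  chainsBelow : ℕ → A → ℤ
  chainsBelow zero y = 1ℤ
  chainsBelow (suc k) y = ∑ els (λ x → ⟦ lt x y ⟧ * chainsBelow k x)

  -- Extensionally the Möbius function from an adjoined bottom element.
  möbius : A → ℤ
  möbius y = ∑ (upTo (suc N)) (λ k → sign (suc k) * chainsBelow k y)

  -- Extending a chain looks only at its head, so a weight depending on the head alone is turned
  -- into another such weight. Arbitrary weights are allowed because the induction changes the
  -- weight at each step.
  ∑-chains : ∀ k (g : List A → ℤ) (G : A → ℤ) → (∀ x c → g (x ∷ c) ≡ G x) →
    ∑ (chains els lt (suc k)) g ≡ ∑ els (λ y → chainsBelow k y * G y)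
  ∑-chains zero g G h = begin
    ∑ (map (_∷ []) els ++ []) g       ≡⟨ cong (λ l → ∑ l g) (Listₚ.++-identityʳ (map (_∷ []) els)) ⟩
    ∑ (map (_∷ []) els) g             ≡⟨ ∑-map (_∷ []) els g ⟩
    ∑ els (λ y → g (y ∷ []))          ≡⟨ ∑-cong els (λ y → trans (h y []) (sym (ℤₚ.*-identityˡ (G y)))) ⟩
    ∑ els (λ y → 1ℤ * G y) ∎
  ∑-chains (suc k) g G h = begin
    ∑ (chains els lt (suc (suc k))) g
      ≡⟨ ∑-concatMap _ (chains els lt (suc k)) g ⟩
    ∑ (chains els lt (suc k)) _
      ≡⟨ ∑-chains k _ (λ x → ∑ els (λ y → ⟦ lt x y ⟧ * G y)) (λ x c → trans (∑-concatMap _ els g) (∑-cong els (step x c))) ⟩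
    ∑ els (λ x → chainsBelow k x * ∑ els (λ y → ⟦ lt x y ⟧ * G y))
      ≡⟨ ∑-cong els (λ x → sym (∑-*ˡ els (chainsBelow k x) (λ y → ⟦ lt x y ⟧ * G y))) ⟩
    ∑ els (λ x → ∑ els (λ y → chainsBelow k x * (⟦ lt x y ⟧ * G y)))
      ≡⟨ ∑-swap els els _ ⟩
    ∑ els (λ y → ∑ els (λ x → chainsBelow k x * (⟦ lt x y ⟧ * G y)))
      ≡⟨ ∑-cong els (λ y → trans (∑-cong els (λ x → rearrange (chainsBelow k x) ⟦ lt x y ⟧ (G y)))
           (∑-*ʳ els (G y) (λ x → ⟦ lt x y ⟧ * chainsBelow k x))) ⟩
    ∑ els (λ y → chainsBelow (suc k) y * G y) ∎
    where
    rearrange : ∀ a b c → a * (b * c) ≡ b * a * c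
    rearrange = solve-∀
    step : ∀ x c y → ∑ (if lt x y then (y ∷ x ∷ c) ∷ [] else []) g ≡ ⟦ lt x y ⟧ * G y
    step x c y with lt x y
    ... | true = trans (ℤₚ.+-identityʳ _) (trans (h y (x ∷ c)) (sym (ℤₚ.*-identityˡ (G y))))
    ... | false = refl

  length-chains : ∀ k → + length (chains els lt (suc k)) ≡ ∑ els (chainsBelow k)
  length-chains k = trans (∑-length (chains els lt (suc k)))
    (trans (∑-chains k _ (λ _ → 1ℤ) (λ _ _ → refl)) (∑-cong els (λ y → ℤₚ.*-identityʳ (chainsBelow k y))))

  height : A → ℕ
  height y = count (λ x → lt x y) els

  -- If `x` is below `y`, everything below `x` is below `y`, and `x` itself is one more element, so
  -- the height drops at each step down a chain.
  chainsBelow-height : ∀ k y → height y < k → chainsBelow k y ≡ 0ℤ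
  chainsBelow-height (suc k) y (s≤s h≤k) = trans (∑-cong∈ els vanish) (∑-zero els (λ _ → refl))
    where
    vanish : ∀ x → x ∈ els → ⟦ lt x y ⟧ * chainsBelow k x ≡ 0ℤ
    vanish x x∈ with lt x y in x<y
    ... | false = refl
    ... | true = trans (ℤₚ.*-identityˡ (chainsBelow k x)) (chainsBelow-height k x
            (ℕₚ.<-≤-trans (count-strict (λ z z<x → lt-trans z<x x<y) x∈ (lt-irrefl x) x<y) h≤k))

  -- Detaching the greatest element below `y` from a chain shifts the length by one and flips the
  -- sign. The two truncated sums differ only in one boundary term, which the height bound kills.
  möbius-rec : ∀ y → möbius y ≡ - (1ℤ + ∑ els (λ x → ⟦ lt x y ⟧ * möbius x))
  möbius-rec y = begin
    ∑ (upTo (suc N)) (λ k → sign (suc k) * chainsBelow k y)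
      ≡⟨ ∑-upTo-suc N (λ k → sign (suc k) * chainsBelow k y) ⟩
    sign 1 * 1ℤ + ∑ (upTo N) (λ k → sign (suc (suc k)) * chainsBelow (suc k) y)
      ≡⟨ cong (_+_ (sign 1 * 1ℤ)) (trans (∑-cong (upTo N) (λ k → neg (sign (suc k)) (chainsBelow (suc k) y)))
           (∑-*ˡ (upTo N) (- 1ℤ) (λ k → sign (suc k) * chainsBelow (suc k) y))) ⟩
    sign 1 * 1ℤ + (- 1ℤ) * rest
      ≡⟨ final rest ⟩
    - (1ℤ + rest)
      ≡⟨ cong (λ z → - (1ℤ + z)) (sym below) ⟩
    - (1ℤ + ∑ els (λ x → ⟦ lt x y ⟧ * möbius x)) ∎
    where
    rest : ℤ
    rest = ∑ (upTo N) (λ k → sign (suc k) * chainsBelow (suc k) y)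
    neg : ∀ a b → - a * b ≡ - 1ℤ * (a * b)
    neg = solve-∀
    final : ∀ a → - 1ℤ * 1ℤ + (- 1ℤ) * a ≡ - (1ℤ + a)
    final = solve-∀
    below : ∑ els (λ x → ⟦ lt x y ⟧ * möbius x) ≡ rest
    below = begin
      ∑ els (λ x → ⟦ lt x y ⟧ * möbius x)
        ≡⟨ ∑-cong els (λ x → sym (∑-*ˡ (upTo (suc N)) ⟦ lt x y ⟧ (λ k → sign (suc k) * chainsBelow k x))) ⟩
      ∑ els (λ x → ∑ (upTo (suc N)) (λ k → ⟦ lt x y ⟧ * (sign (suc k) * chainsBelow k x)))
        ≡⟨ ∑-swap els (upTo (suc N)) _ ⟩
      ∑ (upTo (suc N)) (λ k → ∑ els (λ x → ⟦ lt x y ⟧ * (sign (suc k) * chainsBelow k x)))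
        ≡⟨ ∑-cong (upTo (suc N)) (λ k → trans (∑-cong els (λ x → *-swapˡ ⟦ lt x y ⟧ (sign (suc k)) (chainsBelow k x)))
             (∑-*ˡ els (sign (suc k)) (λ x → ⟦ lt x y ⟧ * chainsBelow k x))) ⟩
      ∑ (upTo (suc N)) (λ k → sign (suc k) * chainsBelow (suc k) y)
        ≡⟨ ∑-upTo-last N (λ k → sign (suc k) * chainsBelow (suc k) y) ⟩
      rest + sign (suc N) * chainsBelow (suc N) y
        -- Here `y` need not be listed, so its height can be as large as `N`; the boundary term has
        -- length `N + 1`, just enough.
        ≡⟨ cong (λ z → rest + sign (suc N) * z) (chainsBelow-height (suc N) y (s≤s (count≤length _ els))) ⟩
      rest + sign (suc N) * 0ℤ
        ≡⟨ trans (cong (_+_ rest) (ℤₚ.*-zeroʳ (sign (suc N)))) (ℤₚ.+-identityʳ rest) ⟩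
      rest ∎

  -- Philip Hall's theorem: grouping chains by their top element gives the Möbius value at an
  -- adjoined greatest element.
  redEuler-möbius : redEuler els lt ≡ - (1ℤ + ∑ els möbius)
  redEuler-möbius = cong -_ (begin
    sumℤ (map (λ k → sign k * + length (chains els lt k)) (upTo (suc N)))
      ≡⟨ trans (sumℤ-map term (upTo (suc N))) (∑-upTo-suc N term) ⟩
    1ℤ + ∑ (upTo N) (λ k → sign (suc k) * + length (chains els lt (suc k)))
      ≡⟨ cong (_+_ 1ℤ) (∑-cong (upTo N) (λ k → cong (sign (suc k) *_) (length-chains k))) ⟩
    1ℤ + short
      ≡⟨ cong (_+_ 1ℤ) (sym total) ⟩
    1ℤ + ∑ els möbius ∎)
    where
    term : ℕ → ℤ
    term k = sign k * + length (chains els lt k)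
    short : ℤ
    short = ∑ (upTo N) (λ k → sign (suc k) * ∑ els (chainsBelow k))
    total : ∑ els möbius ≡ short
    total = begin
      ∑ els möbius
        ≡⟨ ∑-swap els (upTo (suc N)) _ ⟩
      ∑ (upTo (suc N)) (λ k → ∑ els (λ y → sign (suc k) * chainsBelow k y))
        ≡⟨ ∑-cong (upTo (suc N)) (λ k → ∑-*ˡ els (sign (suc k)) (chainsBelow k)) ⟩
      ∑ (upTo (suc N)) (λ k → sign (suc k) * ∑ els (chainsBelow k))
        ≡⟨ ∑-upTo-last N (λ k → sign (suc k) * ∑ els (chainsBelow k)) ⟩
      short + sign (suc N) * ∑ els (chainsBelow N)
        -- A listed `y` is not below itself, so its height is smaller than `N`.
        ≡⟨ cong (λ z → short + sign (suc N) * z) (trans (∑-cong∈ els (λ y y∈ →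
             chainsBelow-height N y (count<length (λ x → lt x y) y∈ (lt-irrefl y)))) (∑-zero els (λ _ → refl))) ⟩
      short + sign (suc N) * 0ℤ
        ≡⟨ trans (cong (_+_ short) (ℤₚ.*-zeroʳ (sign (suc N)))) (ℤₚ.+-identityʳ short) ⟩
      short ∎

-- Lattices of invariant partitions

vec-ext : ∀ {A : Set} {k} {u v : Vec A k} → (∀ i → lookup u i ≡ lookup v i) → u ≡ v
vec-ext {u = u} {v} h = trans (sym (Vecₚ.tabulate∘lookup u)) (trans (Vecₚ.tabulate-cong h) (Vecₚ.tabulate∘lookup v))

all₂-Fin : ∀ {n} {p : Fin n → Fin n → Bool} → all (λ i → all (p i) (allFin n)) (allFin n) ≡ true → ∀ i j → p i j ≡ true
all₂-Fin h i = all-Fin (all-Fin h i)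

all₂-intro : ∀ {n} {p : Fin n → Fin n → Bool} → (∀ i j → p i j ≡ true) → all (λ i → all (p i) (allFin n)) (allFin n) ≡ true
all₂-intro h = all-intro (allFin _) (λ i → all-intro (allFin _) (h i))

relFrom : ∀ {n} → (Fin n → Fin n → Bool) → Rel n
relFrom f = Vec.tabulate (λ i → Vec.tabulate (f i))

rel-relFrom : ∀ {n} (f : Fin n → Fin n → Bool) i j → rel (relFrom f) i j ≡ f i j
rel-relFrom f i j = trans (cong (λ v → lookup v j) (Vecₚ.lookup∘tabulate (λ i → Vec.tabulate (f i)) i)) (Vecₚ.lookup∘tabulate (f i) j)

rel-ext : ∀ {n} {R S : Rel n} → (∀ i j → rel R i j ≡ rel S i j) → R ≡ S
rel-ext h = vec-ext (λ i → vec-ext (h i))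

refines-true : ∀ {n} {R S : Rel n} → refines R S ≡ true → ∀ i j → rel R i j ≡ true → rel S i j ≡ true
refines-true h i j = ⇒-true (all₂-Fin h i j)

refines-intro : ∀ {n} {R S : Rel n} → (∀ i j → rel R i j ≡ true → rel S i j ≡ true) → refines R S ≡ true
refines-intro h = all₂-intro (λ i j → ⇒-intro (h i j))

refines-refl : ∀ {n} (R : Rel n) → refines R R ≡ true
refines-refl R = refines-intro {R = R} {R} (λ i j h → h)

refines-trans : ∀ {n} (R S Q : Rel n) → refines R S ≡ true → refines S Q ≡ true → refines R Q ≡ true
refines-trans R S Q p q = refines-intro {R = R} {Q} (λ i j h → refines-true {R = S} {Q} q i j (refines-true {R = R} {S} p i j h))

refines-antisym : ∀ {n} {R S : Rel n} → refines R S ≡ true → refines S R ≡ true → R ≡ S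
refines-antisym {R = R} {S} p q = rel-ext (λ i j → bool-ext (refines-true {R = R} {S} p i j) (refines-true {R = S} {R} q i j))

strictlyRefines-trans : ∀ {n} {R S Q : Rel n} → strictlyRefines R S ≡ true → strictlyRefines S Q ≡ true → strictlyRefines R Q ≡ true
strictlyRefines-trans {R = R} {S} {Q} p q with ∧-true p | ∧-true q
... | R≤S , S≰R | S≤Q , Q≰S = ∧-intro (refines-trans R S Q R≤S S≤Q) (Q≰R (refines Q R) refl)
  where
  Q≰R : ∀ b → refines Q R ≡ b → not b ≡ true
  Q≰R true eq = trans (cong not (sym (refines-trans Q R S eq R≤S))) Q≰S
  Q≰R false eq = refl

strictlyRefines-irrefl : ∀ {n} (R : Rel n) → strictlyRefines R R ≡ false
strictlyRefines-irrefl R rewrite refines-refl R = refl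

record Equivalence {n} (R : Rel n) : Set where
  field
    reflexive : ∀ i → rel R i i ≡ true
    symmetric : ∀ i j → rel R i j ≡ true → rel R j i ≡ true
    transitive : ∀ i j k → rel R i j ≡ true → rel R j k ≡ true → rel R i k ≡ true

isEquivalence-true : ∀ {n} {R : Rel n} → isEquivalence R ≡ true → Equivalence R
isEquivalence-true h with ∧-true h
... | r , st with ∧-true st
...   | s , t = record
  { reflexive = all-Fin r
  ; symmetric = λ i j → ⇒-true (all₂-Fin s i j)
  ; transitive = λ i j k p q → ⇒-true (all-Fin (all₂-Fin t i j) k) (∧-intro p q) }

isEquivalence-intro : ∀ {n} {R : Rel n} → Equivalence R → isEquivalence R ≡ true
isEquivalence-intro e = ∧-intro (all-intro (allFin _) reflexive) (∧-intro (all₂-intro (λ i j → ⇒-intro (symmetric i j)))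
  (all₂-intro (λ i j → all-intro (allFin _) (λ k → ⇒-intro (λ h → transitive i j k (proj₁ (∧-true h)) (proj₂ (∧-true h)))))))
  where open Equivalence e

isDiscrete-true : ∀ {n} {R : Rel n} → isDiscrete R ≡ true → ∀ i j → rel R i j ≡ (i ==F j)
isDiscrete-true h i j = ==B-true (all₂-Fin h i j)

isDiscrete-intro : ∀ {n} {R : Rel n} → (∀ i j → rel R i j ≡ (i ==F j)) → isDiscrete R ≡ true
isDiscrete-intro h = all₂-intro (λ i j → trans (cong (_==B (i ==F j)) (h i j)) (==B-refl (i ==F j)))

isIndiscrete-true : ∀ {n} {R : Rel n} → isIndiscrete R ≡ true → ∀ i j → rel R i j ≡ true
isIndiscrete-true = all₂-Fin

isIndiscrete-intro : ∀ {n} {R : Rel n} → (∀ i j → rel R i j ≡ true) → isIndiscrete R ≡ true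
isIndiscrete-intro = all₂-intro

all-toList-true : ∀ {A : Set} {k} {p : A → Bool} (v : Vec A k) → all p (toList v) ≡ true → ∀ i → p (lookup v i) ≡ true
all-toList-true (x ∷ v) h zero = proj₁ (∧-true h)
all-toList-true (x ∷ v) h (suc i) = all-toList-true v (proj₂ (∧-true h)) i

all-toList-intro : ∀ {A : Set} {k} {p : A → Bool} (v : Vec A k) → (∀ i → p (lookup v i) ≡ true) → all p (toList v) ≡ true
all-toList-intro [] h = refl
all-toList-intro (x ∷ v) h = ∧-intro (h zero) (all-toList-intro v (h ∘ suc))

Injectiveᵖ : ∀ {n} → Perm n → Set
Injectiveᵖ σ = ∀ i j → app σ i ≡ app σ j → i ≡ j

isBijective-true : ∀ {n} {σ : Perm n} → isBijective σ ≡ true → Injectiveᵖ σ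
isBijective-true {σ = σ} h i j eq = ==F-true (⇒-true (all₂-Fin h i j) (trans (cong (app σ i ==F_) (sym eq)) (==F-refl _)))

isBijective-intro : ∀ {n} {σ : Perm n} → Injectiveᵖ σ → isBijective σ ≡ true
isBijective-intro h = all₂-intro (λ i j → ⇒-intro (λ eq → trans (cong (i ==F_) (sym (h i j (==F-true eq)))) (==F-refl i)))

fixedBy-true : ∀ {n} {σ : Perm n} {R : Rel n} → fixedBy σ R ≡ true → ∀ i j → rel R (app σ i) (app σ j) ≡ rel R i j
fixedBy-true h i j = ==B-true (all₂-Fin h i j)

fixedBy-intro : ∀ {n} {σ : Perm n} {R : Rel n} → (∀ i j → rel R (app σ i) (app σ j) ≡ rel R i j) → fixedBy σ R ≡ true
fixedBy-intro {R = R} h = all₂-intro (λ i j → trans (cong (_==B rel R i j) (h i j)) (==B-refl (rel R i j)))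

==F-injective : ∀ {n} {σ : Perm n} → Injectiveᵖ σ → ∀ i j → (app σ i ==F app σ j) ≡ (i ==F j)
==F-injective {σ = σ} inj i j = bool-ext
  (λ h → trans (cong (i ==F_) (sym (inj i j (==F-true h)))) (==F-refl i))
  (λ h → trans (cong (λ k → app σ i ==F app σ k) (sym (==F-true h))) (==F-refl _))

allRels : ∀ n → List (Rel n)
allRels n = vecs (vecs bools n) n

allRels-enum : ∀ n → Enum (allRels n)
allRels-enum n = vecs-enum (vecs-enum bools-enum n) n

module FixedPartitions {n r} (X : Vec (Perm n) r) (X-inj : ∀ k → Injectiveᵖ (lookup X k))
  (i₀ i₁ : Fin n) (i₀≢i₁ : i₀ ≢ i₁) where

  isFixed : Rel n → Bool
  isFixed R = all (λ σ → fixedBy σ R) (toList X)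

  isInvariant : Rel n → Bool
  isInvariant R = isEquivalence R ∧ isFixed R

  open OrderComplex {A = Rel n} (fixedPoints X) strictlyRefines
    (λ {R} {S} {Q} → strictlyRefines-trans {R = R} {S} {Q}) strictlyRefines-irrefl using (möbius; möbius-rec; redEuler-möbius)

  -- The discrete partition is the bottom that `möbius` adjoins implicitly, so its own value must be
  -- 1; the formula for `möbius` would give -1 there.
  μ : Rel n → ℤ
  μ R = if isDiscrete R then 1ℤ else möbius R

  isProper : Rel n → Bool
  isProper R = not (isDiscrete R) ∧ not (isIndiscrete R)

  ∑-fixedPoints : ∀ f → ∑ (fixedPoints X) f ≡
    ∑ (allRels n) (λ R → ⟦ isEquivalence R ⟧ * (⟦ isProper R ⟧ * (⟦ isFixed R ⟧ * f R)))
  ∑-fixedPoints f = trans (∑-filterB isFixed (properPartitions n) f)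
    (trans (∑-filterB isProper (partitions n) _) (∑-filterB isEquivalence (allRels n) _))

  discrete : Rel n
  discrete = relFrom _==F_

  discrete-isDiscrete : isDiscrete discrete ≡ true
  discrete-isDiscrete = isDiscrete-intro {R = discrete} (rel-relFrom _==F_)

  isDiscrete⇒discrete : ∀ (R : Rel n) → isDiscrete R ≡ true → R ≡ discrete
  isDiscrete⇒discrete R h = rel-ext (λ i j → trans (isDiscrete-true {R = R} h i j) (sym (rel-relFrom _==F_ i j)))

  discrete-equivalence : Equivalence discrete
  discrete-equivalence = record
    { reflexive = λ i → to i i (==F-refl i)
    ; symmetric = λ i j h → to j i (trans (cong (j ==F_) (==F-true (from i j h))) (==F-refl j))
    ; transitive = λ i j k p q → subst (λ z → rel discrete i z ≡ true) (==F-true (from j k q)) p }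
    where
    to : ∀ i j → i ==F j ≡ true → rel discrete i j ≡ true
    to i j = trans (rel-relFrom _==F_ i j)
    from : ∀ i j → rel discrete i j ≡ true → i ==F j ≡ true
    from i j = trans (sym (rel-relFrom _==F_ i j))

  discrete-fixed : isFixed discrete ≡ true
  discrete-fixed = all-toList-intro X (λ k → fixedBy-intro {σ = lookup X k} {R = discrete} (λ i j →
    trans (rel-relFrom _==F_ (app (lookup X k) i) (app (lookup X k) j)) (trans (==F-injective {σ = lookup X k} (X-inj k) i j) (sym (rel-relFrom _==F_ i j)))))

  isDiscrete⇒refines : ∀ (R S : Rel n) → isDiscrete R ≡ true → Equivalence S → refines R S ≡ true
  isDiscrete⇒refines R S d e = refines-intro {R = R} {S} (λ i j h →
    subst (λ z → rel S i z ≡ true) (==F-true (trans (sym (isDiscrete-true {R = R} d i j)) h)) (Equivalence.reflexive e i))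

  isDiscrete⇒isEquivalence : ∀ (R : Rel n) → isDiscrete R ≡ true → isEquivalence R ≡ true
  isDiscrete⇒isEquivalence R d = subst (λ S → isEquivalence S ≡ true) (sym (isDiscrete⇒discrete R d))
    (isEquivalence-intro {R = discrete} discrete-equivalence)

  isDiscrete⇒isFixed : ∀ (R : Rel n) → isDiscrete R ≡ true → isFixed R ≡ true
  isDiscrete⇒isFixed R d = subst (λ S → isFixed S ≡ true) (sym (isDiscrete⇒discrete R d)) discrete-fixed

  -- The invariant partitions below κ are the discrete one, κ itself, and the proper ones strictly below κ.
  split : ∀ e f d i rk kr q x → (d ≡ true → e ≡ true × f ≡ true × rk ≡ true × q ≡ false) →
    (q ≡ true → e ≡ true × f ≡ true × rk ≡ true × kr ≡ true) →
    (rk ≡ true → kr ≡ true → q ≡ true) → (rk ≡ true → i ≡ true → q ≡ true) →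
    ⟦ e ∧ f ⟧ * (⟦ rk ⟧ * (if d then 1ℤ else x)) ≡
    ⟦ d ⟧ + (⟦ e ⟧ * (⟦ not d ∧ not i ⟧ * (⟦ f ⟧ * (⟦ rk ∧ not kr ⟧ * x))) + ⟦ q ⟧ * x)
  split e f true i rk kr q x hd hq _ _ with hd refl
  ... | refl , refl , refl , refl = refl
  split e f false i rk kr true x hd hq _ _ with hq refl
  ... | refl , refl , refl , refl = trans (ℤₚ.*-identityˡ (1ℤ * x)) (sym (trans (ℤₚ.+-identityˡ _)
    (trans (cong (_+ 1ℤ * x) (trans (ℤₚ.*-identityˡ (⟦ not i ⟧ * 0ℤ)) (ℤₚ.*-zeroʳ ⟦ not i ⟧))) (ℤₚ.+-identityˡ (1ℤ * x)))))
  split false f false i rk kr false x hd hq _ _ = refl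
  split true false false i rk kr false x hd hq _ _ = sym (cong (λ z → 0ℤ + (z + 0ℤ)) (trans (ℤₚ.*-identityˡ (⟦ not i ⟧ * 0ℤ)) (ℤₚ.*-zeroʳ ⟦ not i ⟧)))
  split true true false i false kr false x hd hq _ _ = sym (cong (λ z → 0ℤ + (z + 0ℤ)) (trans (ℤₚ.*-identityˡ (⟦ not i ⟧ * 0ℤ)) (ℤₚ.*-zeroʳ ⟦ not i ⟧)))
  split true true false i true true false x hd hq h _ with h refl refl
  ... | ()
  split true true false true true false false x hd hq _ h with h refl refl
  ... | ()
  split true true false false true false false x hd hq _ _ = lem x
    where
    lem : ∀ y → 1ℤ * (1ℤ * y) ≡ 0ℤ + (1ℤ * (1ℤ * (1ℤ * (1ℤ * y))) + 0ℤ * y)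
    lem = solve-∀

  isInvariant-elim : ∀ (R : Rel n) → isInvariant R ≡ true → Equivalence R × isFixed R ≡ true
  isInvariant-elim R h = isEquivalence-true {R = R} (proj₁ (∧-true h)) , proj₂ (∧-true {isEquivalence R} h)

  ∑-below-discrete : ∀ κ → isInvariant κ ≡ true → isDiscrete κ ≡ true →
    ∑ (allRels n) (λ R → ⟦ isInvariant R ⟧ * (⟦ refines R κ ⟧ * μ R)) ≡ 1ℤ
  ∑-below-discrete κ κ-inv κ-disc = trans (∑-point (allRels-enum n) κ _ supp) at-κ
    where
    at-κ : ⟦ isInvariant κ ⟧ * (⟦ refines κ κ ⟧ * μ κ) ≡ 1ℤ
    at-κ = trans (⟦⟧-true (⟦ refines κ κ ⟧ * μ κ) κ-inv) (trans (⟦⟧-true (μ κ) (refines-refl κ)) (cong (λ b → if b then 1ℤ else möbius κ) κ-disc))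
    supp : ∀ R → R ≢ κ → ⟦ isInvariant R ⟧ * (⟦ refines R κ ⟧ * μ R) ≡ 0ℤ
    supp R R≢κ = trans (⟦⟧-cong {isInvariant R} (λ R-inv → ⟦⟧-supported (μ R) (λ R≤κ → R≢κ (refines-antisym {R = R} {κ} R≤κ
      (isDiscrete⇒refines κ R κ-disc (proj₁ (isInvariant-elim R R-inv))))))) (ℤₚ.*-zeroʳ ⟦ isInvariant R ⟧)

  -- The recursion at `κ` makes its value cancel everything below it, the summand 1 of the recursion
  -- being the contribution of the discrete partition.
  ∑-below-nondiscrete : ∀ κ → isInvariant κ ≡ true → isDiscrete κ ≡ false →
    ∑ (allRels n) (λ R → ⟦ isInvariant R ⟧ * (⟦ refines R κ ⟧ * μ R)) ≡ 0ℤ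
  ∑-below-nondiscrete κ κ-inv κ-disc = begin
      ∑ (allRels n) (λ R → ⟦ isInvariant R ⟧ * (⟦ refines R κ ⟧ * μ R))
        ≡⟨ ∑-cong (allRels n) pointwise ⟩
      ∑ (allRels n) (λ R → ⟦ isDiscrete R ⟧ + (proper R + ⟦ R ≟κ ⟧ * möbius R))
        ≡⟨ trans (∑-+ (allRels n) (λ R → ⟦ isDiscrete R ⟧) (λ R → proper R + ⟦ R ≟κ ⟧ * möbius R))
             (cong (_+_ (∑ (allRels n) (λ R → ⟦ isDiscrete R ⟧))) (∑-+ (allRels n) proper (λ R → ⟦ R ≟κ ⟧ * möbius R))) ⟩
      ∑ (allRels n) (λ R → ⟦ isDiscrete R ⟧) + (∑ (allRels n) proper + ∑ (allRels n) (λ R → ⟦ R ≟κ ⟧ * möbius R))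
        ≡⟨ cong₂ _+_ (∑-unique₁ (allRels-enum n) isDiscrete discrete discrete-isDiscrete isDiscrete⇒discrete)
             (cong₂ _+_ (sym (∑-fixedPoints (λ R → ⟦ strictlyRefines R κ ⟧ * möbius R)))
               (∑-unique (allRels-enum n) _≟κ möbius κ (dec-true (Enum._≟_ (allRels-enum n) κ κ) refl)
                 (λ R → does-true (Enum._≟_ (allRels-enum n) R κ)))) ⟩
      1ℤ + (below + möbius κ)
        ≡⟨ cong (λ z → 1ℤ + (below + z)) (möbius-rec κ) ⟩
      1ℤ + (below + - (1ℤ + below))
        ≡⟨ cancel below ⟩
      0ℤ ∎
    where
    below : ℤ
    below = ∑ (fixedPoints X) (λ R → ⟦ strictlyRefines R κ ⟧ * möbius R)
    _≟κ : Rel n → Bool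
    R ≟κ = does (Enum._≟_ (allRels-enum n) R κ)
    proper : Rel n → ℤ
    proper R = ⟦ isEquivalence R ⟧ * (⟦ isProper R ⟧ * (⟦ isFixed R ⟧ * (⟦ strictlyRefines R κ ⟧ * möbius R)))
    cancel : ∀ a → 1ℤ + (a + - (1ℤ + a)) ≡ 0ℤ
    cancel = solve-∀
    κ-equivalence : Equivalence κ
    κ-equivalence = proj₁ (isInvariant-elim κ κ-inv)
    pointwise : ∀ R → ⟦ isInvariant R ⟧ * (⟦ refines R κ ⟧ * μ R) ≡ ⟦ isDiscrete R ⟧ + (proper R + ⟦ R ≟κ ⟧ * möbius R)
    pointwise R = split (isEquivalence R) (isFixed R) (isDiscrete R) (isIndiscrete R) (refines R κ) (refines κ R) (R ≟κ) (möbius R)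
      (λ d → isDiscrete⇒isEquivalence R d , isDiscrete⇒isFixed R d , isDiscrete⇒refines R κ d κ-equivalence ,
             dec-false (Enum._≟_ (allRels-enum n) R κ) (λ eq → true≢false (subst (λ S → isDiscrete S ≡ true) eq d) κ-disc))
      (λ q → is-κ R (does-true (Enum._≟_ (allRels-enum n) R κ) q))
      (λ p q → dec-true (Enum._≟_ (allRels-enum n) R κ) (refines-antisym {R = R} {κ} p q))
      -- The indiscrete partition is absent from `fixedPoints`; it can occur below `κ` only as `κ`
      -- itself.
      (λ p i → dec-true (Enum._≟_ (allRels-enum n) R κ) (refines-antisym {R = R} {κ} p (refines-intro {R = κ} {R} (λ a b _ → isIndiscrete-true {R = R} i a b))))
      where
      is-κ : ∀ R → R ≡ κ → isEquivalence R ≡ true × isFixed R ≡ true × refines R κ ≡ true × refines κ R ≡ true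
      is-κ .κ refl = proj₁ (∧-true κ-inv) , proj₂ (isInvariant-elim κ κ-inv) , refines-refl κ , refines-refl κ

  ∑-below : ∀ κ → isInvariant κ ≡ true →
    ∑ (allRels n) (λ R → ⟦ isInvariant R ⟧ * (⟦ refines R κ ⟧ * μ R)) ≡ ⟦ isDiscrete κ ⟧
  ∑-below κ κ-inv = cases (isDiscrete κ) refl
    where
    cases : ∀ b → isDiscrete κ ≡ b → ∑ (allRels n) (λ R → ⟦ isInvariant R ⟧ * (⟦ refines R κ ⟧ * μ R)) ≡ ⟦ b ⟧
    cases true = ∑-below-discrete κ κ-inv
    cases false = ∑-below-nondiscrete κ κ-inv

  indiscrete : Rel n
  indiscrete = relFrom (λ _ _ → true)

  isIndiscrete⇒indiscrete : ∀ (R : Rel n) → isIndiscrete R ≡ true → R ≡ indiscrete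
  isIndiscrete⇒indiscrete R h = rel-ext (λ i j → trans (isIndiscrete-true {R = R} h i j) (sym (rel-relFrom (λ _ _ → true) i j)))

  indiscrete-all : ∀ i j → rel indiscrete i j ≡ true
  indiscrete-all = rel-relFrom (λ _ _ → true)

  indiscrete-invariant : isInvariant indiscrete ≡ true
  indiscrete-invariant = ∧-intro (isEquivalence-intro {R = indiscrete} record
      { reflexive = λ i → indiscrete-all i i
      ; symmetric = λ i j _ → indiscrete-all j i
      ; transitive = λ i j k _ _ → indiscrete-all i k })
    (all-toList-intro X (λ k → fixedBy-intro {σ = lookup X k} {R = indiscrete} (λ i j → trans (indiscrete-all _ _) (sym (indiscrete-all i j)))))

  -- On a one-point set bottom and top would coincide; the two distinct points `i₀` and `i₁` exclude
  -- this.
  indiscrete-not-discrete : isDiscrete indiscrete ≡ false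
  indiscrete-not-discrete = ≢true⇒≡false (λ d → i₀≢i₁ (==F-true (trans (sym (isDiscrete-true {R = indiscrete} d i₀ i₁)) (indiscrete-all i₀ i₁))))

  strictlyRefines-indiscrete : ∀ (R : Rel n) → isIndiscrete R ≡ false → strictlyRefines R indiscrete ≡ true
  strictlyRefines-indiscrete R h = ∧-intro (refines-intro {R = R} {indiscrete} (λ i j _ → indiscrete-all i j))
    (cong not (≢true⇒≡false (λ q → true≢false (isIndiscrete-intro {R = R} (λ i j → refines-true {R = indiscrete} {R} q i j (indiscrete-all i j))) h)))

  -- Every proper partition lies strictly below the top, so the recursion there runs over the whole
  -- poset and becomes Hall's formula.
  μ-indiscrete : μ indiscrete ≡ redEuler (fixedPoints X) strictlyRefines
  μ-indiscrete = begin
    μ indiscrete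
      ≡⟨ cong (λ b → if b then 1ℤ else möbius indiscrete) indiscrete-not-discrete ⟩
    möbius indiscrete
      ≡⟨ möbius-rec indiscrete ⟩
    - (1ℤ + ∑ (fixedPoints X) (λ R → ⟦ strictlyRefines R indiscrete ⟧ * möbius R))
      ≡⟨ cong (λ z → - (1ℤ + z)) (trans (∑-fixedPoints (λ R → ⟦ strictlyRefines R indiscrete ⟧ * möbius R))
           (trans (∑-cong (allRels n) (λ R → cong (⟦ isEquivalence R ⟧ *_) (⟦⟧-cong {isProper R} (λ p →
              cong (⟦ isFixed R ⟧ *_) (⟦⟧-true (möbius R) (strictlyRefines-indiscrete R (not-ind R p)))))))
            (sym (∑-fixedPoints möbius)))) ⟩
    - (1ℤ + ∑ (fixedPoints X) möbius)
      ≡⟨ sym redEuler-möbius ⟩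
    redEuler (fixedPoints X) strictlyRefines ∎
    where
    not-ind : ∀ R → isProper R ≡ true → isIndiscrete R ≡ false
    not-ind R p = not-true (proj₂ (∧-true {not (isDiscrete R)} p))

  ∑-top : ∑ (allRels n) (λ R → ⟦ isInvariant R ⟧ * (⟦ isIndiscrete R ⟧ * μ R)) ≡ redEuler (fixedPoints X) strictlyRefines
  ∑-top = trans (∑-point (allRels-enum n) indiscrete _ supp) (trans at-top μ-indiscrete)
    where
    supp : ∀ R → R ≢ indiscrete → ⟦ isInvariant R ⟧ * (⟦ isIndiscrete R ⟧ * μ R) ≡ 0ℤ
    supp R R≢ = trans (cong (⟦ isInvariant R ⟧ *_) (⟦⟧-supported (μ R) (λ h → R≢ (isIndiscrete⇒indiscrete R h)))) (ℤₚ.*-zeroʳ ⟦ isInvariant R ⟧)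
    at-top : ⟦ isInvariant indiscrete ⟧ * (⟦ isIndiscrete indiscrete ⟧ * μ indiscrete) ≡ μ indiscrete
    at-top = trans (⟦⟧-true (⟦ isIndiscrete indiscrete ⟧ * μ indiscrete) indiscrete-invariant) (⟦⟧-true (μ indiscrete) (isIndiscrete-intro {R = indiscrete} indiscrete-all))

-- Test sets

iter : ∀ {A : Set} → (A → A) → ℕ → A → A
iter f zero x = x
iter f (suc k) x = f (iter f k x)

iter-+ : ∀ {A : Set} (f : A → A) k l x → iter f (k ℕ.+ l) x ≡ iter f k (iter f l x)
iter-+ f zero l x = refl
iter-+ f (suc k) l x = cong f (iter-+ f k l x)

iter-comm : ∀ {A : Set} (f : A → A) k l x → iter f k (iter f l x) ≡ iter f l (iter f k x)
iter-comm f k l x = trans (sym (iter-+ f k l x)) (trans (cong (λ m → iter f m x) (ℕₚ.+-comm k l)) (iter-+ f l k x))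

iter-injective : ∀ {A : Set} {f : A → A} → (∀ x y → f x ≡ f y → x ≡ y) → ∀ k {x y} → iter f k x ≡ iter f k y → x ≡ y
iter-injective inj zero eq = eq
iter-injective inj (suc k) eq = iter-injective inj k (inj _ _ eq)

shift : ∀ {e} → Fin (suc e) → Fin (suc e)
shift {e} i = suc (toℕ i) DM.mod suc e

toℕ-mod : ∀ k e → toℕ (k DM.mod suc e) ≡ k DM.% suc e
toℕ-mod k e = Finₚ.toℕ-fromℕ< (DM.m%n<n k (suc e))

suc-%-% : ∀ k e → suc (k DM.% suc e) DM.% suc e ≡ suc k DM.% suc e
suc-%-% k e = trans (sym (DM.[m+kn]%n≡m%n (suc (k DM.% suc e)) (k DM./ suc e) (suc e)))
  (cong (λ z → suc z DM.% suc e) (sym (DM.m≡m%n+[m/n]*n k (suc e))))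

toℕ-iter-shift : ∀ {e} k (i : Fin (suc e)) → toℕ (iter shift k i) ≡ (toℕ i ℕ.+ k) DM.% suc e
toℕ-iter-shift {e} zero i = sym (trans (cong (DM._% suc e) (ℕₚ.+-identityʳ (toℕ i))) (DM.m<n⇒m%n≡m (Finₚ.toℕ<n i)))
toℕ-iter-shift {e} (suc k) i = begin
  toℕ (shift (iter shift k i))                ≡⟨ toℕ-mod (suc (toℕ (iter shift k i))) e ⟩
  suc (toℕ (iter shift k i)) DM.% suc e       ≡⟨ cong (λ z → suc z DM.% suc e) (toℕ-iter-shift k i) ⟩
  suc ((toℕ i ℕ.+ k) DM.% suc e) DM.% suc e   ≡⟨ suc-%-% (toℕ i ℕ.+ k) e ⟩
  suc (toℕ i ℕ.+ k) DM.% suc e                ≡⟨ cong (DM._% suc e) (sym (ℕₚ.+-suc (toℕ i) k)) ⟩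
  (toℕ i ℕ.+ suc k) DM.% suc e ∎

iter-shift-period : ∀ {e} (i : Fin (suc e)) → iter shift (suc e) i ≡ i
iter-shift-period {e} i = Finₚ.toℕ-injective (trans (toℕ-iter-shift (suc e) i)
  (trans (DM.[m+n]%n≡m%n (toℕ i) (suc e)) (DM.m<n⇒m%n≡m (Finₚ.toℕ<n i))))

shift-injective : ∀ {e} (i j : Fin (suc e)) → shift i ≡ shift j → i ≡ j
shift-injective {e} i j eq = trans (sym (unshift i)) (trans (cong (iter shift e) eq) (unshift j))
  where
  unshift : ∀ k → iter shift e (shift k) ≡ k
  unshift k = trans (iter-comm shift e 1 k) (iter-shift-period k)

iter-shift-toℕ : ∀ {e} (i : Fin (suc e)) → iter shift (toℕ i) zero ≡ i
iter-shift-toℕ i = Finₚ.toℕ-injective (trans (toℕ-iter-shift (toℕ i) zero) (DM.m<n⇒m%n≡m (Finₚ.toℕ<n i)))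

iter-shift-∣ : ∀ {e k} → suc e ∣ k → iter (shift {e}) k zero ≡ zero
iter-shift-∣ {e} {k} d = Finₚ.toℕ-injective (trans (toℕ-iter-shift k zero) (Dv.n∣m⇒m%n≡0 k (suc e) d))

∣-iter-shift : ∀ {e k} → iter (shift {e}) k zero ≡ zero → suc e ∣ k
∣-iter-shift {e} {k} h = Dv.m%n≡0⇒n∣m k (suc e) (trans (sym (toℕ-iter-shift k zero)) (cong toℕ h))

-- Forward rotation reaches everything on a cycle: `suc e ∸ toℕ i` steps wrap from `i` around to
-- zero, and `toℕ j` more arrive at `j`.
shift-closed : ∀ {e} (c : Fin (suc e) → Bool) → (∀ i → c i ≡ true → c (shift i) ≡ true) → ∀ i → c i ≡ true → ∀ j → c j ≡ true
shift-closed {e} c closed i ci j = subst (λ k → c k ≡ true) reach (go (toℕ j) (go (suc e ∸ toℕ i) ci))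
  where
  go : ∀ k {i} → c i ≡ true → c (iter shift k i) ≡ true
  go zero h = h
  go (suc k) h = closed _ (go k h)
  to-zero : iter shift (suc e ∸ toℕ i) i ≡ zero
  to-zero = Finₚ.toℕ-injective (trans (toℕ-iter-shift (suc e ∸ toℕ i) i)
    (trans (cong (DM._% suc e) (ℕₚ.m+[n∸m]≡n (ℕₚ.<⇒≤ (Finₚ.toℕ<n i)))) (DM.n%n≡0 (suc e))))
  reach : iter shift (toℕ j) (iter shift (suc e ∸ toℕ i) i) ≡ j
  reach = trans (cong (iter shift (toℕ j)) to-zero) (iter-shift-toℕ j)

-- A set with r commuting bijections whose orbits, indexed by component, are t copies of one
-- transitive set of cardinality size, each containing exactly one base point.
record TestSet (t r : ℕ) : Set₁ where
  field
    Z : Set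
    elems : List Z
    enum : Enum elems
    acts : Fin r → Z → Z
    component : Z → Fin t
    isBase : Z → Bool
    point : Fin t → Z
    size : ℕ
    acts-injective : ∀ j z z′ → acts j z ≡ acts j z′ → z ≡ z′
    acts-comm : ∀ j k z → acts j (acts k z) ≡ acts k (acts j z)
    component-acts : ∀ j z → component (acts j z) ≡ component z
    component-point : ∀ τ → component (point τ) ≡ τ
    transitive : (c : Z → Bool) → (∀ j z → c z ≡ true → c (acts j z) ≡ true) →
      ∀ z z′ → component z ≡ component z′ → c z ≡ true → c z′ ≡ true
    ∑-component : ∀ τ → ∑ elems (λ z → ⟦ component z ==F τ ⟧) ≡ + size
    ∑-base : ∀ τ → ∑ elems (λ z → ⟦ component z ==F τ ⟧ * ⟦ isBase z ⟧) ≡ 1ℤ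

trivialTest : ∀ t → TestSet t 0
trivialTest t = record
  { Z = Fin t ; elems = allFin t ; enum = allFin-enum t
  ; acts = λ () ; component = id ; isBase = λ _ → true ; point = id ; size = 1
  ; acts-injective = λ () ; acts-comm = λ () ; component-acts = λ () ; component-point = λ _ → refl
  ; transitive = λ c _ z z′ eq h → subst (λ y → c y ≡ true) eq h
  ; ∑-component = one
  ; ∑-base = λ τ → trans (∑-cong (allFin t) (λ z → ℤₚ.*-identityʳ ⟦ z ==F τ ⟧)) (one τ) }
  where
  one : ∀ τ → ∑ (allFin t) (λ z → ⟦ z ==F τ ⟧) ≡ 1ℤ
  one τ = ∑-unique₁ (allFin-enum t) (_==F τ) τ (==F-refl τ) (λ z → ==F-true)

∑-const : ∀ {A : Set} (xs : List A) c → ∑ xs (λ _ → c) ≡ + length xs * c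
∑-const xs c = trans (∑-cong xs (λ _ → sym (ℤₚ.*-identityˡ c)))
  (trans (∑-*ʳ xs c (λ _ → 1ℤ)) (cong (_* c) (sym (∑-length xs))))

length-allFin : ∀ n → length (allFin n) ≡ n
length-allFin n = Listₚ.length-tabulate id

-- Choosing φ amounts to choosing a homomorphism ℤ^(1+r) → ℤ/(1+e) that sends the first generator to 1.
extend : ∀ {t r} → TestSet t r → (e : ℕ) → Vec (Fin (suc e)) r → TestSet t (suc r)
extend {t} {r} F e φ = record
  { Z = Z × Fin (suc e) ; elems = pairs elems (allFin (suc e)) ; enum = pairs-enum enum (allFin-enum (suc e))
  ; acts = acts′ ; component = component ∘ proj₁
  ; isBase = λ z → isBase (proj₁ z) ∧ (proj₂ z ==F zero)
  ; point = λ τ → point τ , zero ; size = size ℕ.* suc e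
  ; acts-injective = acts′-injective ; acts-comm = acts′-comm
  ; component-acts = λ { zero z → refl ; (suc j) z → component-acts j (proj₁ z) }
  ; component-point = component-point
  ; transitive = transitive′
  ; ∑-component = λ τ → trans (∑-pairs elems (allFin (suc e)) _) (trans (∑-cong elems (λ z →
      trans (∑-const (allFin (suc e)) ⟦ component z ==F τ ⟧) (cong (λ k → + k * ⟦ component z ==F τ ⟧) (length-allFin (suc e)))))
      (trans (∑-*ˡ elems (+ suc e) (λ z → ⟦ component z ==F τ ⟧)) (trans (cong (+ suc e *_) (∑-component τ))
        (trans (ℤₚ.*-comm (+ suc e) (+ size)) (sym (ℤₚ.pos-* size (suc e)))))))
  ; ∑-base = λ τ → trans (∑-pairs elems (allFin (suc e)) _) (trans (∑-cong elems (λ z → base-fibre z τ)) (∑-base τ)) }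
  where
  open TestSet F
  acts′ : Fin (suc r) → Z × Fin (suc e) → Z × Fin (suc e)
  acts′ zero (z , i) = z , shift i
  acts′ (suc j) (z , i) = acts j z , iter shift (toℕ (lookup φ j)) i
  acts′-injective : ∀ j z z′ → acts′ j z ≡ acts′ j z′ → z ≡ z′
  acts′-injective zero (z , i) (z′ , i′) eq = cong₂ _,_ (cong proj₁ eq) (shift-injective i i′ (cong proj₂ eq))
  acts′-injective (suc j) (z , i) (z′ , i′) eq = cong₂ _,_ (acts-injective j z z′ (cong proj₁ eq))
    (iter-injective shift-injective (toℕ (lookup φ j)) (cong proj₂ eq))
  acts′-comm : ∀ j k z → acts′ j (acts′ k z) ≡ acts′ k (acts′ j z)
  acts′-comm zero zero z = refl
  acts′-comm zero (suc k) (z , i) = cong (acts k z ,_) (iter-comm shift 1 (toℕ (lookup φ k)) i)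
  acts′-comm (suc j) zero (z , i) = cong (acts j z ,_) (iter-comm shift (toℕ (lookup φ j)) 1 i)
  acts′-comm (suc j) (suc k) (z , i) = cong₂ _,_ (acts-comm j k z) (iter-comm shift (toℕ (lookup φ j)) (toℕ (lookup φ k)) i)
  -- The new generator sweeps out each fibre, so a closed set meeting a fibre contains it. It is
  -- therefore determined by its trace on level zero, which is closed under the old generators.
  transitive′ : (c : Z × Fin (suc e) → Bool) → (∀ j z → c z ≡ true → c (acts′ j z) ≡ true) →
    ∀ z z′ → component (proj₁ z) ≡ component (proj₁ z′) → c z ≡ true → c z′ ≡ true
  transitive′ c closed (z , i) (z′ , i′) eq h = rotate z′ zero
    (transitive (λ y → c (y , zero)) (λ j y cy → rotate (acts j y) _ (closed (suc j) (y , zero) cy) zero) z z′ eq (rotate z i h zero)) i′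
    where
    rotate : ∀ y i → c (y , i) ≡ true → ∀ i′ → c (y , i′) ≡ true
    rotate y = shift-closed (λ i → c (y , i)) (λ i → closed zero (y , i))
  base-fibre : ∀ z τ → ∑ (allFin (suc e)) (λ i → ⟦ component z ==F τ ⟧ * ⟦ isBase z ∧ (i ==F zero) ⟧) ≡ ⟦ component z ==F τ ⟧ * ⟦ isBase z ⟧
  base-fibre z τ = begin
    ∑ (allFin (suc e)) (λ i → ⟦ component z ==F τ ⟧ * ⟦ isBase z ∧ (i ==F zero) ⟧)
      ≡⟨ ∑-cong (allFin (suc e)) (λ i → trans (cong (⟦ component z ==F τ ⟧ *_) (⟦∧⟧ (isBase z) (i ==F zero)))
           (rearrange ⟦ component z ==F τ ⟧ ⟦ isBase z ⟧ ⟦ i ==F zero ⟧)) ⟩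
    ∑ (allFin (suc e)) (λ i → ⟦ i ==F zero ⟧ * (⟦ component z ==F τ ⟧ * ⟦ isBase z ⟧))
      ≡⟨ ∑-unique (allFin-enum (suc e)) (_==F zero) (λ _ → ⟦ component z ==F τ ⟧ * ⟦ isBase z ⟧) zero refl (λ i → ==F-true) ⟩
    ⟦ component z ==F τ ⟧ * ⟦ isBase z ⟧ ∎
    where
    rearrange : ∀ a b c → a * (b * c) ≡ c * (a * b)
    rearrange = solve-∀

-- Weighted sums over test sets

module WeightedTests (n : ℕ) (μ : ℕ → ℤ) (t : ℕ) where

  -- The sum over all cycle lengths from 1 to `n` and all unitriangular entries. Test sets form a
  -- large type and cannot be the entries of a list summed by `∑`, hence a recursive functional,
  -- whose linearity is established below.
  testSum : ∀ r → (TestSet t r → ℤ) → ℤ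
  testSum zero G = G (trivialTest t)
  testSum (suc r) G = ∑ (upTo n) (λ e → μ (suc e) * ∑ (vecs (allFin (suc e)) r) (λ φ → testSum r (λ F → G (extend F e φ))))

  testSum-cong : ∀ r {G G′ : TestSet t r → ℤ} → (∀ F → G F ≡ G′ F) → testSum r G ≡ testSum r G′
  testSum-cong zero h = h _
  testSum-cong (suc r) h = ∑-cong (upTo n) (λ e → cong (μ (suc e) *_) (∑-cong (vecs (allFin (suc e)) r) (λ φ →
    testSum-cong r (λ F → h (extend F e φ)))))

  testSum-+ : ∀ r (G G′ : TestSet t r → ℤ) → testSum r (λ F → G F + G′ F) ≡ testSum r G + testSum r G′
  testSum-+ zero G G′ = refl
  testSum-+ (suc r) G G′ = trans (∑-cong (upTo n) (λ e → trans (cong (μ (suc e) *_) (trans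
      (∑-cong (vecs (allFin (suc e)) r) (λ φ → testSum-+ r (λ F → G (extend F e φ)) (λ F → G′ (extend F e φ))))
      (∑-+ (vecs (allFin (suc e)) r) (λ φ → testSum r (λ F → G (extend F e φ))) (λ φ → testSum r (λ F → G′ (extend F e φ))))))
      (ℤₚ.*-distribˡ-+ (μ (suc e)) _ _)))
    (∑-+ (upTo n) _ _)

  testSum-0 : ∀ r → testSum r (λ _ → 0ℤ) ≡ 0ℤ
  testSum-0 zero = refl
  testSum-0 (suc r) = ∑-zero (upTo n) (λ e → trans (cong (μ (suc e) *_) (∑-zero (vecs (allFin (suc e)) r) (λ φ → testSum-0 r)))
    (ℤₚ.*-zeroʳ (μ (suc e))))

  testSum-*ˡ : ∀ r c (G : TestSet t r → ℤ) → testSum r (λ F → c * G F) ≡ c * testSum r G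
  testSum-*ˡ zero c G = refl
  testSum-*ˡ (suc r) c G = trans (∑-cong (upTo n) (λ e → trans (cong (μ (suc e) *_) (trans
      (∑-cong (vecs (allFin (suc e)) r) (λ φ → testSum-*ˡ r c (λ F → G (extend F e φ))))
      (∑-*ˡ (vecs (allFin (suc e)) r) c (λ φ → testSum r (λ F → G (extend F e φ))))))
      (*-swapˡ (μ (suc e)) c (inner e))))
    (∑-*ˡ (upTo n) c (λ e → μ (suc e) * inner e))
    where
    inner : ℕ → ℤ
    inner e = ∑ (vecs (allFin (suc e)) r) (λ φ → testSum r (λ F → G (extend F e φ)))

  testSum-∑ : ∀ {A : Set} r (xs : List A) (G : A → TestSet t r → ℤ) →
    testSum r (λ F → ∑ xs (λ x → G x F)) ≡ ∑ xs (λ x → testSum r (G x))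
  testSum-∑ r [] G = testSum-0 r
  testSum-∑ r (x ∷ xs) G = trans (testSum-+ r (G x) _) (cong (_+_ (testSum r (G x))) (testSum-∑ r xs G))

-- Detecting transitivity

BRel : ℕ → Set
BRel n = Fin n → Fin n → Bool

Compatible : ∀ {n} {A : Set} → BRel n → Vec A n → Set
Compatible R f = ∀ i j → R i j ≡ true → lookup f i ≡ lookup f j

compatible? : ∀ {n} {A : Set} → DecidableEquality A → (R : BRel n) (f : Vec A n) → Dec (Compatible R f)
compatible? _≟_ R f = Finₚ.all? (λ i → Finₚ.all? (λ j → (R i j Bool.≟ true) →-dec (lookup f i ≟ lookup f j)))

record Generated {n} (R : BRel n) (i j : Fin n) : Set where
  constructor generates
  field
    agree : (c : Vec Bool n) → Compatible R c → lookup c i ≡ lookup c j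

open Generated

-- Decides whether i and j are related by the equivalence relation generated by R, which is
-- the intersection of the kernels of the two-valued functions that R does not separate.
generated : ∀ {n} → BRel n → Fin n → Fin n → Bool
generated {n} R i j = all (λ c → does (compatible? Bool._≟_ R c →-dec (lookup c i Bool.≟ lookup c j))) (vecs bools n)

generated-true : ∀ {n} {R : BRel n} {i j} → generated R i j ≡ true → Generated R i j
generated-true {n} {R} {i} {j} h = generates λ c → does-true (compatible? Bool._≟_ R c →-dec (lookup c i Bool.≟ lookup c j))
  (all-true (vecs-enum bools-enum n) h c)

generated-intro : ∀ {n} {R : BRel n} {i j} → Generated R i j → generated R i j ≡ true
generated-intro {n} {R} {i} {j} h = all-intro (vecs bools n) (λ c →
  dec-true (compatible? Bool._≟_ R c →-dec (lookup c i Bool.≟ lookup c j)) (agree h c))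

-- Two-valued functions are enough to test agreement in any decidable type: apply the definition to
-- the indicator of the level set of `f` through `i`.
Generated-elim : ∀ {n} {A : Set} (R : BRel n) → DecidableEquality A → ∀ (f : Vec A n) → Compatible R f →
  ∀ {i j} → Generated R i j → lookup f i ≡ lookup f j
Generated-elim R _≟_ f comp {i} {j} h = sym (does-true (lookup f j ≟ lookup f i)
  (trans (sym (at j)) (trans (sym (agree h c c-comp)) (trans (at i) (dec-true (lookup f i ≟ lookup f i) refl)))))
  where
  c = Vec.tabulate (λ k → does (lookup f k ≟ lookup f i))
  at : ∀ k → lookup c k ≡ does (lookup f k ≟ lookup f i)
  at = Vecₚ.lookup∘tabulate (λ k → does (lookup f k ≟ lookup f i))
  c-comp : Compatible R c
  c-comp a b Rab = trans (at a) (trans (cong (λ z → does (z ≟ lookup f i)) (comp a b Rab)) (sym (at b)))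

Preserves : ∀ {n} → (Fin n → Fin n) → BRel n → Set
Preserves g R = ∀ i j → R i j ≡ true → R (g i) (g j) ≡ true

-- A compatible function remains compatible after composition with `g`, so a function separating the
-- images would separate the original points.
Generated-preserved : ∀ {n} {R : BRel n} {g} → Preserves g R → ∀ {i j} → Generated R i j → Generated R (g i) (g j)
Generated-preserved {R = R} {g} pres {i} {j} h = generates agree′
  where
  module _ (c : Vec Bool _) (comp : Compatible R c) where
    c∘g = λ k → lookup c (g k)
    comp′ : Compatible R (Vec.tabulate c∘g)
    comp′ a b Rab = trans (Vecₚ.lookup∘tabulate c∘g a) (trans (comp (g a) (g b) (pres a b Rab)) (sym (Vecₚ.lookup∘tabulate c∘g b)))
    agree′ : lookup c (g i) ≡ lookup c (g j)
    agree′ = trans (sym (Vecₚ.lookup∘tabulate c∘g i)) (trans (agree h (Vec.tabulate c∘g) comp′) (Vecₚ.lookup∘tabulate c∘g j))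

connected : ∀ {n} → BRel n → Bool
connected {n} R = all (λ i → all (generated R i) (allFin n)) (allFin n)

connected-true : ∀ {n} {R : BRel n} → connected R ≡ true → ∀ i j → Generated R i j
connected-true {R = R} h i j = generated-true {R = R} (all₂-Fin h i j)

connected-intro : ∀ {n} {R : BRel n} → (∀ i j → Generated R i j) → connected R ≡ true
connected-intro {R = R} h = all₂-intro (λ i j → generated-intro {R = R} (h i j))

infixl 6 _∪graph_
-- Absorbs a generator into the relation: compatible functions are those constant along `R` and
-- along the orbits of `x`.
_∪graph_ : ∀ {n} → BRel n → Perm n → BRel n
(R ∪graph x) i j = R i j ∨ (app x i ==F j)

∨-trueˡ : ∀ {a b} → a ≡ true → a ∨ b ≡ true
∨-trueˡ refl = refl

∨-trueʳ : ∀ a {b} → b ≡ true → a ∨ b ≡ true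
∨-trueʳ true h = refl
∨-trueʳ false h = h

∨-true : ∀ a {b} → a ∨ b ≡ true → a ≡ true ⊎ b ≡ true
∨-true true h = inj₁ refl
∨-true false h = inj₂ h

∪graph-compatible : ∀ {n} {A : Set} {R : BRel n} {x} {f : Vec A n} → Compatible R f →
  (∀ i → lookup f (app x i) ≡ lookup f i) → Compatible (R ∪graph x) f
∪graph-compatible {R = R} {f = f} comp inv i j h with ∨-true (R i j) h
... | inj₁ Rij = comp i j Rij
... | inj₂ eq = trans (sym (inv i)) (cong (lookup f) (==F-true eq))

∪graph-compatibleˡ : ∀ {n} {A : Set} {R : BRel n} {x} {f : Vec A n} → Compatible (R ∪graph x) f → Compatible R f
∪graph-compatibleˡ comp i j Rij = comp i j (∨-trueˡ Rij)

∪graph-compatibleʳ : ∀ {n} {A : Set} {R : BRel n} {x} {f : Vec A n} → Compatible (R ∪graph x) f → ∀ i → lookup f (app x i) ≡ lookup f i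
∪graph-compatibleʳ {R = R} {x} comp i = sym (comp i (app x i) (∨-trueʳ (R i (app x i)) (==F-refl (app x i))))

Commute : ∀ {n} → Perm n → Perm n → Set
Commute x y = ∀ s → app x (app y s) ≡ app y (app x s)

∪graph-preserved : ∀ {n} {R : BRel n} {x y : Perm n} → Commute x y → Preserves (app y) R → Preserves (app y) (R ∪graph x)
∪graph-preserved {R = R} {x} {y} xy pres i j h with ∨-true (R i j) h
... | inj₁ Rij = ∨-trueˡ (pres i j Rij)
... | inj₂ eq = ∨-trueʳ (R (app y i) (app y j)) (trans (cong (_==F app y j) (trans (xy i) (cong (app y) (==F-true eq)))) (==F-refl (app y j)))

least : (p : ℕ → Bool) → ∀ k → p k ≡ true → ∃ λ m → p m ≡ true × m ≤ k × (∀ j → j < m → p j ≡ false)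
least p k pk with p 0 in p0
... | true = 0 , p0 , z≤n , λ j ()
least p zero pk | false = ⊥-elim (true≢false pk p0)
least p (suc k) pk | false with least (p ∘ suc) k pk
... | m , pm , m≤k , below = suc m , pm , s≤s m≤k , λ { zero _ → p0 ; (suc j) (s≤s j<m) → below j j<m }

-- Two of the first `n + 1` iterates coincide, and injectivity cancels the common initial steps. The
-- bound on the period keeps the later cycle length within the range of `testSum`.
orbit-period : ∀ {n} (x : Perm n) → Injectiveᵖ x → ∀ i → ∃ λ k → iter (app x) (suc k) i ≡ i × suc k ≤ n
orbit-period {n} x inj i with Finₚ.pigeonhole (ℕₚ.n<1+n n) (λ (k : Fin (suc n)) → iter (app x) (toℕ k) i)
... | a , b , a<b , eq = toℕ b ∸ suc (toℕ a) , period , bound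
  where
  b≡ : toℕ b ≡ toℕ a ℕ.+ suc (toℕ b ∸ suc (toℕ a))
  b≡ = sym (trans (ℕₚ.+-suc (toℕ a) _) (ℕₚ.m+[n∸m]≡n a<b))
  period : iter (app x) (suc (toℕ b ∸ suc (toℕ a))) i ≡ i
  period = sym (iter-injective inj (toℕ a) (trans eq (trans (cong (λ m → iter (app x) m i) b≡) (iter-+ (app x) (toℕ a) (suc (toℕ b ∸ suc (toℕ a))) i))))
  bound : suc (toℕ b ∸ suc (toℕ a)) ≤ n
  bound = ℕₚ.≤-trans (ℕₚ.m≤n+m _ (toℕ a)) (subst (_≤ n) b≡ (ℕₚ.≤-pred (Finₚ.toℕ<n b)))

Rotation : ∀ {n r e} → Perm n → (Fin r → Perm n) → Vec (Fin (suc e)) r → Vec (Fin (suc e)) n → Set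
Rotation {n} {r} {e} x X φ v = (∀ s → lookup v (app x s) ≡ shift (lookup v s)) ×
  (∀ j s → lookup v (app (X j) s) ≡ iter shift (toℕ (lookup φ j)) (lookup v s))

record PointedRotation {n r e} (x : Perm (suc n)) (X : Fin r → Perm (suc n)) (R : BRel (suc n))
  (φ : Vec (Fin (suc e)) r) (v : Vec (Fin (suc e)) (suc n)) : Set where
  constructor pointed
  field
    rotation : Rotation x X φ v
    base : lookup v zero ≡ zero
    compatible : Compatible R v

pointedRotation? : ∀ {n r e} x X R φ v → Dec (PointedRotation {n} {r} {e} x X R φ v)
pointedRotation? x X R φ v = map′ (λ (rot , base , comp) → pointed rot base comp) (λ (pointed rot base comp) → rot , base , comp)
  ((Finₚ.all? (λ s → lookup v (app x s) Fin.≟ shift (lookup v s))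
    ×-dec Finₚ.all? (λ j → Finₚ.all? (λ s → lookup v (app (X j) s) Fin.≟ iter shift (toℕ (lookup φ j)) (lookup v s))))
  ×-dec ((lookup v zero Fin.≟ zero) ×-dec compatible? Fin._≟_ R v))

-- When R and x together connect everything, the quotient by R is a single x-cycle of some length u.
module Cyclic {n r} (x : Perm (suc n)) (X : Fin r → Perm (suc n)) (R : BRel (suc n)) (x-inj : Injectiveᵖ x)
  (xX : ∀ j → Commute x (X j)) (x-pres : Preserves (app x) R) (X-pres : ∀ j → Preserves (app (X j)) R)
  (conn : connected (R ∪graph x) ≡ true) where

  orb : ℕ → Fin (suc n)
  orb k = iter (app x) k zero

  infix 4 _~_
  _~_ : Fin (suc n) → Fin (suc n) → Set
  _~_ = Generated R

  ~-refl : ∀ {i} → i ~ i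
  ~-refl = generates λ c comp → refl

  ~-sym : ∀ {i j} → i ~ j → j ~ i
  ~-sym h = generates λ c comp → sym (agree h c comp)

  ~-trans : ∀ {i j k} → i ~ j → j ~ k → i ~ k
  ~-trans h h′ = generates λ c comp → trans (agree h c comp) (agree h′ c comp)

  ~-reflexive : ∀ {i j} → i ≡ j → i ~ j
  ~-reflexive refl = ~-refl

  ~-iter : ∀ k {i j} → i ~ j → iter (app x) k i ~ iter (app x) k j
  ~-iter zero h = h
  ~-iter (suc k) h = Generated-preserved {R = R} {app x} x-pres (~-iter k h)

  abstract
    -- The first return of the `x`-orbit of zero to its `R`-class. The exact period of zero is one
    -- such return and bounds the search.
    first : ∃ λ m → generated R (orb (suc m)) zero ≡ true × m ≤ proj₁ (orbit-period x x-inj zero) ×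
      (∀ j → j < m → generated R (orb (suc j)) zero ≡ false)
    first = least (λ k → generated R (orb (suc k)) zero) (proj₁ (orbit-period x x-inj zero))
      (generated-intro {R = R} (~-reflexive (proj₁ (proj₂ (orbit-period x x-inj zero)))))

  u : ℕ
  u = suc (proj₁ first)

  u≤ : u ≤ suc n
  u≤ = ℕₚ.≤-trans (s≤s (proj₁ (proj₂ (proj₂ first)))) (proj₂ (proj₂ (orbit-period x x-inj zero)))

  orb-u : orb u ~ zero
  orb-u = generated-true {R = R} (proj₁ (proj₂ first))

  orb-multiple : ∀ k → orb (k ℕ.* u) ~ zero
  orb-multiple zero = ~-refl
  orb-multiple (suc k) = ~-trans (~-reflexive (iter-+ (app x) u (k ℕ.* u) zero)) (~-trans (~-iter u (orb-multiple k)) orb-u)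

  orb-mod : ∀ k → orb k ~ orb (k DM.% u)
  orb-mod k = ~-trans (~-reflexive (trans (cong orb (DM.m≡m%n+[m/n]*n k u)) (iter-+ (app x) (k DM.% u) (k DM./ u ℕ.* u) zero)))
    (~-iter (k DM.% u) (orb-multiple (k DM./ u)))

  -- A nonzero remainder of `k` modulo `u` would be a return time earlier than the first one.
  u∣ : ∀ k → orb k ~ zero → u ∣ k
  u∣ k h = cases (k DM.% u) refl
    where
    cases : ∀ m → k DM.% u ≡ m → u ∣ k
    cases zero eq = Dv.m%n≡0⇒n∣m k u eq
    cases (suc m) eq = ⊥-elim (true≢false (generated-intro {R = R} (~-trans (~-sym (~-trans (orb-mod k) (~-reflexive (cong orb eq)))) h))
      (proj₂ (proj₂ (proj₂ first)) m (ℕₚ.≤-pred (subst (_< u) eq (DM.m%n<n k u)))))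

  abstract
    reached? : ∀ s → Dec (∃ λ (k : Fin u) → generated R (orb (toℕ k)) s ≡ true)
    reached? s = Finₚ.any? (λ k → generated R (orb (toℕ k)) s Bool.≟ true)

  reached : Fin (suc n) → Bool
  reached s = does (reached? s)

  reach-intro : ∀ s k → orb k ~ s → reached s ≡ true
  reach-intro s k h = dec-true (reached? s) (k DM.mod u , generated-intro {R = R}
    (~-trans (~-reflexive (cong orb (toℕ-mod k (proj₁ first)))) (~-trans (~-sym (orb-mod k)) h)))

  reach-elim : ∀ s → reached s ≡ true → ∃ λ k → orb k ~ s
  reach-elim s h = let (k , g) = does-true (reached? s) h in toℕ k , generated-true {R = R} g

  reached-vec : Vec Bool (suc n)
  reached-vec = Vec.tabulate reached

  reached-cong : ∀ i j → (∀ k → orb k ~ i → ∃ λ l → orb l ~ j) → (∀ k → orb k ~ j → ∃ λ l → orb l ~ i) →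
    lookup reached-vec i ≡ lookup reached-vec j
  reached-cong i j f g = trans (Vecₚ.lookup∘tabulate reached i) (trans (bool-ext
    (λ h → let (k , p) = reach-elim i h ; (l , q) = f k p in reach-intro j l q)
    (λ h → let (k , p) = reach-elim j h ; (l , q) = g k p in reach-intro i l q)) (sym (Vecₚ.lookup∘tabulate reached j)))

  -- Only forward powers of `x` are at hand, so one step is undone by completing the period of `i`.
  reached-back : ∀ i k → orb k ~ app x i → ∃ λ l → orb l ~ i
  reached-back i k h = let (p , eq , _) = orbit-period x x-inj i in p ℕ.+ k ,
    ~-trans (~-reflexive (iter-+ (app x) p k zero)) (~-trans (~-iter p h) (~-reflexive (trans (iter-comm (app x) p 1 i) eq)))

  -- The classes met by the orbit of zero form a set closed under `R` and `x` in both directions;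
  -- connectedness then makes it everything.
  reached-compatible : Compatible (R ∪graph x) reached-vec
  reached-compatible = ∪graph-compatible {R = R} {x} {reached-vec}
    (λ i j Rij → reached-cong i j (λ k h → k , ~-trans h (generates λ c comp → comp i j Rij))
      (λ k h → k , ~-trans h (generates λ c comp → sym (comp i j Rij))))
    (λ i → reached-cong (app x i) i (reached-back i) (λ k h → suc k , ~-iter 1 h))

  abstract
    reaches : ∀ s → ∃ λ k → orb k ~ s
    reaches s = reach-elim s (trans (sym (Vecₚ.lookup∘tabulate reached s))
      (trans (sym (agree (connected-true {R = R ∪graph x} conn zero s) reached-vec reached-compatible))
        (trans (Vecₚ.lookup∘tabulate reached zero) (reach-intro zero 0 ~-refl))))

  rep : Fin (suc n) → ℕ
  rep s = proj₁ (reaches s)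

  u≡1⇒connected : u ≡ 1 → connected R ≡ true
  u≡1⇒connected eq = connected-intro {R = R} (λ i j → ~-trans (~-sym (all-base i)) (all-base j))
    where
    all-base : ∀ s → zero ~ s
    all-base s = let (k , h) = reaches s in ~-trans (~-sym (subst (λ m → orb m ~ zero) (trans (cong (k ℕ.*_) eq) (ℕₚ.*-identityʳ k)) (orb-multiple k))) h

  connected⇒u≡1 : connected R ≡ true → u ≡ 1
  connected⇒u≡1 h = Dv.∣1⇒≡1 (u∣ 1 (connected-true {R = R} h _ _))

  module _ (e : ℕ) where

    d : ℕ
    d = suc e

    rotation-orb : ∀ {φ v} → PointedRotation {e = e} x X R φ v → ∀ k → lookup v (orb k) ≡ iter shift k zero
    rotation-orb (pointed _ base _) zero = base
    rotation-orb rot@(pointed (x-eq , _) _ _) (suc k) = trans (x-eq (orb k)) (cong shift (rotation-orb rot k))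

    rotation-at : ∀ {φ v} → PointedRotation {e = e} x X R φ v → ∀ k {s} → orb k ~ s → lookup v s ≡ iter shift k zero
    rotation-at {v = v} rot k h = trans (sym (Generated-elim R Fin._≟_ v (PointedRotation.compatible rot) h)) (rotation-orb rot k)

    -- After `u` steps the orbit is back in the class of zero, where `v` vanishes, while `v` has
    -- been rotated `u` times.
    rotation⇒d∣u : ∀ {φ v} → PointedRotation {e = e} x X R φ v → d ∣ u
    rotation⇒d∣u rot = ∣-iter-shift (trans (sym (rotation-orb rot u)) (rotation-at rot 0 (~-sym orb-u)))

    -- The base condition fixes `v` along the orbit of zero, which meets every class; the entries of
    -- `φ` are then read off as the values of `v` at the images of zero under `X`.
    rotation-unique : ∀ {φ v φ′ v′} → PointedRotation {e = e} x X R φ v → PointedRotation x X R φ′ v′ → φ ≡ φ′ × v ≡ v′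
    rotation-unique {φ} {v} {φ′} {v′} rot rot′ = vec-ext φ≡ , vec-ext v≡
      where
      v≡ : ∀ s → lookup v s ≡ lookup v′ s
      v≡ s = trans (rotation-at rot (rep s) (proj₂ (reaches s))) (sym (rotation-at rot′ (rep s) (proj₂ (reaches s))))
      φ-at : ∀ {φ v} → PointedRotation {e = e} x X R φ v → ∀ j → lookup v (app (X j) zero) ≡ lookup φ j
      φ-at {φ} {v} (pointed (_ , X-eq) base _) j = trans (X-eq j zero) (trans (cong (iter shift (toℕ (lookup φ j))) base) (iter-shift-toℕ (lookup φ j)))
      φ≡ : ∀ j → lookup φ j ≡ lookup φ′ j
      φ≡ j = trans (sym (φ-at rot j)) (trans (v≡ _) (φ-at rot′ j))

    module _ (d∣u : d ∣ u) where

      well-defined : ∀ k l → orb k ~ orb l → iter (shift {e}) k zero ≡ iter shift l zero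
      well-defined k l h = begin
        iter shift k zero
          ≡⟨ cong (iter shift k) (sym (iter-shift-∣ (Dv.∣-trans d∣u (u∣ (q ℕ.+ l) tail~)))) ⟩
        iter shift k (iter shift (q ℕ.+ l) zero)
          ≡⟨ trans (cong (iter shift k) (trans (iter-+ shift q l zero) (iter-comm shift q l zero)))
               (iter-comm shift k l (iter shift q zero)) ⟩
        iter shift l (iter shift k (iter shift q zero))
          ≡⟨ cong (iter shift l) (trans (sym (iter-+ shift k q zero)) (cong (λ m → iter shift m zero) kq)) ⟩
        iter shift l (iter shift (k ℕ.* u) zero)
          ≡⟨ cong (iter shift l) (iter-shift-∣ (Dv.∣-trans d∣u (Dv.n∣m*n k))) ⟩
        iter shift l zero ∎
        where
        q : ℕ
        -- This `q` represents -k modulo `u`, so that `q + l` is a return time and subtraction of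
        -- orbit indices is avoided.
        q = k ℕ.* u ∸ k
        kq : k ℕ.+ q ≡ k ℕ.* u
        kq = ℕₚ.m+[n∸m]≡n (ℕₚ.m≤m*n k u)
        tail~ : orb (q ℕ.+ l) ~ zero
        tail~ = ~-trans (~-reflexive (iter-+ (app x) q l zero)) (~-trans (~-iter q (~-sym h))
          (~-trans (~-reflexive (trans (sym (iter-+ (app x) q k zero)) (cong orb (trans (ℕₚ.+-comm q k) kq)))) (orb-multiple k)))

      v₀ : Vec (Fin d) (suc n)
      v₀ = Vec.tabulate (λ s → iter shift (proj₁ (reaches s)) zero)

      v₀-at : ∀ k {s} → orb k ~ s → lookup v₀ s ≡ iter shift k zero
      v₀-at k {s} h = trans (Vecₚ.lookup∘tabulate (λ s → iter shift (rep s) zero) s) (well-defined (rep s) k (~-trans (proj₂ (reaches s)) (~-sym h)))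

      φ₀ : Vec (Fin d) r
      φ₀ = Vec.tabulate (λ j → lookup v₀ (app (X j) zero))

      iter-X : ∀ j k → app (X j) (orb k) ≡ iter (app x) k (app (X j) zero)
      iter-X j zero = refl
      iter-X j (suc k) = trans (sym (xX j (orb k))) (cong (app x) (iter-X j k))

      rotation-exists : PointedRotation x X R φ₀ v₀
      rotation-exists = pointed ((λ s → trans (v₀-at (suc (rep s)) (~-iter 1 (proj₂ (reaches s)))) (cong shift (sym (v₀-at (rep s) (proj₂ (reaches s))))))
        , X-eq) (v₀-at 0 ~-refl) (λ i j Rij → trans (v₀-at (rep i) (proj₂ (reaches i)))
            (sym (v₀-at (rep i) (~-trans (proj₂ (reaches i)) (generates λ c comp → comp i j Rij)))))
        where
        -- Since `X j` commutes with `x`, it carries `orb k` to the point `k` steps beyond the image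
        -- of zero. Its displacement is thus constant, equal to the one recorded at zero.
        X-eq : ∀ j s → lookup v₀ (app (X j) s) ≡ iter shift (toℕ (lookup φ₀ j)) (lookup v₀ s)
        X-eq j s = begin
          lookup v₀ (app (X j) s)
            ≡⟨ v₀-at (k ℕ.+ l) (~-trans (~-reflexive (iter-+ (app x) k l zero)) (~-trans (~-iter k ls)
                 (~-trans (~-reflexive (sym (iter-X j k))) (Generated-preserved {R = R} {app (X j)} (X-pres j) ks)))) ⟩
          iter shift (k ℕ.+ l) zero
            ≡⟨ trans (iter-+ shift k l zero) (cong (iter shift k) (trans (sym (v₀-at l ls)) (sym (trans (iter-shift-toℕ (lookup φ₀ j)) (Vecₚ.lookup∘tabulate (λ j → lookup v₀ (app (X j) zero)) j))))) ⟩
          iter shift k (iter shift (toℕ (lookup φ₀ j)) zero)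
            ≡⟨ iter-comm shift k (toℕ (lookup φ₀ j)) zero ⟩
          iter shift (toℕ (lookup φ₀ j)) (iter shift k zero)
            ≡⟨ cong (iter shift (toℕ (lookup φ₀ j))) (sym (v₀-at k ks)) ⟩
          iter shift (toℕ (lookup φ₀ j)) (lookup v₀ s) ∎
          where
          k = proj₁ (reaches s)
          ks = proj₂ (reaches s)
          l = proj₁ (reaches (app (X j) zero))
          ls = proj₂ (reaches (app (X j) zero))

    -- Each cycle length dividing `u` admits a rotation for a single `φ`; summing over `φ` removes
    -- the dependence on how the other generators act.
    ∑-rotations : ∑ (vecs (allFin d) r) (λ φ → ∑ (vecs (allFin d) (suc n)) (λ v → ⟦ does (pointedRotation? x X R φ v) ⟧)) ≡ ⟦ does (d ∣? u) ⟧
    ∑-rotations = cases (d ∣? u)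
      where
      cases : (d∣u? : Dec (d ∣ u)) → ∑ (vecs (allFin d) r) (λ φ → ∑ (vecs (allFin d) (suc n)) (λ v → ⟦ does (pointedRotation? x X R φ v) ⟧)) ≡ ⟦ does d∣u? ⟧
      cases (no ¬d∣u) = ∑-zero (vecs (allFin d) r) (λ φ → ∑-zero (vecs (allFin d) (suc n)) (λ v →
        cong ⟦_⟧ (dec-false (pointedRotation? x X R φ v) (λ rot → ¬d∣u (rotation⇒d∣u rot)))))
      cases (yes d∣u) = trans
        (∑-point (vecs-enum (allFin-enum d) r) (φ₀ d∣u) _ (λ φ φ≢ → ∑-zero (vecs (allFin d) (suc n)) (λ v →
          cong ⟦_⟧ (dec-false (pointedRotation? x X R φ v) (λ rot → φ≢ (proj₁ (rotation-unique rot (rotation-exists d∣u))))))))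
        (∑-unique₁ (vecs-enum (allFin-enum d) (suc n)) (λ v → does (pointedRotation? x X R (φ₀ d∣u) v)) (v₀ d∣u) (dec-true (pointedRotation? x X R (φ₀ d∣u) (v₀ d∣u)) (rotation-exists d∣u))
          (λ v h → proj₂ (rotation-unique (does-true (pointedRotation? x X R (φ₀ d∣u) v) h) (rotation-exists d∣u))))

-- Pointed equivariant maps into test sets

Equivariant : ∀ {t r n} (F : TestSet t r) → Vec (Perm n) r → Vec (TestSet.Z F) n → Set
Equivariant F X f = ∀ j s → lookup f (app (lookup X j) s) ≡ TestSet.acts F j (lookup f s)

record PointedMap {t r n} (F : TestSet t r) (X : Vec (Perm (suc n)) r) (R : BRel (suc n)) (f : Vec (TestSet.Z F) (suc n)) : Set where
  constructor pointedMap
  field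
    equivariant : Equivariant F X f
    base : TestSet.isBase F (lookup f zero) ≡ true
    compatible : Compatible R f

equivariant? : ∀ {t r n} (F : TestSet t r) (X : Vec (Perm n) r) f → Dec (Equivariant F X f)
equivariant? F X f = Finₚ.all? (λ j → Finₚ.all? (λ s → Enum._≟_ (TestSet.enum F) (lookup f (app (lookup X j) s)) (TestSet.acts F j (lookup f s))))

pointedMap? : ∀ {t r n} (F : TestSet t r) (X : Vec (Perm (suc n)) r) R f → Dec (PointedMap F X R f)
pointedMap? F X R f = map′ (λ (eqv , base , comp) → pointedMap eqv base comp) (λ (pointedMap eqv base comp) → eqv , base , comp)
  (equivariant? F X f ×-dec ((TestSet.isBase F (lookup f zero) Bool.≟ true) ×-dec compatible? (Enum._≟_ (TestSet.enum F)) R f))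

#maps : ∀ {t r n} → TestSet t r → Vec (Perm (suc n)) r → BRel (suc n) → ℤ
#maps {n = n} F X R = ∑ (vecs (TestSet.elems F) (suc n)) (λ f → ⟦ does (pointedMap? F X R f) ⟧)

#rotations : ∀ {r n} e → Perm (suc n) → Vec (Perm (suc n)) r → BRel (suc n) → Vec (Fin (suc e)) r → ℤ
#rotations {n = n} e x X R φ = ∑ (vecs (allFin (suc e)) (suc n)) (λ v → ⟦ does (pointedRotation? x (lookup X) R φ v) ⟧)

-- A map into the extended test set is a pair of coordinates. The new generator fixes the first, so
-- equivariance under `x` becomes compatibility with its graph; the second is a pointed rotation.
-- The two conditions are independent.
#maps-extend : ∀ {t r n} (F : TestSet t r) e φ x (X : Vec (Perm (suc n)) r) R →
  #maps (extend F e φ) (x ∷ X) R ≡ #rotations e x X R φ * #maps F X (R ∪graph x)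
#maps-extend {n = n} F e φ x X R = begin
  #maps (extend F e φ) (x ∷ X) R
    ≡⟨ ∑-vecs-pairs elems (allFin (suc e)) (suc n) _ ⟩
  ∑ us (λ u → ∑ vs (λ v → ⟦ does (pointedMap? (extend F e φ) (x ∷ X) R (Vec.zip u v)) ⟧))
    ≡⟨ ∑-cong us (λ u → ∑-cong vs (λ v → trans (cong ⟦_⟧ (does-⇔ (pointedMap? (extend F e φ) (x ∷ X) R (Vec.zip u v))
         (pointedRotation? x (lookup X) R φ v ×-dec pointedMap? F X (R ∪graph x) u) (split u v) (unsplit u v)))
         (⟦∧⟧ (does (pointedRotation? x (lookup X) R φ v)) (does (pointedMap? F X (R ∪graph x) u))))) ⟩
  ∑ us (λ u → ∑ vs (λ v → ⟦ does (pointedRotation? x (lookup X) R φ v) ⟧ * ⟦ does (pointedMap? F X (R ∪graph x) u) ⟧))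
    ≡⟨ ∑-cong us (λ u → ∑-*ʳ vs ⟦ does (pointedMap? F X (R ∪graph x) u) ⟧ (λ v → ⟦ does (pointedRotation? x (lookup X) R φ v) ⟧)) ⟩
  ∑ us (λ u → #rotations e x X R φ * ⟦ does (pointedMap? F X (R ∪graph x) u) ⟧)
    ≡⟨ ∑-*ˡ us (#rotations e x X R φ) (λ u → ⟦ does (pointedMap? F X (R ∪graph x) u) ⟧) ⟩
  #rotations e x X R φ * #maps F X (R ∪graph x) ∎
  where
  open TestSet F
  us = vecs elems (suc n)
  vs = vecs (allFin (suc e)) (suc n)
  module _ (u : Vec Z (suc n)) (v : Vec (Fin (suc e)) (suc n)) where
    at : ∀ i → lookup (Vec.zip u v) i ≡ (lookup u i , lookup v i)
    at i = Vecₚ.lookup-zip i u v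
    split : PointedMap (extend F e φ) (x ∷ X) R (Vec.zip u v) → PointedRotation x (lookup X) R φ v × PointedMap F X (R ∪graph x) u
    split (pointedMap eqv base comp) =
      pointed ((λ s → cong proj₂ (eqv′ zero s)) , (λ j s → cong proj₂ (eqv′ (suc j) s))) (==F-true (proj₂ (∧-true {isBase (lookup u zero)} base′))) (λ i j h → cong proj₂ (comp′ i j h)) ,
      pointedMap (λ j s → cong proj₁ (eqv′ (suc j) s)) (proj₁ (∧-true base′))
        (∪graph-compatible {R = R} {x} {u} (λ i j h → cong proj₁ (comp′ i j h)) (λ s → cong proj₁ (eqv′ zero s)))
      where
      eqv′ : ∀ j s → (lookup u (app (lookup (x ∷ X) j) s) , lookup v (app (lookup (x ∷ X) j) s)) ≡ TestSet.acts (extend F e φ) j (lookup u s , lookup v s)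
      eqv′ j s = trans (sym (at (app (lookup (x ∷ X) j) s))) (trans (eqv j s) (cong (TestSet.acts (extend F e φ) j) (at s)))
      base′ : isBase (lookup u zero) ∧ (lookup v zero ==F zero) ≡ true
      base′ = trans (sym (cong (TestSet.isBase (extend F e φ)) (at zero))) base
      comp′ : ∀ i j → R i j ≡ true → (lookup u i , lookup v i) ≡ (lookup u j , lookup v j)
      comp′ i j h = trans (sym (at i)) (trans (comp i j h) (at j))
    unsplit : PointedRotation x (lookup X) R φ v × PointedMap F X (R ∪graph x) u → PointedMap (extend F e φ) (x ∷ X) R (Vec.zip u v)
    unsplit (pointed (x-eq , X-eq) base-v comp-v , pointedMap eqv base-u comp-u) = pointedMap eqv′
      (trans (cong (TestSet.isBase (extend F e φ)) (at zero)) (∧-intro base-u (cong (_==F zero) base-v)))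
      (λ i j h → trans (at i) (trans (cong₂ _,_ (∪graph-compatibleˡ {R = R} {x} {u} comp-u i j h) (comp-v i j h)) (sym (at j))))
      where
      eqv′ : Equivariant (extend F e φ) (x ∷ X) (Vec.zip u v)
      eqv′ zero s = trans (at (app x s)) (trans (cong₂ _,_ (∪graph-compatibleʳ {R = R} {x} {u} comp-u s) (x-eq s)) (cong (TestSet.acts (extend F e φ) zero) (sym (at s))))
      eqv′ (suc j) s = trans (at (app (lookup X j) s)) (trans (cong₂ _,_ (eqv j s) (X-eq j s)) (cong (TestSet.acts (extend F e φ) (suc j)) (sym (at s))))

-- Congruence modulo t² and maps to a bare set of copies

infix 4 _≡_mod²_
-- The quotient is kept as data because congruences get summed, also by `testSum`, and the quotients
-- have to be summed with them.
record _≡_mod²_ (a b : ℤ) (t : ℕ) : Set where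
  constructor congruent
  field
    quotient : ℤ
    equation : a ≡ b + + t * + t * quotient

module BaseCase (n t : ℕ) (R : BRel (suc n)) where

  fs : List (Vec (Fin (suc t)) (suc n))
  fs = vecs (allFin (suc t)) (suc n)

  fs-enum : Enum fs
  fs-enum = vecs-enum (allFin-enum (suc t)) (suc n)

  isCompatible : Vec (Fin (suc t)) (suc n) → Bool
  isCompatible f = does (compatible? Fin._≟_ R f)

  ∑-value : (i : Fin (suc n)) (g : Vec (Fin (suc t)) (suc n) → ℤ) → ∑ fs g ≡ ∑ (allFin (suc t)) (λ a → ∑ fs (λ f → ⟦ lookup f i ==F a ⟧ * g f))
  ∑-value i g = trans (∑-cong fs (λ f → sym (∑-unique (allFin-enum (suc t)) (lookup f i ==F_) (λ _ → g f) (lookup f i) (==F-refl (lookup f i)) (λ a h → sym (==F-true h)))))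
    (∑-swap fs (allFin (suc t)) _)

  connected-case : connected R ≡ true → ∑ fs (λ f → ⟦ isCompatible f ⟧) ≡ + suc t
  connected-case conn = begin
    ∑ fs (λ f → ⟦ isCompatible f ⟧)
      ≡⟨ ∑-value zero (λ f → ⟦ isCompatible f ⟧) ⟩
    ∑ (allFin (suc t)) (λ a → ∑ fs (λ f → ⟦ lookup f zero ==F a ⟧ * ⟦ isCompatible f ⟧))
      ≡⟨ ∑-cong (allFin (suc t)) (λ a → trans (∑-cong fs (λ f → sym (⟦∧⟧ (lookup f zero ==F a) (isCompatible f))))
           (∑-unique₁ fs-enum (λ f → (lookup f zero ==F a) ∧ isCompatible f) (Vec.replicate (suc n) a) (const-ok a) (unique a))) ⟩
    ∑ (allFin (suc t)) (λ _ → 1ℤ)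
      ≡⟨ trans (sym (∑-length (allFin (suc t)))) (cong +_ (length-allFin (suc t))) ⟩
    + suc t ∎
    where
    const-ok : ∀ a → (lookup (Vec.replicate (suc n) a) zero ==F a) ∧ isCompatible (Vec.replicate (suc n) a) ≡ true
    const-ok a = ∧-intro (==F-refl a) (dec-true (compatible? Fin._≟_ R (Vec.replicate (suc n) a)) (λ i j _ →
      trans (Vecₚ.lookup-replicate i a) (sym (Vecₚ.lookup-replicate j a))))
    unique : ∀ a f → (lookup f zero ==F a) ∧ isCompatible f ≡ true → f ≡ Vec.replicate (suc n) a
    unique a f h = vec-ext (λ i → trans (Generated-elim R Fin._≟_ f (does-true (compatible? Fin._≟_ R f) (proj₂ (∧-true {lookup f zero ==F a} h))) (connected-true {R = R} conn i zero))
      (trans (==F-true (proj₁ (∧-true h))) (sym (Vecₚ.lookup-replicate i a))))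

  -- The values of f on the two parts cut out by c can be permuted independently.
  module _ (c : Vec Bool (suc n)) (c-comp : Compatible R c) (i₀ i₁ : Fin (suc n)) (c₀ : lookup c i₀ ≡ true) (c₁ : lookup c i₁ ≡ false) where

    part : Fin (suc t) → Fin (suc t) → Fin (suc n) → Fin (suc t)
    part a b i = if lookup c i then a else b

    permuteBy : (Fin (suc t) → Fin (suc t) → Fin (suc t)) → Fin (suc t) → Fin (suc t) → Vec (Fin (suc t)) (suc n) → Vec (Fin (suc t)) (suc n)
    permuteBy σ a b f = Vec.tabulate (λ i → σ (part a b i) (lookup f i))

    at : ∀ σ a b f i → lookup (permuteBy σ a b f) i ≡ σ (part a b i) (lookup f i)
    at σ a b f = Vecₚ.lookup∘tabulate (λ i → σ (part a b i) (lookup f i))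

    permuteBy-inverse : ∀ σ τ → (∀ a k → σ a (τ a k) ≡ k) → ∀ a b f → permuteBy σ a b (permuteBy τ a b f) ≡ f
    permuteBy-inverse σ τ στ a b f = vec-ext (λ i → trans (at σ a b (permuteBy τ a b f) i)
      (trans (cong (σ (part a b i)) (at τ a b f i)) (στ (part a b i) (lookup f i))))

    permuteBy-compatible : ∀ σ a b f → Compatible R f → Compatible R (permuteBy σ a b f)
    permuteBy-compatible σ a b f comp i j h = trans (at σ a b f i)
      (trans (cong₂ (λ e k → σ (if e then a else b) k) (c-comp i j h) (comp i j h)) (sym (at σ a b f j)))

    to from : Fin (suc t) → Fin (suc t) → Fin (suc t)
    to = PC.transpose zero
    from a = PC.transpose a zero

    to-from : ∀ a k → to a (from a k) ≡ k
    to-from a k = PC.transpose-inverse zero a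

    from-to : ∀ a k → from a (to a k) ≡ k
    from-to a k = PC.transpose-inverse a zero

    to-≡ : ∀ a k → (to a k ==F a) ≡ (k ==F zero)
    to-≡ a k = bool-ext
      (λ h → cong (_==F zero) (trans (sym (from-to a k)) (trans (cong (from a) (==F-true h)) (from-to a zero))))
      (λ h → trans (cong (_==F a) (cong (to a) (==F-true h))) (==F-refl a))

    #with : Fin (suc t) → Fin (suc t) → ℤ
    #with a b = ∑ fs (λ f → ⟦ lookup f i₁ ==F b ⟧ * (⟦ lookup f i₀ ==F a ⟧ * ⟦ isCompatible f ⟧))

    -- Swapping 0 with `a` on one part and 0 with `b` on the other is a bijection of maps. It
    -- preserves compatibility because `c` never changes along `R`, so related points are relabelled
    -- alike.
    #with-constant : ∀ a b → #with a b ≡ #with zero zero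
    #with-constant a b = trans (sym (∑-bij fs-enum (permuteBy to a b) (permuteBy from a b)
        (permuteBy-inverse to from to-from a b) (permuteBy-inverse from to from-to a b)
        (λ f → ⟦ lookup f i₁ ==F b ⟧ * (⟦ lookup f i₀ ==F a ⟧ * ⟦ isCompatible f ⟧))))
      (∑-cong fs (λ f → cong₂ _*_ (cong ⟦_⟧ (value f i₁ b (cong (λ e → if e then a else b) c₁)))
        (cong₂ _*_ (cong ⟦_⟧ (value f i₀ a (cong (λ e → if e then a else b) c₀)))
          (cong ⟦_⟧ (does-⇔ (compatible? Fin._≟_ R (permuteBy to a b f)) (compatible? Fin._≟_ R f)
            (λ h → subst (Compatible R) (permuteBy-inverse from to from-to a b f) (permuteBy-compatible from a b (permuteBy to a b f) h))
            (permuteBy-compatible to a b f))))))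
      where
      value : ∀ f i e → part a b i ≡ e → (lookup (permuteBy to a b f) i ==F e) ≡ (lookup f i ==F zero)
      value f i e refl = trans (cong (_==F e) (at to a b f i)) (to-≡ e (lookup f i))

    disconnected-case : ∑ fs (λ f → ⟦ isCompatible f ⟧) ≡ + suc t * + suc t * #with zero zero
    disconnected-case = begin
      ∑ fs (λ f → ⟦ isCompatible f ⟧)
        ≡⟨ trans (∑-value i₀ (λ f → ⟦ isCompatible f ⟧)) (∑-cong (allFin (suc t)) (λ a → ∑-value i₁ (λ f → ⟦ lookup f i₀ ==F a ⟧ * ⟦ isCompatible f ⟧))) ⟩
      ∑ (allFin (suc t)) (λ a → ∑ (allFin (suc t)) (λ b → #with a b))
        ≡⟨ ∑-cong (allFin (suc t)) (λ a → trans (∑-cong (allFin (suc t)) (#with-constant a)) (constant (#with zero zero))) ⟩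
      ∑ (allFin (suc t)) (λ a → + suc t * #with zero zero)
        ≡⟨ trans (constant (+ suc t * #with zero zero)) (sym (ℤₚ.*-assoc (+ suc t) (+ suc t) (#with zero zero))) ⟩
      + suc t * + suc t * #with zero zero ∎
      where
      constant : ∀ z → ∑ (allFin (suc t)) (λ _ → z) ≡ + suc t * z
      constant z = trans (∑-const (allFin (suc t)) z) (cong (λ k → + k * z) (length-allFin (suc t)))

  Separates : Vec Bool (suc n) → Set
  Separates c = Compatible R c × ∃ λ i₀ → ∃ λ i₁ → lookup c i₀ ≡ true × lookup c i₁ ≡ false

  separates? : ∀ c → Dec (Separates c)
  separates? c = compatible? Bool._≟_ R c ×-dec
    Finₚ.any? (λ i → Finₚ.any? (λ j → (lookup c i Bool.≟ true) ×-dec (lookup c j Bool.≟ false)))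

  -- Turns a negative fact into a witness: a separating function is found by search, and if there
  -- were none, all compatible functions would be constant and `R` connected.
  separated : connected R ≡ false → ∃ Separates
  separated disc = cases (search (vecs-enum bools-enum (suc n)) (λ c → does (separates? c)))
    where
    cases : (∃ λ c → does (separates? c) ≡ true) ⊎ (∀ c → does (separates? c) ≡ false) → ∃ Separates
    cases (inj₁ (c , h)) = c , does-true (separates? c) h
    cases (inj₂ none) = ⊥-elim (true≢false (connected-intro {R = R} (λ i j → generates λ c comp →
        constant i j c comp (lookup c i) (lookup c j) refl refl)) disc)
      where
      bad : ∀ c → Compatible R c → ∀ i j → lookup c i ≡ true → lookup c j ≡ false → ⊥
      bad c comp i j p q = true≢false (dec-true (separates? c) (comp , i , j , p , q)) (none c)
      constant : ∀ i j c → Compatible R c → ∀ a b → lookup c i ≡ a → lookup c j ≡ b → lookup c i ≡ lookup c j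
      constant i j c comp true true p q = trans p (sym q)
      constant i j c comp false false p q = trans p (sym q)
      constant i j c comp true false p q = ⊥-elim (bad c comp i j p q)
      constant i j c comp false true p q = ⊥-elim (bad c comp j i q p)

  #compatible : ∑ fs (λ f → ⟦ isCompatible f ⟧) ≡ + suc t * ⟦ connected R ⟧ mod² suc t
  #compatible = cases (connected R) refl
    where
    one : ∀ a → a ≡ a * 1ℤ + a * a * 0ℤ
    one = solve-∀
    square : ∀ a b → a * a * b ≡ a * 0ℤ + a * a * b
    square = solve-∀
    cases : ∀ b → connected R ≡ b → ∑ fs (λ f → ⟦ isCompatible f ⟧) ≡ + suc t * ⟦ b ⟧ mod² suc t
    cases true eq = congruent 0ℤ (trans (connected-case eq) (one (+ suc t)))
    cases false eq = let (c , comp , i₀ , i₁ , p , q) = separated eq in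
      congruent (#with c comp i₀ i₁ p q zero zero) (trans (disconnected-case c comp i₀ i₁ p q) (square (+ suc t) (#with c comp i₀ i₁ p q zero zero)))

-- Eliminating generators one at a time

module Detection (n : ℕ) (μ : ℕ → ℤ)
  (μ-inversion : ∀ u → 1 ≤ u → u ≤ suc n → ∑ (upTo (suc n)) (λ e → μ (suc e) * ⟦ does (suc e ∣? u) ⟧) ≡ ⟦ does (u ℕ.≟ 1) ⟧)
  (t : ℕ) where

  open WeightedTests (suc n) μ (suc t)

  Commuting : ∀ {r} → Vec (Perm (suc n)) r → Set
  Commuting X = ∀ j k → Commute (lookup X j) (lookup X k)

  rotationSum : ∀ {r} → Perm (suc n) → Vec (Perm (suc n)) r → BRel (suc n) → ℤ
  rotationSum {r} x X R = ∑ (upTo (suc n)) (λ e → μ (suc e) * ∑ (vecs (allFin (suc e)) r) (#rotations e x X R))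

  -- Each cycle length dividing `u` contributes one rotation, and `u≤` keeps all these lengths
  -- inside the sum, so the divisor sum of `μ` reduces to the test `u = 1`.
  rotationSum-connected : ∀ {r} x (X : Vec (Perm (suc n)) r) R → Injectiveᵖ x → (∀ j → Commute x (lookup X j)) →
    Preserves (app x) R → (∀ j → Preserves (app (lookup X j)) R) → connected (R ∪graph x) ≡ true → rotationSum x X R ≡ ⟦ connected R ⟧
  rotationSum-connected x X R x-inj xX x-pres X-pres conn =
    trans (∑-cong (upTo (suc n)) (λ e → cong (μ (suc e) *_) (∑-rotations e)))
      (trans (μ-inversion u (s≤s z≤n) u≤) (cong ⟦_⟧ (bool-ext (λ h → u≡1⇒connected (does-true (u ℕ.≟ 1) h)) (λ h → dec-true (u ℕ.≟ 1) (connected⇒u≡1 h)))))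
    where open Cyclic x (lookup X) R x-inj xX x-pres X-pres conn

  -- The relation grows as generators are absorbed. If it is connected after absorbing `x`, the
  -- quotient before was one `x`-cycle, and the rotation sum tests whether its length is 1. If it is
  -- disconnected afterwards, it was so before, and both main terms vanish whatever the rotation sum
  -- is.
  testSum-#maps : ∀ r (X : Vec (Perm (suc n)) r) R → (∀ j → Injectiveᵖ (lookup X j)) → Commuting X → (∀ j → Preserves (app (lookup X j)) R) →
    testSum r (λ F → #maps F X R) ≡ + suc t * ⟦ connected R ⟧ mod² suc t
  testSum-#maps zero [] R _ _ _ = let (congruent q eq) = BaseCase.#compatible n t R in congruent q
    (trans (∑-cong (vecs (allFin (suc t)) (suc n)) (λ f → cong ⟦_⟧ (does-⇔ (pointedMap? (trivialTest (suc t)) [] R f) (compatible? Fin._≟_ R f)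
      PointedMap.compatible (pointedMap (λ ()) refl)))) eq)
  testSum-#maps (suc r) (x ∷ X) R inj comm pres = congruent (rotationSum x X R * q) (begin
    testSum (suc r) (λ F → #maps F (x ∷ X) R)
      ≡⟨ ∑-cong (upTo (suc n)) (λ e → cong (μ (suc e) *_) (∑-cong (vecs (allFin (suc e)) r) (λ φ →
           trans (testSum-cong r (λ F → #maps-extend F e φ x X R)) (testSum-*ˡ r (#rotations e x X R φ) (λ F → #maps F X (R ∪graph x)))))) ⟩
    ∑ (upTo (suc n)) (λ e → μ (suc e) * ∑ (vecs (allFin (suc e)) r) (λ φ → #rotations e x X R φ * rest))
      ≡⟨ ∑-cong (upTo (suc n)) (λ e → trans (cong (μ (suc e) *_) (∑-*ʳ (vecs (allFin (suc e)) r) rest (#rotations e x X R)))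
           (sym (ℤₚ.*-assoc (μ (suc e)) (∑ (vecs (allFin (suc e)) r) (#rotations e x X R)) rest))) ⟩
    ∑ (upTo (suc n)) (λ e → μ (suc e) * ∑ (vecs (allFin (suc e)) r) (#rotations e x X R) * rest)
      ≡⟨ ∑-*ʳ (upTo (suc n)) rest (λ e → μ (suc e) * ∑ (vecs (allFin (suc e)) r) (#rotations e x X R)) ⟩
    rotationSum x X R * rest
      ≡⟨ cong (rotationSum x X R *_) eq ⟩
    rotationSum x X R * (+ suc t * ⟦ connected (R ∪graph x) ⟧ + + suc t * + suc t * q)
      ≡⟨ rearrange (rotationSum x X R) (+ suc t) ⟦ connected (R ∪graph x) ⟧ q ⟩
    + suc t * (rotationSum x X R * ⟦ connected (R ∪graph x) ⟧) + + suc t * + suc t * (rotationSum x X R * q)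
      ≡⟨ cong (λ z → + suc t * z + + suc t * + suc t * (rotationSum x X R * q)) detect ⟩
    + suc t * ⟦ connected R ⟧ + + suc t * + suc t * (rotationSum x X R * q) ∎)
    where
    ih : testSum r (λ F → #maps F X (R ∪graph x)) ≡ + suc t * ⟦ connected (R ∪graph x) ⟧ mod² suc t
    ih = testSum-#maps r X (R ∪graph x) (inj ∘ suc) (λ j k → comm (suc j) (suc k))
      (λ j → ∪graph-preserved {R = R} {x} {lookup X j} (comm zero (suc j)) (pres (suc j)))
    q : ℤ
    q = _≡_mod²_.quotient ih
    eq : testSum r (λ F → #maps F X (R ∪graph x)) ≡ + suc t * ⟦ connected (R ∪graph x) ⟧ + + suc t * + suc t * q
    eq = _≡_mod²_.equation ih
    rest : ℤ
    rest = testSum r (λ F → #maps F X (R ∪graph x))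
    rearrange : ∀ a b c d → a * (b * c + b * b * d) ≡ b * (a * c) + b * b * (a * d)
    rearrange = solve-∀
    detect : rotationSum x X R * ⟦ connected (R ∪graph x) ⟧ ≡ ⟦ connected R ⟧
    detect = cases (connected (R ∪graph x)) refl
      where
      cases : ∀ b → connected (R ∪graph x) ≡ b → rotationSum x X R * ⟦ b ⟧ ≡ ⟦ connected R ⟧
      cases true conn = trans (ℤₚ.*-identityʳ (rotationSum x X R))
        (rotationSum-connected x X R (inj zero) (λ j → comm zero (suc j)) (pres zero) (λ j → pres (suc j)) conn)
      cases false disc = trans (ℤₚ.*-zeroʳ (rotationSum x X R)) (cong ⟦_⟧ (sym (≢true⇒≡false (λ h → true≢false
        (connected-intro {R = R ∪graph x} (λ i j → generates λ c comp → Generated.agree (connected-true {R = R} h i j) c (∪graph-compatibleˡ {R = R} {x} {c} comp))) disc))))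

-- Counting equivariant injections

InjectiveVec : ∀ {A : Set} {k} → Vec A k → Set
InjectiveVec f = ∀ i j → lookup f i ≡ lookup f j → i ≡ j

injectiveVec? : ∀ {A : Set} {k} → DecidableEquality A → (f : Vec A k) → Dec (InjectiveVec f)
injectiveVec? _≟_ f = Finₚ.all? (λ i → Finₚ.all? (λ j → (lookup f i ≟ lookup f j) →-dec (i Fin.≟ j)))

-- The argument is an integer because sizes of target sets arise as sums of indicators, from which 1
-- is repeatedly subtracted.
fallingFactorial : ℤ → ℕ → ℤ
fallingFactorial q zero = 1ℤ
fallingFactorial q (suc k) = q * fallingFactorial (q - 1ℤ) k

fallingFactorial-! : ∀ n → fallingFactorial (+ n) n ≡ + (n !)
fallingFactorial-! zero = refl
fallingFactorial-! (suc n) = trans (cong (+ suc n *_) (fallingFactorial-! n)) (sym (ℤₚ.pos-* (suc n) (n !)))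

∑-⟦⟧-count : ∀ {A : Set} (p : A → Bool) xs → ∑ xs (λ x → ⟦ p x ⟧) ≡ + count p xs
∑-⟦⟧-count p xs = trans (∑-cong xs (λ x → sym (ℤₚ.*-identityʳ ⟦ p x ⟧))) (trans (sym (∑-filterB p xs (λ _ → 1ℤ))) (sym (∑-length (filterB p xs))))

∑-⟦⟧≡0 : ∀ {A : Set} {xs : List A} → Enum xs → (p : A → Bool) → ∑ xs (λ x → ⟦ p x ⟧) ≡ 0ℤ → ∀ x → p x ≡ false
∑-⟦⟧≡0 {xs = xs} e p h x = not-true (all-true e (none xs (ℤₚ.+-injective (trans (sym (∑-⟦⟧-count p xs)) h))) x)
  where
  none : ∀ xs → count p xs ≡ 0 → all (not ∘ p) xs ≡ true
  none [] h = refl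
  none (x ∷ xs) h with p x
  ... | false = none xs h

module Injections {A : Set} {xs : List A} (e : Enum xs) where

  _≟_ : DecidableEquality A
  _≟_ = Enum._≟_ e

  without : (A → Bool) → A → A → Bool
  without Q z y = Q y ∧ not (does (z ≟ y))

  -- Injectivity in a form that recurses on the vector: each chosen value is removed from the
  -- allowed set for the rest, which is the shape required for counting.
  injectsInto : ∀ {k} → (A → Bool) → Vec A k → Bool
  injectsInto Q [] = true
  injectsInto Q (z ∷ f) = Q z ∧ injectsInto (without Q z) f

  ∑-without : ∀ Q z → Q z ≡ true → ∑ xs (λ y → ⟦ without Q z y ⟧) ≡ ∑ xs (λ y → ⟦ Q y ⟧) - 1ℤ
  ∑-without Q z Qz = begin
    without∑
      ≡⟨ add-sub without∑ ⟩
    without∑ + 1ℤ - 1ℤ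
      ≡⟨ cong (λ w → without∑ + w - 1ℤ) (sym (∑-unique₁ e (λ y → does (z ≟ y)) z (dec-true (z ≟ z) refl) (λ y h → sym (does-true (z ≟ y) h)))) ⟩
    without∑ + ∑ xs (λ y → ⟦ does (z ≟ y) ⟧) - 1ℤ
      ≡⟨ cong (_- 1ℤ) (trans (sym (∑-+ xs (λ y → ⟦ without Q z y ⟧) (λ y → ⟦ does (z ≟ y) ⟧))) (∑-cong xs pointwise)) ⟩
    ∑ xs (λ y → ⟦ Q y ⟧) - 1ℤ ∎
    where
    without∑ = ∑ xs (λ y → ⟦ without Q z y ⟧)
    add-sub : ∀ a → a ≡ a + 1ℤ - 1ℤ
    add-sub = solve-∀
    pointwise : ∀ y → ⟦ without Q z y ⟧ + ⟦ does (z ≟ y) ⟧ ≡ ⟦ Q y ⟧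
    pointwise y with z ≟ y
    ... | yes refl rewrite Qz = refl
    ... | no _ with Q y
    ...   | true = refl
    ...   | false = refl

  -- The first value shrinks the allowed set, so the induction runs over all `Q` at once; the count
  -- depends on `Q` only through its size.
  ∑-injectsInto : ∀ k Q → ∑ (vecs xs k) (λ f → ⟦ injectsInto Q f ⟧) ≡ fallingFactorial (∑ xs (λ y → ⟦ Q y ⟧)) k
  ∑-injectsInto zero Q = refl
  ∑-injectsInto (suc k) Q = begin
    ∑ (vecs xs (suc k)) (λ f → ⟦ injectsInto Q f ⟧)
      ≡⟨ trans (∑-vecs-suc xs k _) (∑-cong xs (λ z → trans (∑-cong (vecs xs k) (λ f → ⟦∧⟧ (Q z) (injectsInto (without Q z) f)))
           (∑-*ˡ (vecs xs k) ⟦ Q z ⟧ (λ f → ⟦ injectsInto (without Q z) f ⟧)))) ⟩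
    ∑ xs (λ z → ⟦ Q z ⟧ * ∑ (vecs xs k) (λ f → ⟦ injectsInto (without Q z) f ⟧))
      ≡⟨ ∑-cong xs (λ z → ⟦⟧-cong {Q z} (λ Qz → trans (∑-injectsInto k (without Q z)) (cong (λ q → fallingFactorial q k) (∑-without Q z Qz)))) ⟩
    ∑ xs (λ z → ⟦ Q z ⟧ * fallingFactorial (∑ xs (λ y → ⟦ Q y ⟧) - 1ℤ) k)
      ≡⟨ ∑-*ʳ xs _ (λ z → ⟦ Q z ⟧) ⟩
    fallingFactorial (∑ xs (λ y → ⟦ Q y ⟧)) (suc k) ∎

  injectsInto-true : ∀ {k} Q (f : Vec A k) → injectsInto Q f ≡ true → (∀ i → Q (lookup f i) ≡ true) × InjectiveVec f
  injectsInto-true Q [] h = (λ ()) , λ ()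
  injectsInto-true Q (z ∷ f) h with ∧-true h
  ... | Qz , h′ with injectsInto-true (without Q z) f h′
  ...   | into , inj = (λ { zero → Qz ; (suc i) → proj₁ (∧-true (into i)) }) , inj′
    where
    z≢ : ∀ i → z ≢ lookup f i
    z≢ i eq = true≢false (dec-true (z ≟ lookup f i) eq) (not-true (proj₂ (∧-true {Q (lookup f i)} (into i))))
    inj′ : InjectiveVec (z ∷ f)
    inj′ zero zero eq = refl
    inj′ zero (suc j) eq = ⊥-elim (z≢ j eq)
    inj′ (suc i) zero eq = ⊥-elim (z≢ i (sym eq))
    inj′ (suc i) (suc j) eq = cong suc (inj i j eq)

  injectsInto-intro : ∀ {k} Q (f : Vec A k) → (∀ i → Q (lookup f i) ≡ true) → InjectiveVec f → injectsInto Q f ≡ true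
  injectsInto-intro Q [] into inj = refl
  injectsInto-intro Q (z ∷ f) into inj = ∧-intro (into zero) (injectsInto-intro (without Q z) f
    (λ i → ∧-intro (into (suc i)) (cong not (dec-false (z ≟ lookup f i) (λ eq → zero≢suc (inj zero (suc i) eq)))))
    (λ i j eq → Finₚ.suc-injective (inj (suc i) (suc j) eq)))
    where
    zero≢suc : ∀ {k} {i : Fin k} → zero ≢ suc i
    zero≢suc ()

  inImage? : ∀ {k} (f : Vec A k) z → Dec (∃ λ s → lookup f s ≡ z)
  inImage? f z = Finₚ.any? (λ s → lookup f s ≟ z)

  ∑-inImage : ∀ {k} (f : Vec A k) → InjectiveVec f → ∑ xs (λ z → ⟦ does (inImage? f z) ⟧) ≡ + k
  ∑-inImage {k} f inj = begin
    ∑ xs (λ z → ⟦ does (inImage? f z) ⟧)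
      ≡⟨ ∑-cong xs fibre ⟩
    ∑ xs (λ z → ∑ (allFin k) (λ s → ⟦ does (lookup f s ≟ z) ⟧))
      ≡⟨ ∑-swap xs (allFin k) _ ⟩
    ∑ (allFin k) (λ s → ∑ xs (λ z → ⟦ does (lookup f s ≟ z) ⟧))
      ≡⟨ ∑-cong (allFin k) (λ s → ∑-unique₁ e (λ z → does (lookup f s ≟ z)) (lookup f s) (dec-true (lookup f s ≟ lookup f s) refl) (λ z h → sym (does-true (lookup f s ≟ z) h))) ⟩
    ∑ (allFin k) (λ _ → 1ℤ)
      ≡⟨ trans (sym (∑-length (allFin k))) (cong +_ (length-allFin k)) ⟩
    + k ∎
    where
    fibre : ∀ z → ⟦ does (inImage? f z) ⟧ ≡ ∑ (allFin k) (λ s → ⟦ does (lookup f s ≟ z) ⟧)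
    fibre z with inImage? f z
    ... | yes (s , eq) = sym (∑-unique₁ (allFin-enum k) (λ s → does (lookup f s ≟ z)) s (dec-true (lookup f s ≟ z) eq)
            (λ s′ h → inj s′ s (trans (does-true (lookup f s′ ≟ z) h) (sym eq))))
    ... | no none = sym (∑-zero (allFin k) (λ s → cong ⟦_⟧ (dec-false (lookup f s ≟ z) (λ eq → none (s , eq)))))

  -- The part of `Q` missed by `f` has size k - k = 0, and a sum of indicators vanishes only if all
  -- of them do.
  injective⇒onto : ∀ {k} (f : Vec A k) (Q : A → Bool) → InjectiveVec f → (∀ s → Q (lookup f s) ≡ true) → ∑ xs (λ z → ⟦ Q z ⟧) ≡ + k →
    ∀ z → Q z ≡ true → ∃ λ s → lookup f s ≡ z
  injective⇒onto {k} f Q inj into size z Qz = does-true (inImage? f z) (in-image (∑-⟦⟧≡0 e (λ z → Q z ∧ not (does (inImage? f z))) rest z))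
    where
    in-image : Q z ∧ not (does (inImage? f z)) ≡ false → does (inImage? f z) ≡ true
    in-image h = double-negation (trans (cong (_∧ not (does (inImage? f z))) (sym Qz)) h)
      where
      double-negation : ∀ {b} → not b ≡ false → b ≡ true
      double-negation {true} _ = refl
    pointwise : ∀ z → ⟦ Q z ∧ not (does (inImage? f z)) ⟧ + ⟦ does (inImage? f z) ⟧ ≡ ⟦ Q z ⟧
    pointwise z with inImage? f z
    ... | yes (s , refl) rewrite into s = refl
    ... | no _ with Q z
    ...   | true = refl
    ...   | false = refl
    add-sub : ∀ a b → a ≡ a + b - b
    add-sub = solve-∀
    rest : ∑ xs (λ z → ⟦ Q z ∧ not (does (inImage? f z)) ⟧) ≡ 0ℤ
    rest = begin
      ∑ xs (λ z → ⟦ Q z ∧ not (does (inImage? f z)) ⟧)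
        ≡⟨ add-sub _ (∑ xs (λ z → ⟦ does (inImage? f z) ⟧)) ⟩
      ∑ xs (λ z → ⟦ Q z ∧ not (does (inImage? f z)) ⟧) + ∑ xs (λ z → ⟦ does (inImage? f z) ⟧) - ∑ xs (λ z → ⟦ does (inImage? f z) ⟧)
        ≡⟨ cong₂ _-_ (trans (sym (∑-+ xs _ _)) (trans (∑-cong xs pointwise) size)) (∑-inImage f inj) ⟩
      + k - + k
        ≡⟨ ℤₚ.+-inverseʳ (+ k) ⟩
      0ℤ ∎

length-perms : ∀ n → length (perms n) ≡ n !
length-perms n = ℤₚ.+-injective (begin
  + length (perms n)
    ≡⟨ sym (∑-⟦⟧-count isBijective (vecs (allFin n) n)) ⟩
  ∑ (vecs (allFin n) n) (λ σ → ⟦ isBijective σ ⟧)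
    ≡⟨ ∑-cong (vecs (allFin n) n) (λ σ → cong ⟦_⟧ (bool-ext
         (λ h → injectsInto-intro (λ _ → true) σ (λ _ → refl) (isBijective-true {σ = σ} h))
         (λ h → isBijective-intro {σ = σ} (proj₂ (injectsInto-true (λ _ → true) σ h))))) ⟩
  ∑ (vecs (allFin n) n) (λ σ → ⟦ injectsInto (λ _ → true) σ ⟧)
    ≡⟨ ∑-injectsInto n (λ _ → true) ⟩
  fallingFactorial (∑ (allFin n) (λ _ → 1ℤ)) n
    ≡⟨ cong (λ q → fallingFactorial q n) (trans (sym (∑-length (allFin n))) (cong +_ (length-allFin n))) ⟩
  fallingFactorial (+ n) n
    ≡⟨ fallingFactorial-! n ⟩
  + (n !) ∎)
  where
  open Injections (allFin-enum n)

-- Admissible tuples and invariant images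

isAdmissible : ∀ {n r} → Vec (Perm n) r → Bool
isAdmissible X = allv isBijective X ∧ pairwiseCommuting (toList X)

tuples : ∀ n r → List (Vec (Perm n) r)
tuples n r = vecs (vecs (allFin n) n) r

tuples-enum : ∀ n r → Enum (tuples n r)
tuples-enum n r = vecs-enum (vecs-enum (allFin-enum n) n) r

∑-commutingTuples : ∀ n r (g : Vec (Perm n) r → ℤ) → ∑ (commutingTuples n r) g ≡ ∑ (tuples n r) (λ X → ⟦ isAdmissible X ⟧ * g X)
∑-commutingTuples n r g = trans (∑-filterB _ (vecs (perms n) r) g) (trans (∑-vecs-filterB isBijective (vecs (allFin n) n) r _)
  (∑-cong (tuples n r) (λ X → trans (sym (ℤₚ.*-assoc ⟦ allv isBijective X ⟧ ⟦ pairwiseCommuting (toList X) ⟧ (g X)))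
    (cong (_* g X) (sym (⟦∧⟧ (allv isBijective X) (pairwiseCommuting (toList X))))))))

isAdmissible-true : ∀ {n r} {X : Vec (Perm n) r} → isAdmissible X ≡ true →
  (∀ j → Injectiveᵖ (lookup X j)) × (∀ j k → Commute (lookup X j) (lookup X k))
isAdmissible-true {X = X} h = (λ j → isBijective-true {σ = lookup X j} (allv-true X (proj₁ (∧-true h)) j)) ,
  λ j k s → ==F-true (all-Fin (all-toList-true X (all-toList-true X (proj₂ (∧-true {allv isBijective X} h)) j) k) s)

isAdmissible-intro : ∀ {n r} {X : Vec (Perm n) r} → (∀ j → Injectiveᵖ (lookup X j)) → (∀ j k → Commute (lookup X j) (lookup X k)) →
  isAdmissible X ≡ true
isAdmissible-intro {X = X} inj comm = ∧-intro (allv-intro X (λ j → isBijective-intro {σ = lookup X j} (inj j)))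
  (all-toList-intro X (λ j → all-toList-intro X (λ k → all-intro (allFin _) (λ s →
    trans (cong (_==F app (lookup X k) (app (lookup X j) s)) (comm j k s)) (==F-refl _)))))

card : ∀ {t} → Vec Bool t → ℕ
card [] = 0
card (true ∷ A) = suc (card A)
card (false ∷ A) = card A

∑-card : ∀ {t} (A : Vec Bool t) → ∑ (allFin t) (λ τ → ⟦ lookup A τ ⟧) ≡ + card A
∑-card [] = refl
∑-card {suc t} (true ∷ A) = cong (_+_ 1ℤ) (trans (∑-tabulate t suc _) (∑-card A))
∑-card {suc t} (false ∷ A) = trans (ℤₚ.+-identityˡ _) (trans (∑-tabulate t suc _) (∑-card A))

-- An injective map f from {0,…,n} to Z is equivariant for a (then unique) commuting tuple exactly when its image
-- is a union of components.
module EquivariantInjections {t r} (F : TestSet t r) (n : ℕ) where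

  open TestSet F
  open Injections enum

  inside : Vec Bool t → Z → Bool
  inside A z = lookup A (component z)

  fills? : (A : Vec Bool t) → Dec (card A ℕ.* size ≡ suc n)
  fills? A = card A ℕ.* size ℕ.≟ suc n

  weighted-∑-component : ∀ (A : Vec Bool t) (w : Z → ℤ) c → (∀ τ → ∑ elems (λ z → ⟦ component z ==F τ ⟧ * w z) ≡ c) →
    ∑ elems (λ z → ⟦ inside A z ⟧ * w z) ≡ + card A * c
  weighted-∑-component A w c h = begin
    ∑ elems (λ z → ⟦ inside A z ⟧ * w z)
      ≡⟨ ∑-cong elems (λ z → sym (∑-unique (allFin-enum t) (component z ==F_) (λ τ → ⟦ lookup A τ ⟧ * w z) (component z) (==F-refl _) (λ τ h → sym (==F-true h)))) ⟩
    ∑ elems (λ z → ∑ (allFin t) (λ τ → ⟦ component z ==F τ ⟧ * (⟦ lookup A τ ⟧ * w z)))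
      ≡⟨ ∑-swap elems (allFin t) _ ⟩
    ∑ (allFin t) (λ τ → ∑ elems (λ z → ⟦ component z ==F τ ⟧ * (⟦ lookup A τ ⟧ * w z)))
      ≡⟨ ∑-cong (allFin t) (λ τ → trans (∑-cong elems (λ z → *-swapˡ ⟦ component z ==F τ ⟧ ⟦ lookup A τ ⟧ (w z)))
           (trans (∑-*ˡ elems ⟦ lookup A τ ⟧ (λ z → ⟦ component z ==F τ ⟧ * w z)) (cong (⟦ lookup A τ ⟧ *_) (h τ)))) ⟩
    ∑ (allFin t) (λ τ → ⟦ lookup A τ ⟧ * c)
      ≡⟨ trans (∑-*ʳ (allFin t) c (λ τ → ⟦ lookup A τ ⟧)) (cong (_* c) (∑-card A)) ⟩
    + card A * c ∎

  ∑-inside : ∀ A → ∑ elems (λ z → ⟦ inside A z ⟧) ≡ + (card A ℕ.* size)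
  ∑-inside A = trans (∑-cong elems (λ z → sym (ℤₚ.*-identityʳ ⟦ inside A z ⟧))) (trans (weighted-∑-component A (λ _ → 1ℤ) (+ size)
    (λ τ → trans (∑-cong elems (λ z → ℤₚ.*-identityʳ ⟦ component z ==F τ ⟧)) (∑-component τ))) (sym (ℤₚ.pos-* (card A) size)))

  module _ (f : Vec Z (suc n)) (f-inj : InjectiveVec f) where

    lands? : ∀ A → Dec (∀ s → inside A (lookup f s) ≡ true)
    lands? A = Finₚ.all? (λ s → inside A (lookup f s) Bool.≟ true)

    actsOn : Vec (Perm (suc n)) r → Bool
    actsOn X = isAdmissible X ∧ does (equivariant? F X f)

    filledBy : Vec Bool t → Bool
    filledBy A = does (fills? A) ∧ does (lands? A)

    onto : ∀ A → filledBy A ≡ true → ∀ z → inside A z ≡ true → ∃ λ s → lookup f s ≡ z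
    onto A h = injective⇒onto f (inside A) f-inj (does-true (lands? A) (proj₂ (∧-true {does (fills? A)} h)))
      (trans (∑-inside A) (cong +_ (does-true (fills? A) (proj₁ (∧-true h)))))

    -- Take for `A` the components met by `f`. Equivariance closes the image under the action, so by
    -- transitivity each component met is filled.
    acts⇒filled : ∀ X → actsOn X ≡ true → ∃ λ A → filledBy A ≡ true
    acts⇒filled X h = A , ∧-intro (dec-true (fills? A) (ℤₚ.+-injective (begin
        + (card A ℕ.* size)                          ≡⟨ sym (∑-inside A) ⟩
        ∑ elems (λ z → ⟦ inside A z ⟧)                ≡⟨ ∑-cong elems (λ z → cong ⟦_⟧ (inside≡ z)) ⟩
        ∑ elems (λ z → ⟦ does (inImage? f z) ⟧)       ≡⟨ ∑-inImage f f-inj ⟩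
        + suc n ∎)))
      (dec-true (lands? A) (λ s → trans (at _) (dec-true (hit? _) (s , refl))))
      where
      eqv : Equivariant F X f
      eqv = does-true (equivariant? F X f) (proj₂ (∧-true {isAdmissible X} h))
      hit? : ∀ τ → Dec (∃ λ s → component (lookup f s) ≡ τ)
      hit? τ = Finₚ.any? (λ s → component (lookup f s) Fin.≟ τ)
      A : Vec Bool t
      A = Vec.tabulate (λ τ → does (hit? τ))
      at : ∀ τ → lookup A τ ≡ does (hit? τ)
      at = Vecₚ.lookup∘tabulate (λ τ → does (hit? τ))
      closed : ∀ j z → does (inImage? f z) ≡ true → does (inImage? f (acts j z)) ≡ true
      closed j z h = let (s , eq) = does-true (inImage? f z) h in
        dec-true (inImage? f (acts j z)) (app (lookup X j) s , trans (eqv j s) (cong (acts j) eq))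
      inside≡ : ∀ z → inside A z ≡ does (inImage? f z)
      inside≡ z = trans (at (component z)) (bool-ext
        (λ h → let (s , eq) = does-true (hit? (component z)) h in
          transitive (λ z → does (inImage? f z)) closed (lookup f s) z eq (dec-true (inImage? f (lookup f s)) (s , refl)))
        (λ h → let (s , eq) = does-true (inImage? f z) h in dec-true (hit? (component z)) (s , cong component eq)))

    -- The action on a union of components is transported back along `f`; injectivity and
    -- commutation are inherited from `acts`.
    filled⇒acts : ∀ A → filledBy A ≡ true → ∃ λ X → actsOn X ≡ true
    filled⇒acts A h = X , ∧-intro (isAdmissible-intro {X = X} inj comm) (dec-true (equivariant? F X f) eqv)
      where
      lands : ∀ s → inside A (lookup f s) ≡ true
      lands = does-true (lands? A) (proj₂ (∧-true {does (fills? A)} h))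
      image : ∀ j s → ∃ λ s′ → lookup f s′ ≡ acts j (lookup f s)
      image j s = onto A h (acts j (lookup f s)) (trans (cong (lookup A) (component-acts j (lookup f s))) (lands s))
      X : Vec (Perm (suc n)) r
      X = Vec.tabulate (λ j → Vec.tabulate (λ s → proj₁ (image j s)))
      at : ∀ j s → app (lookup X j) s ≡ proj₁ (image j s)
      at j s = trans (cong (λ σ → app σ s) (Vecₚ.lookup∘tabulate (λ j → Vec.tabulate (λ s → proj₁ (image j s))) j)) (Vecₚ.lookup∘tabulate (λ s → proj₁ (image j s)) s)
      eqv : Equivariant F X f
      eqv j s = trans (cong (lookup f) (at j s)) (proj₂ (image j s))
      inj : ∀ j → Injectiveᵖ (lookup X j)
      inj j s s′ eq = f-inj s s′ (acts-injective j _ _ (trans (sym (eqv j s)) (trans (cong (lookup f) eq) (eqv j s′))))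
      comm : ∀ j k → Commute (lookup X j) (lookup X k)
      comm j k s = f-inj _ _ (trans (eqv j _) (trans (cong (acts j) (eqv k s)) (trans (acts-comm j k _)
        (sym (trans (eqv k _) (cong (acts k) (eqv j s)))))))

    acts-unique : ∀ X X′ → actsOn X ≡ true → actsOn X′ ≡ true → X ≡ X′
    acts-unique X X′ h h′ = vec-ext (λ j → vec-ext (λ s → f-inj _ _ (trans
      (does-true (equivariant? F X f) (proj₂ (∧-true {isAdmissible X} h)) j s)
      (sym (does-true (equivariant? F X′ f) (proj₂ (∧-true {isAdmissible X′} h′)) j s)))))

    -- No component is empty, each containing a `point`, so `A` is recovered as the set of
    -- components that `f` reaches.
    filled-unique : ∀ A A′ → filledBy A ≡ true → filledBy A′ ≡ true → A ≡ A′
    filled-unique A A′ h h′ = vec-ext (λ τ → bool-ext (sub A A′ h h′ τ) (sub A′ A h′ h τ))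
      where
      sub : ∀ A A′ → filledBy A ≡ true → filledBy A′ ≡ true → ∀ τ → lookup A τ ≡ true → lookup A′ τ ≡ true
      sub A A′ h h′ τ Aτ = let (s , eq) = onto A h (point τ) (trans (cong (lookup A) (component-point τ)) Aτ) in
        trans (cong (lookup A′) (sym (component-point τ))) (trans (cong (λ z → lookup A′ (component z)) (sym eq))
          (does-true (lands? A′) (proj₂ (∧-true {does (fills? A′)} h′)) s))

    ∑-actsOn : ∑ (tuples (suc n) r) (λ X → ⟦ actsOn X ⟧) ≡ ∑ (vecs bools t) (λ A → ⟦ filledBy A ⟧)
    ∑-actsOn = ∑-∃! (tuples-enum (suc n) r) (vecs-enum bools-enum t) actsOn filledBy acts⇒filled filled⇒acts acts-unique filled-unique

  fs : List (Vec Z (suc n))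
  fs = vecs elems (suc n)

  injective? : (f : Vec Z (suc n)) → Dec (InjectiveVec f)
  injective? = injectiveVec? (Enum._≟_ enum)

  isEmbedding : Vec (Perm (suc n)) r → Vec Z (suc n) → Bool
  isEmbedding X f = isBase (lookup f zero) ∧ (does (injective? f) ∧ does (equivariant? F X f))

  pointedInjections : Vec Bool t → ℤ
  pointedInjections A = ∑ fs (λ f → ⟦ isBase (lookup f zero) ⟧ * ⟦ injectsInto (inside A) f ⟧)

  -- There is one base point per component in `A` for zero to go to; the other `n` points then fill
  -- the `n` remaining elements in any order.
  ∑-pointedInjections : ∀ A → card A ℕ.* size ≡ suc n → pointedInjections A ≡ + card A * + (n !)
  ∑-pointedInjections A fills = begin
    pointedInjections A
      ≡⟨ trans (∑-vecs-suc elems n _) (∑-cong elems (λ z → ∑-*ˡ (vecs elems n) ⟦ isBase z ⟧ (λ f → ⟦ injectsInto (inside A) (z ∷ f) ⟧))) ⟩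
    ∑ elems (λ z → ⟦ isBase z ⟧ * ∑ (vecs elems n) (λ f → ⟦ inside A z ∧ injectsInto (without (inside A) z) f ⟧))
      ≡⟨ ∑-cong elems (λ z → trans (cong (⟦ isBase z ⟧ *_) (trans (∑-cong (vecs elems n) (λ f → ⟦∧⟧ (inside A z) (injectsInto (without (inside A) z) f)))
           (∑-*ˡ (vecs elems n) ⟦ inside A z ⟧ (λ f → ⟦ injectsInto (without (inside A) z) f ⟧))))
           (trans (*-swapˡ ⟦ isBase z ⟧ ⟦ inside A z ⟧ _) (trans (⟦⟧-cong {inside A z} (λ h → cong (⟦ isBase z ⟧ *_) (rest z h)))
             (sym (ℤₚ.*-assoc ⟦ inside A z ⟧ ⟦ isBase z ⟧ (+ (n !))))))) ⟩
    ∑ elems (λ z → ⟦ inside A z ⟧ * ⟦ isBase z ⟧ * + (n !))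
      ≡⟨ trans (∑-*ʳ elems (+ (n !)) (λ z → ⟦ inside A z ⟧ * ⟦ isBase z ⟧)) (cong (_* + (n !)) (trans
           (weighted-∑-component A (λ z → ⟦ isBase z ⟧) 1ℤ ∑-base) (ℤₚ.*-identityʳ (+ card A)))) ⟩
    + card A * + (n !) ∎
    where
    rest : ∀ z → inside A z ≡ true → ∑ (vecs elems n) (λ f → ⟦ injectsInto (without (inside A) z) f ⟧) ≡ + (n !)
    rest z h = trans (∑-injectsInto n (without (inside A) z)) (trans (cong (λ q → fallingFactorial q n)
      (trans (∑-without (inside A) z h) (cong (_- 1ℤ) (trans (∑-inside A) (cong +_ fills))))) (fallingFactorial-! n))

  -- Summing over tuples first, for a fixed injection, replaces the tuple by the set of components
  -- it fills: either both exist and are unique, or neither exists.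
  ∑-embeddings : ∑ (tuples (suc n) r) (λ X → ⟦ isAdmissible X ⟧ * ∑ fs (λ f → ⟦ isEmbedding X f ⟧)) ≡
    ∑ (vecs bools t) (λ A → ⟦ does (fills? A) ⟧ * (+ card A * + (n !)))
  ∑-embeddings = begin
    ∑ Xs (λ X → ⟦ isAdmissible X ⟧ * ∑ fs (λ f → ⟦ isEmbedding X f ⟧))
      ≡⟨ ∑-cong Xs (λ X → sym (∑-*ˡ fs ⟦ isAdmissible X ⟧ (λ f → ⟦ isEmbedding X f ⟧))) ⟩
    ∑ Xs (λ X → ∑ fs (λ f → ⟦ isAdmissible X ⟧ * ⟦ isEmbedding X f ⟧))
      ≡⟨ ∑-swap Xs fs _ ⟩
    ∑ fs (λ f → ∑ Xs (λ X → ⟦ isAdmissible X ⟧ * ⟦ isEmbedding X f ⟧))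
      ≡⟨ ∑-cong fs (λ f → trans (∑-cong Xs (λ X → indicators (isAdmissible X) (isBase (lookup f zero)) (does (injective? f)) (does (equivariant? F X f))))
           (∑-*ˡ Xs ⟦ isBase (lookup f zero) ⟧ (λ X → ⟦ does (injective? f) ⟧ * ⟦ isAdmissible X ∧ does (equivariant? F X f) ⟧))) ⟩
    ∑ fs (λ f → ⟦ isBase (lookup f zero) ⟧ * ∑ Xs (λ X → ⟦ does (injective? f) ⟧ * ⟦ isAdmissible X ∧ does (equivariant? F X f) ⟧))
      ≡⟨ ∑-cong fs (λ f → cong (⟦ isBase (lookup f zero) ⟧ *_) (trans (∑-*ˡ Xs ⟦ does (injective? f) ⟧ (λ X → ⟦ isAdmissible X ∧ does (equivariant? F X f) ⟧)) (exchange f))) ⟩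
    ∑ fs (λ f → ⟦ isBase (lookup f zero) ⟧ * ∑ As (λ A → ⟦ does (fills? A) ⟧ * ⟦ injectsInto (inside A) f ⟧))
      ≡⟨ ∑-cong fs (λ f → trans (sym (∑-*ˡ As ⟦ isBase (lookup f zero) ⟧ (λ A → ⟦ does (fills? A) ⟧ * ⟦ injectsInto (inside A) f ⟧))) (∑-cong As (λ A → *-swapˡ ⟦ isBase (lookup f zero) ⟧ ⟦ does (fills? A) ⟧ ⟦ injectsInto (inside A) f ⟧))) ⟩
    ∑ fs (λ f → ∑ As (λ A → ⟦ does (fills? A) ⟧ * (⟦ isBase (lookup f zero) ⟧ * ⟦ injectsInto (inside A) f ⟧)))
      ≡⟨ trans (∑-swap fs As _) (∑-cong As (λ A → ∑-*ˡ fs ⟦ does (fills? A) ⟧ (λ f → ⟦ isBase (lookup f zero) ⟧ * ⟦ injectsInto (inside A) f ⟧))) ⟩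
    ∑ As (λ A → ⟦ does (fills? A) ⟧ * pointedInjections A)
      ≡⟨ ∑-cong As (λ A → ⟦⟧-cong {does (fills? A)} (λ h → ∑-pointedInjections A (does-true (fills? A) h))) ⟩
    ∑ As (λ A → ⟦ does (fills? A) ⟧ * (+ card A * + (n !))) ∎
    where
    Xs = tuples (suc n) r
    As = vecs bools t
    indicators : ∀ a b c d → ⟦ a ⟧ * ⟦ b ∧ (c ∧ d) ⟧ ≡ ⟦ b ⟧ * (⟦ c ⟧ * ⟦ a ∧ d ⟧)
    indicators true true true true = refl
    indicators true true true false = refl
    indicators true true false true = refl
    indicators true true false false = refl
    indicators true false true true = refl
    indicators true false true false = refl
    indicators true false false true = refl
    indicators true false false false = refl
    indicators false true true true = refl
    indicators false true true false = refl
    indicators false true false true = refl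
    indicators false true false false = refl
    indicators false false true true = refl
    indicators false false true false = refl
    indicators false false false true = refl
    indicators false false false false = refl
    exchange : ∀ f → ⟦ does (injective? f) ⟧ * ∑ Xs (λ X → ⟦ isAdmissible X ∧ does (equivariant? F X f) ⟧) ≡
      ∑ As (λ A → ⟦ does (fills? A) ⟧ * ⟦ injectsInto (inside A) f ⟧)
    exchange f = cases (injective? f)
      where
      cases : (d : Dec (InjectiveVec f)) → ⟦ does d ⟧ * ∑ Xs (λ X → ⟦ isAdmissible X ∧ does (equivariant? F X f) ⟧) ≡
        ∑ As (λ A → ⟦ does (fills? A) ⟧ * ⟦ injectsInto (inside A) f ⟧)
      cases (yes inj) = trans (ℤₚ.*-identityˡ (∑ Xs (λ X → ⟦ isAdmissible X ∧ does (equivariant? F X f) ⟧)))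
        (trans (∑-actsOn f inj) (∑-cong As (λ A → trans (⟦∧⟧ (does (fills? A)) (does (lands? f inj A)))
          (cong (λ b → ⟦ does (fills? A) ⟧ * ⟦ b ⟧) (bool-ext
            (λ h → injectsInto-intro (inside A) f (does-true (lands? f inj A) h) inj)
            (λ h → dec-true (lands? f inj A) (proj₁ (injectsInto-true (inside A) f h))))))))
      cases (no ¬inj) = sym (∑-zero As (λ A → trans (cong (λ b → ⟦ does (fills? A) ⟧ * ⟦ b ⟧)
        (≢true⇒≡false (λ h → ¬inj (proj₂ (injectsInto-true (inside A) f h)))))
        (ℤₚ.*-zeroʳ ⟦ does (fills? A) ⟧)))

-- Euler factors of bFun

∏ : ∀ {A : Set} → List A → (A → ℤ) → ℤ
∏ [] f = 1ℤ
∏ (x ∷ xs) f = f x * ∏ xs f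

∏-cong : ∀ {A : Set} (xs : List A) {f g : A → ℤ} → (∀ x → f x ≡ g x) → ∏ xs f ≡ ∏ xs g
∏-cong [] h = refl
∏-cong (x ∷ xs) h = cong₂ _*_ (h x) (∏-cong xs h)

∏-map : ∀ {A B : Set} (h : A → B) xs (f : B → ℤ) → ∏ (map h xs) f ≡ ∏ xs (f ∘ h)
∏-map h [] f = refl
∏-map h (x ∷ xs) f = cong (f (h x) *_) (∏-map h xs f)

prodℤ-map : ∀ {A : Set} (f : A → ℤ) xs → prodℤ (map f xs) ≡ ∏ xs f
prodℤ-map f [] = refl
prodℤ-map f (x ∷ xs) = cong (f x *_) (prodℤ-map f xs)

product-map : ∀ {A : Set} (f : A → ℕ) xs → + product (map f xs) ≡ ∏ xs (λ x → + f x)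
product-map f [] = refl
product-map f (x ∷ xs) = trans (ℤₚ.pos-* (f x) (product (map f xs))) (cong (+ f x *_) (product-map f xs))

∏-filterB : ∀ {A : Set} (p : A → Bool) xs (f : A → ℤ) → ∏ (filterB p xs) f ≡ ∏ xs (λ x → if p x then f x else 1ℤ)
∏-filterB p [] f = refl
∏-filterB p (x ∷ xs) f with p x
... | true = cong (f x *_) (∏-filterB p xs f)
... | false = trans (∏-filterB p xs f) (sym (ℤₚ.*-identityˡ _))

∏-applyUpTo : ∀ {A : Set} (h : ℕ → A) m (f : A → ℤ) → ∏ (applyUpTo h m) f ≡ ∏ (upTo m) (f ∘ h)
∏-applyUpTo h zero f = refl
∏-applyUpTo h (suc m) f = cong (f (h 0) *_) (trans (∏-applyUpTo (h ∘ suc) m f) (sym (∏-applyUpTo suc m (f ∘ h))))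

∏-upTo-suc : ∀ m (f : ℕ → ℤ) → ∏ (upTo (suc m)) f ≡ f 0 * ∏ (upTo m) (f ∘ suc)
∏-upTo-suc m f = cong (f 0 *_) (∏-applyUpTo suc m f)

∏-upTo-last : ∀ m (f : ℕ → ℤ) → ∏ (upTo (suc m)) f ≡ ∏ (upTo m) f * f m
∏-upTo-last zero f = ℤₚ.*-comm (f 0) 1ℤ
∏-upTo-last (suc m) f = begin
  ∏ (upTo (suc (suc m))) f                      ≡⟨ ∏-upTo-suc (suc m) f ⟩
  f 0 * ∏ (upTo (suc m)) (f ∘ suc)              ≡⟨ cong (f 0 *_) (∏-upTo-last m (f ∘ suc)) ⟩
  f 0 * (∏ (upTo m) (f ∘ suc) * f (suc m))      ≡⟨ sym (ℤₚ.*-assoc (f 0) (∏ (upTo m) (f ∘ suc)) (f (suc m))) ⟩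
  f 0 * ∏ (upTo m) (f ∘ suc) * f (suc m)        ≡⟨ cong (_* f (suc m)) (sym (∏-upTo-suc m f)) ⟩
  ∏ (upTo (suc m)) f * f (suc m) ∎

-- Multiplying an argument by a power of `p` alters the product over primes in the single factor at
-- `p`; this isolates that factor.
∏-upTo-change : ∀ N i₀ c {f g : ℕ → ℤ} → i₀ < N → f i₀ ≡ c * g i₀ → (∀ i → i ≢ i₀ → f i ≡ g i) →
  ∏ (upTo N) f ≡ c * ∏ (upTo N) g
∏-upTo-change (suc N) i₀ c {f} {g} (s≤s i₀≤N) at-i₀ off with i₀ ℕ.≟ N
... | yes refl = begin
  ∏ (upTo (suc N)) f           ≡⟨ ∏-upTo-last N f ⟩
  ∏ (upTo N) f * f N           ≡⟨ cong₂ _*_ (∏-upTo-cong N (λ i i<N → off i (ℕₚ.<⇒≢ i<N))) at-i₀ ⟩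
  ∏ (upTo N) g * (c * g N)     ≡⟨ *-swapˡ (∏ (upTo N) g) c (g N) ⟩
  c * (∏ (upTo N) g * g N)     ≡⟨ cong (c *_) (sym (∏-upTo-last N g)) ⟩
  c * ∏ (upTo (suc N)) g ∎
  where
  ∏-upTo-cong : ∀ N → (∀ i → i < N → f i ≡ g i) → ∏ (upTo N) f ≡ ∏ (upTo N) g
  ∏-upTo-cong zero h = refl
  ∏-upTo-cong (suc N) h = trans (∏-upTo-last N f) (trans (cong₂ _*_ (∏-upTo-cong N (λ i i<N → h i (ℕₚ.m<n⇒m<1+n i<N))) (h N ℕₚ.≤-refl)) (sym (∏-upTo-last N g)))
... | no i₀≢N = begin
  ∏ (upTo (suc N)) f           ≡⟨ ∏-upTo-last N f ⟩
  ∏ (upTo N) f * f N           ≡⟨ cong₂ _*_ (∏-upTo-change N i₀ c (ℕₚ.≤∧≢⇒< i₀≤N i₀≢N) at-i₀ off) (off N (i₀≢N ∘ sym)) ⟩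
  c * ∏ (upTo N) g * g N       ≡⟨ ℤₚ.*-assoc c (∏ (upTo N) g) (g N) ⟩
  c * (∏ (upTo N) g * g N)     ≡⟨ cong (c *_) (sym (∏-upTo-last N g)) ⟩
  c * ∏ (upTo (suc N)) g ∎

∑-upTo-< : ∀ M k → k ≤ M → ∑ (upTo M) (λ i → ⟦ does (suc i ℕ.≤? k) ⟧) ≡ + k
∑-upTo-< zero zero _ = refl
∑-upTo-< (suc M) zero _ = ∑-zero (upTo (suc M)) (λ i → cong ⟦_⟧ (dec-false (suc i ℕ.≤? 0) λ ()))
∑-upTo-< (suc M) (suc k) (s≤s k≤M) = trans (∑-upTo-suc M (λ i → ⟦ does (suc i ℕ.≤? suc k) ⟧)) (cong₂ _+_ (cong ⟦_⟧ (dec-true (1 ℕ.≤? suc k) (s≤s z≤n)))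
  (trans (∑-cong (upTo M) (λ i → cong ⟦_⟧ (does-⇔ (suc (suc i) ℕ.≤? suc k) (suc i ℕ.≤? k) ℕₚ.≤-pred s≤s))) (∑-upTo-< M k k≤M)))

prime>1 : ∀ {p} → Prime p → 1 < p
prime>1 pr = ℕ.nonTrivial⇒n>1 _ {{prime⇒nonTrivial pr}}

prime>0 : ∀ {p} → Prime p → 0 < p
prime>0 pr = ℕₚ.<-trans ℕₚ.0<1+n (prime>1 pr)

^-nonZero : ∀ {p} → Prime p → ∀ k → NonZero (p ^ k)
^-nonZero pr k = ℕₚ.m^n≢0 _ k {{prime⇒nonZero pr}}

n<p^n : ∀ {p} → 1 < p → ∀ k → k < p ^ k
n<p^n 1<p zero = s≤s z≤n
n<p^n {p} 1<p (suc k) = ℕₚ.≤-trans (s≤s (n<p^n 1<p k)) (ℕₚ.≤-trans (ℕₚ.+-monoˡ-≤ (p ^ k) (ℕₚ.≤-trans (s≤s z≤n) (n<p^n 1<p k)))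
  (ℕₚ.≤-trans (ℕₚ.≤-reflexive (cong (p ^ k ℕ.+_) (sym (ℕₚ.+-identityʳ (p ^ k))))) (ℕₚ.*-monoˡ-≤ (p ^ k) 1<p)))

p^e∣⇒≤ : ∀ {p} → Prime p → ∀ {e k m} → ¬ p ∣ m → p ^ e ∣ p ^ k ℕ.* m → e ≤ k
p^e∣⇒≤ {p} pr {e} {k} {m} p∤m d = ℕₚ.≮⇒≥ λ k<e → p∤m (Dv.∣-trans (Dv.m∣m*n (p ^ (e ∸ suc k)))
  (Dv.*-cancelˡ-∣ (p ^ k) {{^-nonZero pr k}} (subst (_∣ p ^ k ℕ.* m) (split k<e) d)))
  where
  split : k < e → p ^ e ≡ p ^ k ℕ.* (p ℕ.* p ^ (e ∸ suc k))
  split k<e = trans (cong (p ^_) (trans (sym (ℕₚ.m+[n∸m]≡n k<e)) (sym (ℕₚ.+-suc k (e ∸ suc k))))) (ℕₚ.^-distribˡ-+-* p k (suc (e ∸ suc k)))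

^-mono-∣ : ∀ p {a b} → a ≤ b → p ^ a ∣ p ^ b
^-mono-∣ p {a} {b} a≤b = Dv.divides (p ^ (b ∸ a)) (trans (cong (p ^_) (sym (ℕₚ.m∸n+n≡m a≤b))) (ℕₚ.^-distribˡ-+-* p (b ∸ a) a))

∑-range1 : ∀ m (f : ℕ → ℤ) → ∑ (range1 m) f ≡ ∑ (upTo m) (f ∘ suc)
∑-range1 m f = ∑-map suc (upTo m) f

-- The exponents that `val` counts are those from 1 to `k`, and k < p^k ensures that its search
-- range contains them all.
val-^* : ∀ {p} → Prime p → ∀ k {m} → 1 ≤ m → ¬ p ∣ m → val p (p ^ k ℕ.* m) ≡ k
val-^* {p} pr k {m} 1≤m p∤m = ℤₚ.+-injective (begin
  + val p M
    ≡⟨ sym (∑-⟦⟧-count (λ e → ⌊ (p ^ e) ∣? M ⌋) (range1 M)) ⟩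
  ∑ (range1 M) (λ e → ⟦ ⌊ (p ^ e) ∣? M ⌋ ⟧)
    ≡⟨ ∑-range1 M _ ⟩
  ∑ (upTo M) (λ i → ⟦ ⌊ (p ^ suc i) ∣? M ⌋ ⟧)
    ≡⟨ ∑-cong (upTo M) (λ i → cong ⟦_⟧ (bool-ext (λ h → dec-true (suc i ℕ.≤? k) (p^e∣⇒≤ pr p∤m (⌊⌋-true ((p ^ suc i) ∣? M) h)))
         (λ h → ⌊⌋-intro ((p ^ suc i) ∣? M) (Dv.∣-trans (^-mono-∣ p (does-true (suc i ℕ.≤? k) h)) (Dv.m∣m*n m))))) ⟩
  ∑ (upTo M) (λ i → ⟦ does (suc i ℕ.≤? k) ⟧)
    ≡⟨ ∑-upTo-< M k (ℕₚ.≤-trans (ℕₚ.<⇒≤ (n<p^n (prime>1 pr) k)) (ℕₚ.m≤m*n (p ^ k) m {{ℕ.>-nonZero 1≤m}})) ⟩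
  + k ∎)
  where
  M = p ^ k ℕ.* m

record Split (p m : ℕ) : Set where
  constructor split
  field
    exponent cofactor : ℕ
    splits : m ≡ p ^ exponent ℕ.* cofactor
    cofactor>0 : 1 ≤ cofactor
    p∤cofactor : ¬ p ∣ cofactor

splitPrime : ∀ {p} → Prime p → ∀ m → 1 ≤ m → Split p m
splitPrime {p} pr = <-rec (λ m → 1 ≤ m → Split p m) step
  where
  step : ∀ m → (∀ {q} → q < m → 1 ≤ q → Split p q) → 1 ≤ m → Split p m
  step m rec 1≤m with p ∣? m
  ... | no p∤m = split 0 m (sym (ℕₚ.*-identityˡ m)) 1≤m p∤m
  ... | yes (Dv.divides zero refl) = ⊥-elim (ℕₚ.<-irrefl refl 1≤m)
  ... | yes (Dv.divides (suc q) refl) with rec {suc q} (ℕₚ.m<m*n (suc q) p (prime>1 pr)) (s≤s z≤n)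
  ...   | split k c eq c>0 p∤c = split (suc k) c (trans (cong (ℕ._* p) eq) (trans (ℕₚ.*-comm (p ^ k ℕ.* c) p) (sym (ℕₚ.*-assoc p (p ^ k) c)))) c>0 p∤c

prime-∣-prime : ∀ {p q} → Prime p → Prime q → q ∣ p → q ≡ p
prime-∣-prime pp pq d with prime⇒irreducible pp d
... | inj₁ refl = ⊥-elim (ℕₚ.<-irrefl refl (prime>1 pq))
... | inj₂ eq = eq

prime-∤-^* : ∀ {p q} → Prime p → Prime q → q ≢ p → ∀ k {m} → ¬ q ∣ m → ¬ q ∣ p ^ k ℕ.* m
prime-∤-^* pp pq q≢p zero {m} q∤m d = q∤m (subst (_ ∣_) (ℕₚ.*-identityˡ m) d)
prime-∤-^* {p} {q} pp pq q≢p (suc k) {m} q∤m d with euclidsLemma p (p ^ k ℕ.* m) pq (subst (q ∣_) (ℕₚ.*-assoc p (p ^ k) m) d)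
... | inj₁ q∣p = q≢p (prime-∣-prime pp pq q∣p)
... | inj₂ rest = prime-∤-^* pp pq q≢p k q∤m rest

val-other : ∀ {p q} → Prime p → Prime q → q ≢ p → ∀ k {m} → 1 ≤ m → val q (p ^ k ℕ.* m) ≡ val q m
val-other {p} {q} pp pq q≢p k {m} 1≤m = begin
  val q (p ^ k ℕ.* m)                  ≡⟨ cong (val q) (trans (cong (p ^ k ℕ.*_) splits) (trans (sym (ℕₚ.*-assoc (p ^ k) (q ^ exponent) cofactor))
                                           (trans (cong (ℕ._* cofactor) (ℕₚ.*-comm (p ^ k) (q ^ exponent))) (ℕₚ.*-assoc (q ^ exponent) (p ^ k) cofactor)))) ⟩
  val q (q ^ exponent ℕ.* (p ^ k ℕ.* cofactor)) ≡⟨ val-^* pq exponent (ℕₚ.*-mono-≤ (ℕ.>-nonZero⁻¹ _ {{^-nonZero pp k}}) cofactor>0) (prime-∤-^* pp pq q≢p k p∤cofactor) ⟩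
  exponent                             ≡⟨ sym (val-^* pq exponent cofactor>0 p∤cofactor) ⟩
  val q (q ^ exponent ℕ.* cofactor)    ≡⟨ cong (val q) (sym splits) ⟩
  val q m ∎
  where
  open Split (splitPrime pq m 1≤m)

val-∤ : ∀ {p m} → Prime p → 1 ≤ m → ¬ p ∣ m → val p m ≡ 0
val-∤ {p} {m} pr 1≤m p∤m = trans (cong (val p) (sym (ℕₚ.*-identityˡ m))) (val-^* pr 0 1≤m p∤m)

-- For `p > 1` this is the coefficient of x^k in the product of 1 - p^i x over i < r, by the
-- q-binomial theorem.
localFactor : ℕ → ℕ → ℕ → ℤ
localFactor r p k = sign k * + (p ^ (k C 2)) * + pBinom p r k

primeTerm : ℕ → ℕ → ℕ → ℤ
primeTerm r m i = if ⌊ prime? (suc i) ⌋ then localFactor r (suc i) (val (suc i) m) else 1ℤ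

bFun-∏ : ∀ r m → bFun r m ≡ ∏ (upTo m) (primeTerm r m)
bFun-∏ r m = trans (prodℤ-map _ (filterB (λ p → ⌊ prime? p ⌋) (range1 m))) (trans (∏-filterB (λ p → ⌊ prime? p ⌋) (range1 m) _) (∏-map suc (upTo m) _))

primeTerm-> : ∀ r m i → 1 ≤ m → m ≤ i → primeTerm r m i ≡ 1ℤ
primeTerm-> r m i 1≤m m≤i with prime? (suc i)
... | no _ = refl
... | yes pr = cong (localFactor r (suc i)) (val-∤ pr 1≤m (λ d → ℕₚ.<⇒≱ (s≤s m≤i) (Dv.∣⇒≤ {{ℕ.>-nonZero 1≤m}} d)))

-- The product defining `bFun` has a length depending on its argument. Padding with factors 1 allows
-- two arguments to be compared over the same range.
bFun-∏-extended : ∀ r m j → 1 ≤ m → bFun r m ≡ ∏ (upTo (j ℕ.+ m)) (primeTerm r m)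
bFun-∏-extended r m zero 1≤m = bFun-∏ r m
bFun-∏-extended r m (suc j) 1≤m = sym (trans (∏-upTo-last (j ℕ.+ m) (primeTerm r m))
  (trans (cong (∏ (upTo (j ℕ.+ m)) (primeTerm r m) *_) (primeTerm-> r m (j ℕ.+ m) 1≤m (ℕₚ.m≤n+m m j)))
    (trans (ℤₚ.*-identityʳ (∏ (upTo (j ℕ.+ m)) (primeTerm r m))) (sym (bFun-∏-extended r m j 1≤m)))))

bFun-^* : ∀ r {p} → Prime p → ∀ k {m} → 1 ≤ m → ¬ p ∣ m → bFun r (p ^ k ℕ.* m) ≡ localFactor r p k * bFun r m
bFun-^* r {p} pr zero {m} 1≤m p∤m = trans (cong (bFun r) (ℕₚ.*-identityˡ m)) (sym (ℤₚ.*-identityˡ (bFun r m)))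
bFun-^* r {zero} pr (suc k) {m} 1≤m p∤m = ⊥-elim (ℕₚ.<-irrefl refl (prime>0 pr))
bFun-^* r {p@(suc i₀)} pr (suc k) {m} 1≤m p∤m = begin
  bFun r M
    ≡⟨ bFun-∏ r M ⟩
  ∏ (upTo M) (primeTerm r M)
    ≡⟨ ∏-upTo-change M i₀ (localFactor r p (suc k)) i₀<M at-p off-p ⟩
  localFactor r p (suc k) * ∏ (upTo M) (primeTerm r m)
    ≡⟨ cong (localFactor r p (suc k) *_) (trans (cong (λ N → ∏ (upTo N) (primeTerm r m)) (sym (ℕₚ.m∸n+n≡m m≤M))) (sym (bFun-∏-extended r m (M ∸ m) 1≤m))) ⟩
  localFactor r p (suc k) * bFun r m ∎
  where
  M = p ^ suc k ℕ.* m
  m≤M : m ≤ M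
  m≤M = ℕₚ.m≤n*m m (p ^ suc k) {{^-nonZero pr (suc k)}}
  1≤M : 1 ≤ M
  1≤M = ℕₚ.≤-trans 1≤m m≤M
  i₀<M : i₀ < M
  i₀<M = Dv.∣⇒≤ {{ℕ.>-nonZero 1≤M}} (Dv.∣-trans (Dv.m∣m*n (p ^ k)) (Dv.m∣m*n m))
  at-p : primeTerm r M i₀ ≡ localFactor r p (suc k) * primeTerm r m i₀
  at-p with prime? p
  ... | no ¬pr = ⊥-elim (¬pr pr)
  ... | yes _ = trans (cong (localFactor r p) (val-^* pr (suc k) 1≤m p∤m))
          (sym (trans (cong (λ v → localFactor r p (suc k) * localFactor r p v) (val-∤ pr 1≤m p∤m)) (ℤₚ.*-identityʳ (localFactor r p (suc k)))))
  off-p : ∀ i → i ≢ i₀ → primeTerm r M i ≡ primeTerm r m i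
  off-p i i≢ with prime? (suc i)
  ... | no _ = refl
  ... | yes pq = cong (localFactor r (suc i)) (val-other pr pq (i≢ ∘ ℕₚ.suc-injective) (suc k) 1≤m)

∏-*ˡ : ∀ c m (f : ℕ → ℤ) → ∏ (upTo m) (λ i → + c * f i) ≡ + (c ^ m) * ∏ (upTo m) f
∏-*ˡ c zero f = refl
∏-*ˡ c (suc m) f = begin
  ∏ (upTo (suc m)) (λ i → + c * f i)                 ≡⟨ ∏-upTo-last m (λ i → + c * f i) ⟩
  ∏ (upTo m) (λ i → + c * f i) * (+ c * f m)         ≡⟨ cong (_* (+ c * f m)) (∏-*ˡ c m f) ⟩
  + (c ^ m) * ∏ (upTo m) f * (+ c * f m)             ≡⟨ rearrange (+ (c ^ m)) (∏ (upTo m) f) (+ c) (f m) ⟩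
  + c * + (c ^ m) * (∏ (upTo m) f * f m)             ≡⟨ cong₂ _*_ (sym (ℤₚ.pos-* c (c ^ m))) (sym (∏-upTo-last m f)) ⟩
  + (c ^ suc m) * ∏ (upTo (suc m)) f ∎
  where
  rearrange : ∀ a b c d → a * b * (c * d) ≡ c * a * (b * d)
  rearrange = solve-∀

-- Gaussian binomials and the q-Pascal rules

module QPascal (p : ℕ) (1<p : 1 < p) where

  pw : ℕ → ℤ
  pw k = + (p ^ k)

  pw-suc : ∀ k → pw (suc k) ≡ + p * pw k
  pw-suc k = ℤₚ.pos-* p (p ^ k)

  -- For prime `p`, the number of linearly independent ordered `d`-tuples in an `r`-dimensional
  -- space over the field with `p` elements; taken in ℤ to have honest subtraction.
  frames : ℕ → ℕ → ℤ
  frames r d = ∏ (upTo d) (λ i → pw r - pw i)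

  frames-last : ∀ r d → frames r (suc d) ≡ frames r d * (pw r - pw d)
  frames-last r d = ∏-upTo-last d (λ i → pw r - pw i)

  frames-suc : ∀ r d → frames (suc r) (suc d) ≡ pw d * (pw (suc r) - 1ℤ) * frames r d
  frames-suc r d = begin
    frames (suc r) (suc d)
      ≡⟨ ∏-upTo-suc d (λ i → pw (suc r) - pw i) ⟩
    (pw (suc r) - 1ℤ) * ∏ (upTo d) (λ i → pw (suc r) - pw (suc i))
      ≡⟨ cong ((pw (suc r) - 1ℤ) *_) (trans (∏-cong (upTo d) (λ i → trans (cong₂ _-_ (pw-suc r) (pw-suc i)) (factor (+ p) (pw r) (pw i)))) (∏-*ˡ p d (λ i → pw r - pw i))) ⟩
    (pw (suc r) - 1ℤ) * (pw d * frames r d)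
      ≡⟨ rearrange (pw (suc r) - 1ℤ) (pw d) (frames r d) ⟩
    pw d * (pw (suc r) - 1ℤ) * frames r d ∎
    where
    factor : ∀ a b c → a * b - a * c ≡ a * (b - c)
    factor = solve-∀
    rearrange : ∀ a b c → a * (b * c) ≡ b * a * c
    rearrange = solve-∀

  frames-> : ∀ {r d} → r < d → frames r d ≡ 0ℤ
  frames-> {r} {suc d} (s≤s r≤d) with r ℕ.≟ d
  ... | yes refl = trans (frames-last r r) (trans (cong (frames r r *_) (ℤₚ.+-inverseʳ (pw r))) (ℤₚ.*-zeroʳ (frames r r)))
  ... | no r≢d = trans (frames-last r d) (cong (_* (pw r - pw d)) (frames-> (ℕₚ.≤∧≢⇒< r≤d r≢d)))

  pw-mono : ∀ {i r} → i ≤ r → p ^ i ≤ p ^ r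
  pw-mono i≤r = ℕₚ.^-monoʳ-≤ p {{ℕ.>-nonZero (ℕₚ.<-trans ℕₚ.0<1+n 1<p)}} i≤r

  -- For d > r both sides vanish through the factor i = r, so truncated subtraction is harmless.
  product-frames : ∀ r d → + product (map (λ i → p ^ r ∸ p ^ i) (upTo d)) ≡ frames r d
  product-frames r d = trans (product-map (λ i → p ^ r ∸ p ^ i) (upTo d)) (go d)
    where
    term : ℕ → ℤ
    term i = + (p ^ r ∸ p ^ i)
    go : ∀ d → ∏ (upTo d) term ≡ frames r d
    go zero = refl
    go (suc d) with d ℕ.≤? r
    ... | yes d≤r = trans (∏-upTo-last d term) (trans (cong₂ _*_ (go d)
            (trans (sym (ℤₚ.⊖-≥ (pw-mono d≤r))) (sym (ℤₚ.m-n≡m⊖n (p ^ r) (p ^ d))))) (sym (frames-last r d)))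
    ... | no d≰r = trans (∏-upTo-last d term) (trans (cong (_* term d) (trans (go d) (frames-> (ℕₚ.≰⇒> d≰r)))) (sym (frames-> (ℕₚ.m<n⇒m<1+n (ℕₚ.≰⇒> d≰r)))))

  -- The Gaussian binomial defined by one of its two Pascal rules, which makes integrality evident.
  gauss : ℕ → ℕ → ℕ
  gauss r zero = 1
  gauss zero (suc k) = 0
  gauss (suc r) (suc k) = p ^ suc k ℕ.* gauss r (suc k) ℕ.+ gauss r k

  gauss-frames : ∀ r k → + gauss r k * frames k k ≡ frames r k
  gauss-frames r zero = refl
  gauss-frames zero (suc k) = sym (frames-> {0} {suc k} (s≤s z≤n))
  gauss-frames (suc r) (suc k) = begin
    + (p ^ suc k ℕ.* gauss r (suc k) ℕ.+ gauss r k) * frames (suc k) (suc k)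
      ≡⟨ cong (_* frames (suc k) (suc k)) (trans (ℤₚ.pos-+ (p ^ suc k ℕ.* gauss r (suc k)) (gauss r k)) (cong (_+ + gauss r k) (ℤₚ.pos-* (p ^ suc k) (gauss r (suc k))))) ⟩
    (pw (suc k) * + gauss r (suc k) + + gauss r k) * frames (suc k) (suc k)
      ≡⟨ distribute (pw (suc k)) (+ gauss r (suc k)) (+ gauss r k) (frames (suc k) (suc k)) ⟩
    pw (suc k) * (+ gauss r (suc k) * frames (suc k) (suc k)) + + gauss r k * frames (suc k) (suc k)
      ≡⟨ cong₂ (λ a b → pw (suc k) * a + + gauss r k * b) (trans (gauss-frames r (suc k)) (frames-last r k)) (frames-suc k k) ⟩
    pw (suc k) * (frames r k * (pw r - pw k)) + + gauss r k * (pw k * (pw (suc k) - 1ℤ) * frames k k)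
      ≡⟨ cong (λ b → pw (suc k) * (frames r k * (pw r - pw k)) + b) (trans (*-swapˡ (+ gauss r k) (pw k * (pw (suc k) - 1ℤ)) (frames k k)) (cong (pw k * (pw (suc k) - 1ℤ) *_) (gauss-frames r k))) ⟩
    pw (suc k) * (frames r k * (pw r - pw k)) + pw k * (pw (suc k) - 1ℤ) * frames r k
      ≡⟨ cong (λ z → z * (frames r k * (pw r - pw k)) + pw k * (z - 1ℤ) * frames r k) (pw-suc k) ⟩
    + p * pw k * (frames r k * (pw r - pw k)) + pw k * (+ p * pw k - 1ℤ) * frames r k
      ≡⟨ final (+ p) (pw k) (frames r k) (pw r) ⟩
    pw k * (+ p * pw r - 1ℤ) * frames r k
      ≡⟨ cong (λ z → pw k * (z - 1ℤ) * frames r k) (sym (pw-suc r)) ⟩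
    pw k * (pw (suc r) - 1ℤ) * frames r k
      ≡⟨ sym (frames-suc r k) ⟩
    frames (suc r) (suc k) ∎
    where
    distribute : ∀ a b c d → (a * b + c) * d ≡ a * (b * d) + c * d
    distribute = solve-∀
    final : ∀ q k f r → q * k * (f * (r - k)) + k * (q * k - 1ℤ) * f ≡ k * (q * r - 1ℤ) * f
    final = solve-∀

  frames-nonZero : ∀ k → frames k k ≢ 0ℤ
  frames-nonZero zero ()
  frames-nonZero (suc k) eq with ℤₚ.i*j≡0⇒i≡0∨j≡0 (pw k * (pw (suc k) - 1ℤ)) (trans (sym (frames-suc k k)) eq)
  ... | inj₂ z = frames-nonZero k z
  ... | inj₁ z with ℤₚ.i*j≡0⇒i≡0∨j≡0 (pw k) z
  ...   | inj₁ w = ℕₚ.<⇒≢ (ℕₚ.≤-trans (s≤s z≤n) (n<p^n 1<p k)) (sym (ℤₚ.+-injective w))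
  ...   | inj₂ w = ℕₚ.<⇒≢ (ℕₚ.≤-trans (s≤s (s≤s z≤n)) (n<p^n 1<p (suc k))) (sym (ℤₚ.+-injective (ℤₚ.i-j≡0⇒i≡j (pw (suc k)) 1ℤ w)))

  frames-cancel : ∀ k {a b} → a * frames k k ≡ b * frames k k → a ≡ b
  frames-cancel k {a} {b} eq = ℤₚ.*-cancelʳ-≡ a b (frames k k) {{ℤ.≢-nonZero (frames-nonZero k)}} eq

  divℕ-exact : ∀ a b → b ≢ 0 → divℕ (a ℕ.* b) b ≡ a
  divℕ-exact a zero b≢0 = ⊥-elim (b≢0 refl)
  divℕ-exact a (suc b) _ = DM.m*n/n≡m a (suc b)

  -- The numerator of `pBinom` is `gauss r k` times its denominator, so the floor division is exact.
  pBinom-gauss : ∀ r k → pBinom p r k ≡ gauss r k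
  pBinom-gauss r k = trans (cong (λ N → divℕ N den) num≡) (divℕ-exact (gauss r k) den (λ z → frames-nonZero k (trans (sym (product-frames k k)) (cong +_ z))))
    where
    den = product (map (λ i → p ^ k ∸ p ^ i) (upTo k))
    num≡ : product (map (λ i → p ^ r ∸ p ^ i) (upTo k)) ≡ gauss r k ℕ.* den
    num≡ = ℤₚ.+-injective (trans (product-frames r k) (trans (sym (gauss-frames r k))
      (trans (cong (+ gauss r k *_) (sym (product-frames k k))) (sym (ℤₚ.pos-* (gauss r k) den)))))

  -- The other Pascal rule, whose coefficient is p^(r-k); multiplying through by p^k keeps the
  -- exponents nonnegative.
  gauss-pascal : ∀ r k → pw k * + gauss (suc r) (suc k) ≡ pw k * + gauss r (suc k) + pw r * + gauss r k
  gauss-pascal r k = frames-cancel (suc k) (begin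
    pw k * + gauss (suc r) (suc k) * D
      ≡⟨ trans (ℤₚ.*-assoc (pw k) (+ gauss (suc r) (suc k)) D) (cong (pw k *_) (trans (gauss-frames (suc r) (suc k)) (frames-suc r k))) ⟩
    pw k * (pw k * (pw (suc r) - 1ℤ) * F)
      ≡⟨ cong (λ z → pw k * (pw k * (z - 1ℤ) * F)) (pw-suc r) ⟩
    pw k * (pw k * (+ p * pw r - 1ℤ) * F)
      ≡⟨ sym (final (+ p) (pw k) F (pw r)) ⟩
    pw k * (F * (pw r - pw k)) + pw r * (pw k * (+ p * pw k - 1ℤ) * F)
      ≡⟨ cong (λ z → pw k * (F * (pw r - pw k)) + pw r * (pw k * (z - 1ℤ) * F)) (sym (pw-suc k)) ⟩
    pw k * (F * (pw r - pw k)) + pw r * (pw k * (pw (suc k) - 1ℤ) * F)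
      ≡⟨ cong₂ (λ a b → pw k * a + pw r * b) (trans (sym (frames-last r k)) (sym (gauss-frames r (suc k))))
           (trans (cong (pw k * (pw (suc k) - 1ℤ) *_) (sym (gauss-frames r k))) (trans (*-swapˡ (pw k * (pw (suc k) - 1ℤ)) (+ gauss r k) (frames k k)) (cong (+ gauss r k *_) (sym (frames-suc k k))))) ⟩
    pw k * (+ gauss r (suc k) * D) + pw r * (+ gauss r k * D)
      ≡⟨ collect (pw k) (+ gauss r (suc k)) D (pw r) (+ gauss r k) ⟩
    (pw k * + gauss r (suc k) + pw r * + gauss r k) * D ∎)
    where
    D = frames (suc k) (suc k)
    F = frames r k
    final : ∀ q k f r → k * (f * (r - k)) + r * (k * (q * k - 1ℤ) * f) ≡ k * (k * (q * r - 1ℤ) * f)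
    final = solve-∀
    collect : ∀ a b c d e → a * (b * c) + d * (e * c) ≡ (a * b + d * e) * c
    collect = solve-∀

  choose-2 : ∀ k → suc k C 2 ≡ k C 2 ℕ.+ k
  choose-2 k = trans (sym (Comb.nCk+nC[k+1]≡[n+1]C[k+1] k 1)) (trans (ℕₚ.+-comm (k C 1) (k C 2)) (cong (k C 2 ℕ.+_) (Comb.nC1≡n k)))

  -- Multiplication of the generating polynomial by 1 - p^r x. The power p^k demanded by
  -- `gauss-pascal` comes from the growth of the binomial exponent by `k`.
  localFactor-suc : ∀ r k → localFactor (suc r) p (suc k) ≡ localFactor r p (suc k) + - pw r * localFactor r p k
  localFactor-suc r k = begin
    - sign k * pw (suc k C 2) * + pBinom p (suc r) (suc k)
      ≡⟨ cong₂ (λ a b → - sign k * a * b) pw-choose (cong +_ (pBinom-gauss (suc r) (suc k))) ⟩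
    - sign k * (pw (k C 2) * pw k) * + gauss (suc r) (suc k)
      ≡⟨ assoc (sign k) (pw (k C 2)) (pw k) (+ gauss (suc r) (suc k)) ⟩
    - sign k * pw (k C 2) * (pw k * + gauss (suc r) (suc k))
      ≡⟨ cong (- sign k * pw (k C 2) *_) (gauss-pascal r k) ⟩
    - sign k * pw (k C 2) * (pw k * + gauss r (suc k) + pw r * + gauss r k)
      ≡⟨ distribute (sign k) (pw (k C 2)) (pw k) (+ gauss r (suc k)) (pw r) (+ gauss r k) ⟩
    - sign k * (pw (k C 2) * pw k) * + gauss r (suc k) + - pw r * (sign k * pw (k C 2) * + gauss r k)
      ≡⟨ cong₂ (λ a b → a + - pw r * b) (cong₂ (λ a b → - sign k * a * b) (sym pw-choose) (cong +_ (sym (pBinom-gauss r (suc k)))))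
           (cong (λ b → sign k * pw (k C 2) * + b) (sym (pBinom-gauss r k))) ⟩
    localFactor r p (suc k) + - pw r * localFactor r p k ∎
    where
    pw-choose : pw (suc k C 2) ≡ pw (k C 2) * pw k
    pw-choose = trans (cong pw (choose-2 k)) (trans (cong +_ (ℕₚ.^-distribˡ-+-* p (k C 2) k)) (ℤₚ.pos-* (p ^ (k C 2)) (p ^ k)))
    assoc : ∀ a b c d → - a * (b * c) * d ≡ - a * b * (c * d)
    assoc = solve-∀
    distribute : ∀ a b c d e f → - a * b * (c * d + e * f) ≡ - a * (b * c) * d + - e * (a * b * f)
    distribute = solve-∀

  localFactor-zero : ∀ k → localFactor 0 p (suc k) ≡ 0ℤ
  localFactor-zero k = trans (cong (λ b → - sign k * pw (suc k C 2) * + b) (pBinom-gauss 0 (suc k))) (ℤₚ.*-zeroʳ (- sign k * pw (suc k C 2)))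

∑-upTo-allFin : ∀ N (f : ℕ → ℤ) → ∑ (upTo N) f ≡ ∑ (allFin N) (f ∘ toℕ)
∑-upTo-allFin zero f = refl
∑-upTo-allFin (suc N) f = trans (∑-upTo-suc N f) (cong (_+_ (f 0)) (trans (∑-upTo-allFin N (f ∘ suc)) (sym (∑-tabulate N suc (f ∘ toℕ)))))

-- Dirichlet convolution

-- The correspondence is a relation instead of a function: dividing out a power of `p`, or staying
-- within the index bound after multiplying by one, makes sense only on the supports.
∑-reindex : ∀ {A B : Set} {xs : List A} {ys : List B} → Enum xs → Enum ys →
  (P : A → Bool) (f : A → ℤ) (Q : B → Bool) (g : B → ℤ) (R : A → B → Bool) →
  (∀ x → P x ≡ true → ∃ λ y → Q y ≡ true × R x y ≡ true) →
  (∀ y → Q y ≡ true → ∃ λ x → P x ≡ true × R x y ≡ true) →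
  (∀ x y y′ → R x y ≡ true → R x y′ ≡ true → y ≡ y′) →
  (∀ x x′ y → R x y ≡ true → R x′ y ≡ true → x ≡ x′) →
  (∀ x y → P x ≡ true → Q y ≡ true → R x y ≡ true → f x ≡ g y) →
  ∑ xs (λ x → ⟦ P x ⟧ * f x) ≡ ∑ ys (λ y → ⟦ Q y ⟧ * g y)
∑-reindex {xs = xs} {ys} ex ey P f Q g R to from uy ux eq = begin
  ∑ xs (λ x → ⟦ P x ⟧ * f x)
    ≡⟨ ∑-cong xs (λ x → ⟦⟧-cong {P x} (λ Px → let (y , Qy , Rxy) = to x Px in
         sym (∑-unique ey (λ y → Q y ∧ R x y) (λ _ → f x) y (∧-intro Qy Rxy) (λ y′ h → uy x y′ y (proj₂ (∧-true {Q y′} h)) Rxy)))) ⟩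
  ∑ xs (λ x → ⟦ P x ⟧ * ∑ ys (λ y → ⟦ Q y ∧ R x y ⟧ * f x))
    ≡⟨ ∑-cong xs (λ x → sym (∑-*ˡ ys ⟦ P x ⟧ (λ y → ⟦ Q y ∧ R x y ⟧ * f x))) ⟩
  ∑ xs (λ x → ∑ ys (λ y → ⟦ P x ⟧ * (⟦ Q y ∧ R x y ⟧ * f x)))
    ≡⟨ trans (∑-swap xs ys _) (∑-cong ys (λ y → ∑-cong xs (λ x → transfer (P x) (Q y) (R x y) (f x) (g y) (eq x y)))) ⟩
  ∑ ys (λ y → ∑ xs (λ x → ⟦ Q y ⟧ * (⟦ P x ∧ R x y ⟧ * g y)))
    ≡⟨ ∑-cong ys (λ y → ∑-*ˡ xs ⟦ Q y ⟧ (λ x → ⟦ P x ∧ R x y ⟧ * g y)) ⟩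
  ∑ ys (λ y → ⟦ Q y ⟧ * ∑ xs (λ x → ⟦ P x ∧ R x y ⟧ * g y))
    ≡⟨ ∑-cong ys (λ y → ⟦⟧-cong {Q y} (λ Qy → let (x , Px , Rxy) = from y Qy in
         ∑-unique ex (λ x → P x ∧ R x y) (λ _ → g y) x (∧-intro Px Rxy) (λ x′ h → ux x′ x y (proj₂ (∧-true {P x′} h)) Rxy))) ⟩
  ∑ ys (λ y → ⟦ Q y ⟧ * g y) ∎
  where
  transfer : ∀ a b c z w → (a ≡ true → b ≡ true → c ≡ true → z ≡ w) → ⟦ a ⟧ * (⟦ b ∧ c ⟧ * z) ≡ ⟦ b ⟧ * (⟦ a ∧ c ⟧ * w)
  transfer true true true z w h = cong (λ y → 1ℤ * (1ℤ * y)) (h refl refl refl)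
  transfer true true false z w h = refl
  transfer true false c z w h = refl
  transfer false true c z w h = refl
  transfer false false c z w h = refl

value : ∀ {N} → Fin N → ℕ
value i = suc (toℕ i)

value-injective : ∀ {N} {i j : Fin N} → value i ≡ value j → i ≡ j
value-injective eq = Finₚ.toℕ-injective (ℕₚ.suc-injective eq)

value-surjective : ∀ {N c} → 1 ≤ c → c ≤ N → ∃ λ (i : Fin N) → value i ≡ c
value-surjective {N} {suc c} _ c<N = Fin.fromℕ< c<N , cong suc (Finₚ.toℕ-fromℕ< c<N)

-- Dirichlet convolution at `m` as soon as `N` is at least `m`; a common cutoff lets values at
-- different arguments be compared term by term.
convolve : ℕ → (ℕ → ℤ) → (ℕ → ℤ) → ℕ → ℤ
convolve N g h m = ∑ (upTo N) (λ a → ∑ (upTo N) (λ b → ⟦ does (suc a ℕ.* suc b ℕ.≟ m) ⟧ * (g (suc a) * h (suc b))))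

square : ∀ N → List (Fin N × Fin N)
square N = pairs (allFin N) (allFin N)

square-enum : ∀ N → Enum (square N)
square-enum N = pairs-enum (allFin-enum N) (allFin-enum N)

convolve-square : ∀ N g h m → convolve N g h m ≡ ∑ (square N) (λ (i , j) → ⟦ does (value i ℕ.* value j ℕ.≟ m) ⟧ * (g (value i) * h (value j)))
convolve-square N g h m = trans (∑-upTo-allFin N _) (trans (∑-cong (allFin N) (λ i → ∑-upTo-allFin N _)) (sym (∑-pairs (allFin N) (allFin N) _)))

coprime-cancel : ∀ {p} → Prime p → ∀ j {a b} → ¬ p ∣ a → p ^ j ∣ a ℕ.* b → p ^ j ∣ b
coprime-cancel pr zero {b = b} _ _ = Dv.1∣ b
coprime-cancel {p} pr (suc j) {a} {b} p∤a d with euclidsLemma a b pr (Dv.∣-trans (Dv.m∣m*n (p ^ j)) d)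
... | inj₁ p∣a = ⊥-elim (p∤a p∣a)
... | inj₂ (Dv.divides q refl) = subst (p ^ suc j ∣_) (ℕₚ.*-comm p q) (Dv.*-monoʳ-∣ p (coprime-cancel pr j p∤a
        (Dv.*-cancelˡ-∣ p {{prime⇒nonZero pr}} (subst (p ^ suc j ∣_) (trans (sym (ℕₚ.*-assoc a q p)) (ℕₚ.*-comm (a ℕ.* q) p)) d))))

-- The Euler factor at p of a Dirichlet convolution g ∗ h, when g has Euler factor 1 + c x.
module EulerFactor {p} (pr : Prime p) (N : ℕ) (g h : ℕ → ℤ) (c : ℤ) (η : ℕ → ℤ)
  (g-p : ∀ m → 1 ≤ m → ¬ p ∣ m → g (p ℕ.* m) ≡ c * g m)
  (g-p² : ∀ m → 1 ≤ m → p ℕ.* p ∣ m → g m ≡ 0ℤ)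
  (h-p : ∀ k m → 1 ≤ m → ¬ p ∣ m → h (p ^ k ℕ.* m) ≡ η k * h m)
  (k m : ℕ) (1≤m : 1 ≤ m) (p∤m : ¬ p ∣ m) (M≤N : p ^ suc k ℕ.* m ≤ N) where

  M : ℕ
  M = p ^ suc k ℕ.* m

  is-product : ℕ → Fin N × Fin N → Bool
  is-product m (i , j) = does (value i ℕ.* value j ℕ.≟ m)

  term : Fin N × Fin N → ℤ
  term (i , j) = g (value i) * h (value j)

  divides-p divides-p² : Fin N × Fin N → Bool
  divides-p (i , j) = does (p ∣? value i)
  divides-p² (i , j) = does (p ℕ.* p ∣? value i)

  A B : Fin N × Fin N → Bool
  A x = is-product M x ∧ not (divides-p x)
  B x = is-product M x ∧ (divides-p x ∧ not (divides-p² x))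

  -- The first factor contains `p` not at all, exactly once, or at least twice, and in the last case
  -- `g` vanishes.
  three-cases : ∀ x → ⟦ is-product M x ⟧ * term x ≡ ⟦ A x ⟧ * term x + ⟦ B x ⟧ * term x
  three-cases x@(i , j) with is-product M x | p ∣? value i | p ℕ.* p ∣? value i
  ... | false | _ | _ = refl
  ... | true | no _ | _ = sym (ℤₚ.+-identityʳ (1ℤ * term x))
  ... | true | yes _ | no _ = sym (ℤₚ.+-identityˡ (1ℤ * term x))
  ... | true | yes _ | yes d = trans (ℤₚ.*-identityˡ (term x)) (cong (_* h (value j)) (g-p² (value i) (s≤s z≤n) d))

  not-false : ∀ {P : Set} (d : Dec P) → not (does d) ≡ true → ¬ P
  not-false (no ¬p) _ = ¬p

  Q : Fin N × Fin N → Bool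
  Q = is-product m

  Q-p∤ˡ : ∀ (i j : Fin N) → value i ℕ.* value j ≡ m → ¬ p ∣ value i
  Q-p∤ˡ i j eq d = p∤m (subst (p ∣_) eq (Dv.∣-trans d (Dv.m∣m*n (value j))))

  Q-p∤ʳ : ∀ (i j : Fin N) → value i ℕ.* value j ≡ m → ¬ p ∣ value j
  Q-p∤ʳ i j eq d = p∤m (subst (p ∣_) eq (Dv.∣-trans d (Dv.n∣m*n (value i))))

  scaled : ∀ e f → (Fin N × Fin N) → (Fin N × Fin N) → Bool
  scaled e f (i , j) (i′ , j′) = does (value i ℕ.≟ p ^ e ℕ.* value i′) ∧ does (value j ℕ.≟ p ^ f ℕ.* value j′)

  scaled-true : ∀ e f (i j i′ j′ : Fin N) → scaled e f (i , j) (i′ , j′) ≡ true → value i ≡ p ^ e ℕ.* value i′ × value j ≡ p ^ f ℕ.* value j′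
  scaled-true e f i j i′ j′ h = does-true (value i ℕ.≟ p ^ e ℕ.* value i′) (proj₁ (∧-true h)) ,
    does-true (value j ℕ.≟ p ^ f ℕ.* value j′) (proj₂ (∧-true {does (value i ℕ.≟ p ^ e ℕ.* value i′)} h))

  scaled-intro : ∀ e f (i j i′ j′ : Fin N) → value i ≡ p ^ e ℕ.* value i′ → value j ≡ p ^ f ℕ.* value j′ → scaled e f (i , j) (i′ , j′) ≡ true
  scaled-intro e f i j i′ j′ a b = ∧-intro (dec-true (value i ℕ.≟ p ^ e ℕ.* value i′) a) (dec-true (value j ℕ.≟ p ^ f ℕ.* value j′) b)

  scaled-uniqueʳ : ∀ e f (x y y′ : Fin N × Fin N) → scaled e f x y ≡ true → scaled e f x y′ ≡ true → y ≡ y′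
  scaled-uniqueʳ e f (i , j) (i₁ , j₁) (i₂ , j₂) h h′ =
    let (a , b) = scaled-true e f i j i₁ j₁ h ; (a′ , b′) = scaled-true e f i j i₂ j₂ h′ in
    cong₂ _,_ (value-injective (ℕₚ.*-cancelˡ-≡ (value i₁) (value i₂) (p ^ e) {{^-nonZero pr e}} (trans (sym a) a′)))
              (value-injective (ℕₚ.*-cancelˡ-≡ (value j₁) (value j₂) (p ^ f) {{^-nonZero pr f}} (trans (sym b) b′)))

  scaled-uniqueˡ : ∀ e f (x x′ y : Fin N × Fin N) → scaled e f x y ≡ true → scaled e f x′ y ≡ true → x ≡ x′
  scaled-uniqueˡ e f (i , j) (i′ , j′) (i₁ , j₁) h h′ =
    let (a , b) = scaled-true e f i j i₁ j₁ h ; (a′ , b′) = scaled-true e f i′ j′ i₁ j₁ h′ in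
    cong₂ _,_ (value-injective (trans a (sym a′))) (value-injective (trans b (sym b′)))

  interchange : ∀ e f a b → (p ^ e ℕ.* a) ℕ.* (p ^ f ℕ.* b) ≡ p ^ (e ℕ.+ f) ℕ.* (a ℕ.* b)
  interchange e f a b = trans (ℕₚ.[m*n]*[o*p]≡[m*o]*[n*p] (p ^ e) a (p ^ f) b) (cong (ℕ._* (a ℕ.* b)) (sym (ℕₚ.^-distribˡ-+-* p e f)))

  bounded : ∀ {e} a b → e ≤ suc k → a ℕ.* b ≡ m → 1 ≤ b → p ^ e ℕ.* a ≤ N
  bounded {e} a b e≤ eq 1≤b = ℕₚ.≤-trans (ℕₚ.*-mono-≤ (ℕₚ.^-monoʳ-≤ p {{prime⇒nonZero pr}} e≤)
    (ℕₚ.≤-trans (ℕₚ.m≤m*n a b {{ℕ.>-nonZero 1≤b}}) (ℕₚ.≤-reflexive eq))) M≤N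

  -- A pair of factors of p^(k+1) m in which the first contains p exactly e times is a rescaled pair of factors of m.
  module Rescale (e f : ℕ) (e+f : e ℕ.+ f ≡ suc k) (P : Fin N × Fin N → Bool)
    (P-intro : ∀ (i j i′ : Fin N) → value i ≡ p ^ e ℕ.* value i′ → ¬ p ∣ value i′ → value i ℕ.* value j ≡ M → P (i , j) ≡ true)
    (P-elim : ∀ (i j : Fin N) → P (i , j) ≡ true → value i ℕ.* value j ≡ M × ∃ λ a → value i ≡ p ^ e ℕ.* a × ¬ p ∣ a)
    (g-e : ℤ) (g-scale : ∀ a → 1 ≤ a → ¬ p ∣ a → g (p ^ e ℕ.* a) ≡ g-e * g a) where

    to : ∀ x → P x ≡ true → ∃ λ y → Q y ≡ true × scaled e f x y ≡ true
    to (i , j) h with P-elim i j h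
    ... | ij≡M , a , i≡ , p∤a with coprime-cancel pr f p∤a (Dv.*-cancelˡ-∣ (p ^ e) {{^-nonZero pr e}} p^f∣)
      where
      p^f∣ : p ^ e ℕ.* p ^ f ∣ p ^ e ℕ.* (a ℕ.* value j)
      p^f∣ = subst₂ (λ x y → x ∣ y) (trans (cong (p ^_) (sym e+f)) (ℕₚ.^-distribˡ-+-* p e f))
        (trans (sym ij≡M) (trans (cong (ℕ._* value j) i≡) (ℕₚ.*-assoc (p ^ e) a (value j)))) (Dv.m∣m*n m)
    ...   | Dv.divides b j≡ = (i′ , j′) , dec-true (value i′ ℕ.* value j′ ℕ.≟ m) (trans (cong₂ ℕ._*_ i′≡ j′≡) ab≡m) ,
              scaled-intro e f i j i′ j′ (trans i≡ (cong (p ^ e ℕ.*_) (sym i′≡))) (trans j≡′ (cong (p ^ f ℕ.*_) (sym j′≡)))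
      where
      j≡′ : value j ≡ p ^ f ℕ.* b
      j≡′ = trans j≡ (ℕₚ.*-comm b (p ^ f))
      ab≡m : a ℕ.* b ≡ m
      ab≡m = ℕₚ.*-cancelˡ-≡ (a ℕ.* b) m (p ^ suc k) {{^-nonZero pr (suc k)}} (trans (cong (λ s → p ^ s ℕ.* (a ℕ.* b)) (sym e+f))
        (trans (sym (interchange e f a b)) (trans (cong₂ ℕ._*_ (sym i≡) (sym j≡′)) ij≡M)))
      1≤a : 1 ≤ a
      1≤a = ℕₚ.n≢0⇒n>0 (λ { refl → ℕₚ.<⇒≢ 1≤m ab≡m })
      1≤b : 1 ≤ b
      1≤b = ℕₚ.n≢0⇒n>0 (λ { refl → ℕₚ.<⇒≢ 1≤m (trans (sym (ℕₚ.*-zeroʳ a)) ab≡m) })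
      wa : ∃ λ (i : Fin N) → value i ≡ a
      wa = value-surjective 1≤a (subst (_≤ N) (ℕₚ.*-identityˡ a) (bounded {0} a b z≤n ab≡m 1≤b))
      wb : ∃ λ (j : Fin N) → value j ≡ b
      wb = value-surjective 1≤b (subst (_≤ N) (ℕₚ.*-identityˡ b) (bounded {0} b a z≤n (trans (ℕₚ.*-comm b a) ab≡m) 1≤a))
      i′ = proj₁ wa
      i′≡ = proj₂ wa
      j′ = proj₁ wb
      j′≡ = proj₂ wb

    from : ∀ y → Q y ≡ true → ∃ λ x → P x ≡ true × scaled e f x y ≡ true
    from (i′ , j′) h = (i , j) , P-intro i j i′ i≡ (Q-p∤ˡ i′ j′ eq)
        (trans (cong₂ ℕ._*_ i≡ j≡) (trans (interchange e f (value i′) (value j′)) (cong₂ (λ s n → p ^ s ℕ.* n) e+f eq))) ,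
        scaled-intro e f i j i′ j′ i≡ j≡
      where
      eq : value i′ ℕ.* value j′ ≡ m
      eq = does-true (value i′ ℕ.* value j′ ℕ.≟ m) h
      pos : ∀ s n → 1 ≤ n → 1 ≤ p ^ s ℕ.* n
      pos s n 1≤n = ℕₚ.*-mono-≤ (ℕ.>-nonZero⁻¹ (p ^ s) {{^-nonZero pr s}}) 1≤n
      wi : ∃ λ (i : Fin N) → value i ≡ p ^ e ℕ.* value i′
      wi = value-surjective (pos e (value i′) (s≤s z≤n)) (bounded (value i′) (value j′) (ℕₚ.≤-trans (ℕₚ.m≤m+n e f) (ℕₚ.≤-reflexive e+f)) eq (s≤s z≤n))
      wj : ∃ λ (j : Fin N) → value j ≡ p ^ f ℕ.* value j′
      wj = value-surjective (pos f (value j′) (s≤s z≤n)) (bounded (value j′) (value i′) (ℕₚ.≤-trans (ℕₚ.m≤n+m f e) (ℕₚ.≤-reflexive e+f))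
        (trans (ℕₚ.*-comm (value j′) (value i′)) eq) (s≤s z≤n))
      i = proj₁ wi
      i≡ = proj₂ wi
      j = proj₁ wj
      j≡ = proj₂ wj

    ∑-rescale : ∑ (square N) (λ x → ⟦ P x ⟧ * term x) ≡ g-e * η f * convolve N g h m
    ∑-rescale = begin
      ∑ (square N) (λ x → ⟦ P x ⟧ * term x)
        ≡⟨ ∑-reindex (square-enum N) (square-enum N) P term Q (λ y → g-e * η f * term y) (scaled e f) to from (scaled-uniqueʳ e f) (scaled-uniqueˡ e f)
             (λ { (i , j) (i′ , j′) _ Qy Rxy → compare i j i′ j′ (does-true (value i′ ℕ.* value j′ ℕ.≟ m) Qy) (scaled-true e f i j i′ j′ Rxy) }) ⟩
      ∑ (square N) (λ y → ⟦ Q y ⟧ * (g-e * η f * term y))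
        ≡⟨ trans (∑-cong (square N) (λ y → *-swapˡ ⟦ Q y ⟧ (g-e * η f) (term y))) (∑-*ˡ (square N) (g-e * η f) (λ y → ⟦ Q y ⟧ * term y)) ⟩
      g-e * η f * ∑ (square N) (λ y → ⟦ Q y ⟧ * term y)
        ≡⟨ cong (g-e * η f *_) (sym (convolve-square N g h m)) ⟩
      g-e * η f * convolve N g h m ∎
      where
      mix : ∀ a b c d → a * b * (c * d) ≡ a * c * (b * d)
      mix = solve-∀
      compare : ∀ (i j i′ j′ : Fin N) → value i′ ℕ.* value j′ ≡ m → value i ≡ p ^ e ℕ.* value i′ × value j ≡ p ^ f ℕ.* value j′ →
        term (i , j) ≡ g-e * η f * term (i′ , j′)
      compare i j i′ j′ eq (a , b) = trans (cong₂ _*_ (trans (cong g a) (g-scale (value i′) (s≤s z≤n) (Q-p∤ˡ i′ j′ eq)))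
        (trans (cong h b) (h-p f (value j′) (s≤s z≤n) (Q-p∤ʳ i′ j′ eq)))) (mix g-e (g (value i′)) (η f) (h (value j′)))

  ∑-A : ∑ (square N) (λ x → ⟦ A x ⟧ * term x) ≡ 1ℤ * η (suc k) * convolve N g h m
  ∑-A = Rescale.∑-rescale 0 (suc k) refl A
    (λ i j i′ i≡ p∤i′ eq → ∧-intro (dec-true (value i ℕ.* value j ℕ.≟ M) eq)
      (cong not (dec-false (p ∣? value i) (λ d → p∤i′ (subst (p ∣_) (trans i≡ (ℕₚ.*-identityˡ (value i′))) d)))))
    (λ i j h → does-true (value i ℕ.* value j ℕ.≟ M) (proj₁ (∧-true h)) , value i , sym (ℕₚ.*-identityˡ (value i)) ,
      not-false (p ∣? value i) (proj₂ (∧-true {is-product M (i , j)} h)))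
    1ℤ (λ a _ _ → trans (cong g (ℕₚ.*-identityˡ a)) (sym (ℤₚ.*-identityˡ (g a))))

  p¹ : p ^ 1 ≡ p
  p¹ = ℕₚ.*-identityʳ p

  ∑-B : ∑ (square N) (λ x → ⟦ B x ⟧ * term x) ≡ c * η k * convolve N g h m
  ∑-B = Rescale.∑-rescale 1 k refl B
    (λ i j i′ i≡ p∤i′ eq → ∧-intro (dec-true (value i ℕ.* value j ℕ.≟ M) eq) (∧-intro
      (dec-true (p ∣? value i) (Dv.divides (value i′) (trans i≡ (trans (cong (ℕ._* value i′) p¹) (ℕₚ.*-comm p (value i′))))))
      (cong not (dec-false (p ℕ.* p ∣? value i) (λ d → p∤i′ (Dv.*-cancelˡ-∣ p {{prime⇒nonZero pr}}
        (subst (p ℕ.* p ∣_) (trans i≡ (cong (ℕ._* value i′) p¹)) d)))))))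
    B-elim c (λ a 1≤a p∤a → trans (cong (λ q → g (q ℕ.* a)) p¹) (g-p a 1≤a p∤a))
    where
    B-elim : ∀ (i j : Fin N) → B (i , j) ≡ true → value i ℕ.* value j ≡ M × ∃ λ a → value i ≡ p ^ 1 ℕ.* a × ¬ p ∣ a
    B-elim i j h with does-true (p ∣? value i) (proj₁ (∧-true (proj₂ (∧-true {is-product M (i , j)} h))))
    ... | Dv.divides a eq = does-true (value i ℕ.* value j ℕ.≟ M) (proj₁ (∧-true h)) , a , trans eq (trans (ℕₚ.*-comm a p) (cong (ℕ._* a) (sym p¹))) ,
      λ p∣a → not-false (p ℕ.* p ∣? value i) (proj₂ (∧-true {divides-p (i , j)} (proj₂ (∧-true {is-product M (i , j)} h))))
        (subst (p ℕ.* p ∣_) (trans (ℕₚ.*-comm p a) (sym eq)) (Dv.*-monoʳ-∣ p p∣a))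

  convolve-^* : convolve N g h M ≡ (η (suc k) + c * η k) * convolve N g h m
  convolve-^* = begin
    convolve N g h M
      ≡⟨ trans (convolve-square N g h M) (trans (∑-cong (square N) three-cases) (∑-+ (square N) (λ x → ⟦ A x ⟧ * term x) (λ x → ⟦ B x ⟧ * term x))) ⟩
    ∑ (square N) (λ x → ⟦ A x ⟧ * term x) + ∑ (square N) (λ x → ⟦ B x ⟧ * term x)
      ≡⟨ cong₂ _+_ ∑-A ∑-B ⟩
    1ℤ * η (suc k) * convolve N g h m + c * η k * convolve N g h m
      ≡⟨ collect (η (suc k)) c (η k) (convolve N g h m) ⟩
    (η (suc k) + c * η k) * convolve N g h m ∎
    where
    collect : ∀ a b c d → 1ℤ * a * d + b * c * d ≡ (a + b * c) * d
    collect = solve-∀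

convolve-1 : ∀ N g h → 1 ≤ N → convolve N g h 1 ≡ g 1 * h 1
convolve-1 (suc N) g h _ = trans (convolve-square (suc N) g h 1) (∑-unique (square-enum (suc N)) (λ (i , j) → does (value i ℕ.* value j ℕ.≟ 1))
  (λ (i , j) → g (value i) * h (value j)) (zero , zero) refl
  (λ { (i , j) eq → cong₂ _,_ (value-injective (ℕₚ.m*n≡1⇒m≡1 (value i) (value j) (does-true (value i ℕ.* value j ℕ.≟ 1) eq)))
                              (value-injective (ℕₚ.m*n≡1⇒n≡1 (value i) (value j) (does-true (value i ℕ.* value j ℕ.≟ 1) eq))) }))

-- Identities between multiplicative functions

prime-divisor : ∀ u → 1 < u → ∃ λ p → Prime p × p ∣ u
prime-divisor u 1<u with factorise u {{ℕ.>-nonZero (ℕₚ.<-trans ℕₚ.0<1+n 1<u)}}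
... | record { factors = [] ; isFactorisation = eq } = ⊥-elim (ℕₚ.<⇒≢ 1<u (sym eq))
... | record { factors = p ∷ ps ; isFactorisation = eq ; factorsPrime = pr ∷ _ } = p , pr , subst (p ∣_) (sym eq) (Dv.m∣m*n (product ps))

-- Strips the full power of one prime divisor at a time. The bound by `N` is handed to the step
-- because the Euler factors of `convolve` require it.
multiplicative-induction : ∀ N (F G : ℕ → ℤ) → F 1 ≡ G 1 →
  (∀ {p} → Prime p → ∀ k m → 1 ≤ m → ¬ p ∣ m → p ^ suc k ℕ.* m ≤ N → F m ≡ G m → F (p ^ suc k ℕ.* m) ≡ G (p ^ suc k ℕ.* m)) →
  ∀ u → 1 ≤ u → u ≤ N → F u ≡ G u
multiplicative-induction N F G base step = <-rec (λ u → 1 ≤ u → u ≤ N → F u ≡ G u) go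
  where
  go : ∀ u → (∀ {v} → v < u → 1 ≤ v → v ≤ N → F v ≡ G v) → 1 ≤ u → u ≤ N → F u ≡ G u
  go (suc zero) rec _ _ = base
  go u@(suc (suc _)) rec 1≤u u≤N with prime-divisor u (s≤s (s≤s z≤n))
  ... | p , pr , p∣u with splitPrime pr u 1≤u
  ...   | split zero m u≡ m>0 p∤m = ⊥-elim (p∤m (subst (p ∣_) (trans u≡ (ℕₚ.*-identityˡ m)) p∣u))
  ...   | split (suc k) m u≡ m>0 p∤m = subst (λ w → F w ≡ G w) (sym u≡) (step pr k m m>0 p∤m (subst (_≤ N) u≡ u≤N)
            (rec m<u m>0 (ℕₚ.≤-trans (ℕₚ.<⇒≤ m<u) u≤N)))
    where
    m<u : m < u
    m<u = subst (m <_) (trans (ℕₚ.*-comm m (p ^ suc k)) (sym u≡)) (ℕₚ.m<m*n m (p ^ suc k) {{ℕ.>-nonZero m>0}}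
      (ℕₚ.≤-trans (s≤s (s≤s z≤n)) (n<p^n (prime>1 pr) (suc k))))

bFun-0 : ∀ u → 1 ≤ u → bFun 0 u ≡ ⟦ does (u ℕ.≟ 1) ⟧
bFun-0 u 1≤u = multiplicative-induction u (bFun 0) (λ u → ⟦ does (u ℕ.≟ 1) ⟧) refl step u 1≤u ℕₚ.≤-refl
  where
  step : ∀ {p} → Prime p → ∀ k m → 1 ≤ m → ¬ p ∣ m → p ^ suc k ℕ.* m ≤ u → bFun 0 m ≡ ⟦ does (m ℕ.≟ 1) ⟧ →
    bFun 0 (p ^ suc k ℕ.* m) ≡ ⟦ does (p ^ suc k ℕ.* m ℕ.≟ 1) ⟧
  step {p} pr k m 1≤m p∤m _ _ = trans (bFun-^* 0 pr (suc k) 1≤m p∤m) (trans (cong (_* bFun 0 m) (QPascal.localFactor-zero p (prime>1 pr) k))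
    (sym (cong ⟦_⟧ (dec-false (p ^ suc k ℕ.* m ℕ.≟ 1) (λ eq → ℕₚ.<⇒≢ (ℕₚ.≤-trans (s≤s (s≤s z≤n)) (n<p^n (prime>1 pr) (suc k))) (sym (ℕₚ.m*n≡1⇒m≡1 (p ^ suc k) m eq)))))))

-- bFun 1 is the classical Möbius function.
bFun-one-p : ∀ {p} → Prime p → ∀ m → 1 ≤ m → ¬ p ∣ m → bFun 1 (p ℕ.* m) ≡ - 1ℤ * bFun 1 m
bFun-one-p {p} pr m 1≤m p∤m = trans (cong (λ q → bFun 1 (q ℕ.* m)) (sym (ℕₚ.*-identityʳ p))) (trans (bFun-^* 1 pr 1 1≤m p∤m)
  (cong (_* bFun 1 m) (trans (QPascal.localFactor-suc p (prime>1 pr) 0 0) (cong (_+ - 1ℤ) (QPascal.localFactor-zero p (prime>1 pr) 0)))))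

bFun-one-p² : ∀ {p} → Prime p → ∀ m → 1 ≤ m → p ℕ.* p ∣ m → bFun 1 m ≡ 0ℤ
bFun-one-p² {p} pr m 1≤m d with splitPrime pr m 1≤m
... | split zero c m≡ c>0 p∤c = ⊥-elim (p∤c (subst (p ∣_) (trans m≡ (ℕₚ.*-identityˡ c)) (Dv.∣-trans (Dv.m∣m*n p) d)))
... | split (suc zero) c m≡ c>0 p∤c = ⊥-elim (p∤c (Dv.*-cancelˡ-∣ p {{prime⇒nonZero pr}} (subst (p ℕ.* p ∣_) (trans m≡ (cong (ℕ._* c) (ℕₚ.*-identityʳ p))) d)))
... | split (suc (suc k)) c m≡ c>0 p∤c = trans (cong (bFun 1) m≡) (trans (bFun-^* 1 pr (suc (suc k)) c>0 p∤c) (cong (_* bFun 1 c)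
        (trans (QPascal.localFactor-suc p (prime>1 pr) 0 (suc k)) (cong₂ (λ a b → a + - 1ℤ * b) (QPascal.localFactor-zero p (prime>1 pr) (suc k)) (QPascal.localFactor-zero p (prime>1 pr) k)))))

-- All Euler coefficients of the constant function are 1, so every prime dividing `u` contributes
-- the factor 1 - 1.
convolve-one : ∀ N u → 1 ≤ u → u ≤ N → convolve N (bFun 1) (λ _ → 1ℤ) u ≡ ⟦ does (u ℕ.≟ 1) ⟧
convolve-one N u 1≤u u≤N = multiplicative-induction N (convolve N (bFun 1) (λ _ → 1ℤ)) (λ u → ⟦ does (u ℕ.≟ 1) ⟧)
  (convolve-1 N (bFun 1) (λ _ → 1ℤ) (ℕₚ.≤-trans 1≤u u≤N))
  (λ {p} pr k m 1≤m p∤m le _ → trans (EulerFactor.convolve-^* pr N (bFun 1) (λ _ → 1ℤ) (- 1ℤ) (λ _ → 1ℤ) (bFun-one-p pr) (bFun-one-p² pr) (λ _ _ _ _ → refl) k m 1≤m p∤m le)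
    (sym (cong ⟦_⟧ (dec-false (p ^ suc k ℕ.* m ℕ.≟ 1) (λ eq → ℕₚ.<⇒≢ (ℕₚ.≤-trans (s≤s (s≤s z≤n)) (n<p^n (prime>1 pr) (suc k))) (sym (ℕₚ.m*n≡1⇒m≡1 (p ^ suc k) m eq))))))) u 1≤u u≤N

*-^ : ∀ r a b → (a ℕ.* b) ^ r ≡ a ^ r ℕ.* b ^ r
*-^ zero a b = refl
*-^ (suc r) a b = trans (cong (a ℕ.* b ℕ.*_) (*-^ r a b)) (ℕₚ.[m*n]*[o*p]≡[m*o]*[n*p] a b (a ^ r) (b ^ r))

-- The weight of one layer of a test set: μ(m) for the cycle length, times the m^r choices of `φ`.
-- It is the Dirichlet inverse of m ↦ m^r.
twisted : ℕ → ℕ → ℤ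
twisted r m = bFun 1 m * + (m ^ r)

-- At each prime the Euler factor of `twisted r` is 1 - p^r x, the very factor by which
-- `localFactor-suc` passes from `r` to `r + 1`.
bFun-suc : ∀ r N u → 1 ≤ u → u ≤ N → bFun (suc r) u ≡ convolve N (twisted r) (bFun r) u
bFun-suc r N u 1≤u u≤N = multiplicative-induction N (bFun (suc r)) (convolve N (twisted r) (bFun r))
  (sym (trans (convolve-1 N (twisted r) (bFun r) (ℕₚ.≤-trans 1≤u u≤N)) (cong (λ z → 1ℤ * + z * 1ℤ) (ℕₚ.^-zeroˡ r)))) step u 1≤u u≤N
  where
  step : ∀ {p} → Prime p → ∀ k m → 1 ≤ m → ¬ p ∣ m → p ^ suc k ℕ.* m ≤ N → bFun (suc r) m ≡ convolve N (twisted r) (bFun r) m →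
    bFun (suc r) (p ^ suc k ℕ.* m) ≡ convolve N (twisted r) (bFun r) (p ^ suc k ℕ.* m)
  step {p} pr k m 1≤m p∤m le ih = begin
    bFun (suc r) (p ^ suc k ℕ.* m)
      ≡⟨ bFun-^* (suc r) pr (suc k) 1≤m p∤m ⟩
    localFactor (suc r) p (suc k) * bFun (suc r) m
      ≡⟨ cong₂ _*_ (QPascal.localFactor-suc p (prime>1 pr) r k) ih ⟩
    (localFactor r p (suc k) + - + (p ^ r) * localFactor r p k) * convolve N (twisted r) (bFun r) m
      ≡⟨ sym (EulerFactor.convolve-^* pr N (twisted r) (bFun r) (- + (p ^ r)) (localFactor r p) twisted-p twisted-p² (λ k m → bFun-^* r pr k {m}) k m 1≤m p∤m le) ⟩
    convolve N (twisted r) (bFun r) (p ^ suc k ℕ.* m) ∎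
    where
    rearrange : ∀ a b c → - 1ℤ * a * (b * c) ≡ - b * (a * c)
    rearrange = solve-∀
    twisted-p : ∀ m → 1 ≤ m → ¬ p ∣ m → twisted r (p ℕ.* m) ≡ - + (p ^ r) * twisted r m
    twisted-p m 1≤m p∤m = trans (cong₂ _*_ (bFun-one-p pr m 1≤m p∤m) (trans (cong +_ (*-^ r p m)) (ℤₚ.pos-* (p ^ r) (m ^ r))))
      (rearrange (bFun 1 m) (+ (p ^ r)) (+ (m ^ r)))
    twisted-p² : ∀ m → 1 ≤ m → p ℕ.* p ∣ m → twisted r m ≡ 0ℤ
    twisted-p² m 1≤m d = cong (_* + (m ^ r)) (bFun-one-p² pr m 1≤m d)

-- The total Euler characteristic

mod²-refl : ∀ {t a b} → a ≡ b → a ≡ b mod² t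
mod²-refl {t} {a} {b} eq = congruent 0ℤ (trans eq (lem b (+ t)))
  where
  lem : ∀ b t → b ≡ b + t * t * 0ℤ
  lem = solve-∀

mod²-+ : ∀ {t a b c d} → a ≡ b mod² t → c ≡ d mod² t → a + c ≡ b + d mod² t
mod²-+ {t} {a} {b} {c} {d} (congruent q eq) (congruent q′ eq′) = congruent (q + q′) (trans (cong₂ _+_ eq eq′) (lem b d (+ t) q q′))
  where
  lem : ∀ b d t q q′ → b + t * t * q + (d + t * t * q′) ≡ b + d + t * t * (q + q′)
  lem = solve-∀

mod²-*ˡ : ∀ {t a b} c → a ≡ b mod² t → c * a ≡ c * b mod² t
mod²-*ˡ {t} {a} {b} c (congruent q eq) = congruent (c * q) (trans (cong (c *_) eq) (lem c b (+ t) q))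
  where
  lem : ∀ c b t q → c * (b + t * t * q) ≡ c * b + t * t * (c * q)
  lem = solve-∀

mod²-⟦⟧ : ∀ {t a b} p → (p ≡ true → a ≡ b mod² t) → ⟦ p ⟧ * a ≡ ⟦ p ⟧ * b mod² t
mod²-⟦⟧ true h = mod²-*ˡ 1ℤ (h refl)
mod²-⟦⟧ false h = mod²-refl refl

mod²-∑ : ∀ {A : Set} {t} (xs : List A) {f g : A → ℤ} → (∀ x → f x ≡ g x mod² t) → ∑ xs f ≡ ∑ xs g mod² t
mod²-∑ [] h = mod²-refl refl
mod²-∑ (x ∷ xs) h = mod²-+ (h x) (mod²-∑ xs h)

mod²-substˡ : ∀ {t a a′ b} → a ≡ a′ → a′ ≡ b mod² t → a ≡ b mod² t
mod²-substˡ refl h = h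

mod²-substʳ : ∀ {t a b b′} → a ≡ b mod² t → b ≡ b′ → a ≡ b′ mod² t
mod²-substʳ h refl = h

mod²-trans-sym : ∀ {t a b c} → a ≡ b mod² t → a ≡ c mod² t → b ≡ c mod² t
mod²-trans-sym {t} {a} {b} {c} (congruent q eq) (congruent q′ eq′) = congruent (q′ - q) (begin
  b                                   ≡⟨ add-sub b (+ t * + t * q) ⟩
  b + + t * + t * q - + t * + t * q   ≡⟨ cong (_- + t * + t * q) (trans (sym eq) eq′) ⟩
  c + + t * + t * q′ - + t * + t * q  ≡⟨ collect c (+ t) q q′ ⟩
  c + + t * + t * (q′ - q) ∎)
  where
  add-sub : ∀ b z → b ≡ b + z - z
  add-sub = solve-∀
  collect : ∀ c t q q′ → c + t * t * q′ - t * t * q ≡ c + t * t * (q′ - q)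
  collect = solve-∀

-- One modulus suffices: after cancelling a factor `suc t`, the number `suc t` divides a - b, and
-- `t` is chosen as the absolute value of a - b, too small a multiple unless it is zero.
mod²-equal : ∀ a b → (∀ t → + suc t * a ≡ + suc t * b mod² suc t) → a ≡ b
mod²-equal a b h = ℤₚ.i-j≡0⇒i≡j a b (ℤₚ.∣i∣≡0⇒i≡0 (zero-if-small ℤ.∣ a - b ∣ t (ℕₚ.n<1+n t) divides))
  where
  t = ℤ.∣ a - b ∣
  q = _≡_mod²_.quotient (h t)
  factored : + suc t * (a - b) ≡ + suc t * (+ suc t * q)
  factored = trans (distribute (+ suc t) a b) (trans (cong (_- + suc t * b) (_≡_mod²_.equation (h t))) (collect (+ suc t) b q))
    where
    distribute : ∀ t a b → t * (a - b) ≡ t * a - t * b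
    distribute = solve-∀
    collect : ∀ t b q → t * b + t * t * q - t * b ≡ t * (t * q)
    collect = solve-∀
  divides : suc t ∣ ℤ.∣ a - b ∣
  divides = Dv.divides ℤ.∣ q ∣ (trans (cong ℤ.∣_∣ (ℤₚ.*-cancelˡ-≡ (+ suc t) (a - b) (+ suc t * q) factored))
    (trans (ℤₚ.abs-* (+ suc t) q) (ℕₚ.*-comm (suc t) ℤ.∣ q ∣)))
  zero-if-small : ∀ m t → m < suc t → suc t ∣ m → m ≡ 0
  zero-if-small zero t _ _ = refl
  zero-if-small (suc m) t lt d = ⊥-elim (ℕₚ.<⇒≱ lt (Dv.∣⇒≤ d))

∑-divisors : ∀ N a u → 1 ≤ u → u ≤ N → ∑ (upTo N) (λ b → ⟦ does (suc a ℕ.* suc b ℕ.≟ u) ⟧) ≡ ⟦ does (suc a ∣? u) ⟧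
∑-divisors N a u 1≤u u≤N = trans (∑-upTo-allFin N (λ b → ⟦ does (suc a ℕ.* suc b ℕ.≟ u) ⟧)) (cases (suc a ∣? u))
  where
  cases : (d : Dec (suc a ∣ u)) → ∑ (allFin N) (λ j → ⟦ does (suc a ℕ.* value j ℕ.≟ u) ⟧) ≡ ⟦ does d ⟧
  cases (no a∤u) = ∑-zero (allFin N) (λ j → cong ⟦_⟧ (dec-false (suc a ℕ.* value j ℕ.≟ u) (λ eq → a∤u (Dv.divides (value j) (trans (sym eq) (ℕₚ.*-comm (suc a) (value j)))))))
  cases (yes (Dv.divides q u≡)) = ∑-unique₁ (allFin-enum N) (λ j → does (suc a ℕ.* value j ℕ.≟ u)) j (dec-true (suc a ℕ.* value j ℕ.≟ u) eq)
      (λ j′ h → value-injective (ℕₚ.*-cancelˡ-≡ (value j′) (value j) (suc a) (trans (does-true (suc a ℕ.* value j′ ℕ.≟ u) h) (sym eq))))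
    where
    1≤q : 1 ≤ q
    1≤q = ℕₚ.n≢0⇒n>0 (λ { refl → ℕₚ.<⇒≢ 1≤u (sym u≡) })
    witness : ∃ λ (j : Fin N) → value j ≡ q
    witness = value-surjective 1≤q (ℕₚ.≤-trans (ℕₚ.≤-trans (ℕₚ.m≤m*n q (suc a)) (ℕₚ.≤-reflexive (sym u≡))) u≤N)
    j = proj₁ witness
    eq : suc a ℕ.* value j ≡ u
    eq = trans (cong (suc a ℕ.*_) (proj₂ witness)) (trans (ℕₚ.*-comm (suc a) q) (sym u≡))

möbius-inversion : ∀ N u → 1 ≤ u → u ≤ N → ∑ (upTo N) (λ e → bFun 1 (suc e) * ⟦ does (suc e ∣? u) ⟧) ≡ ⟦ does (u ℕ.≟ 1) ⟧
möbius-inversion N u 1≤u u≤N = trans (∑-cong (upTo N) (λ e → trans (cong (bFun 1 (suc e) *_) (sym (∑-divisors N e u 1≤u u≤N)))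
    (trans (sym (∑-*ˡ (upTo N) (bFun 1 (suc e)) (λ b → ⟦ does (suc e ℕ.* suc b ℕ.≟ u) ⟧)))
      (∑-cong (upTo N) (λ b → rearrange (bFun 1 (suc e)) ⟦ does (suc e ℕ.* suc b ℕ.≟ u) ⟧)))))
  (convolve-one N u 1≤u u≤N)
  where
  rearrange : ∀ a b → a * b ≡ b * (a * 1ℤ)
  rearrange = solve-∀

∑-vecs-const : ∀ {A : Set} (xs : List A) k c → ∑ (vecs xs k) (λ _ → c) ≡ + (length xs ^ k) * c
∑-vecs-const xs zero c = trans (ℤₚ.+-identityʳ c) (sym (ℤₚ.*-identityˡ c))
∑-vecs-const xs (suc k) c = begin
  ∑ (vecs xs (suc k)) (λ _ → c)                    ≡⟨ ∑-vecs-suc xs k (λ _ → c) ⟩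
  ∑ xs (λ _ → ∑ (vecs xs k) (λ _ → c))             ≡⟨ ∑-cong xs (λ _ → ∑-vecs-const xs k c) ⟩
  ∑ xs (λ _ → + (length xs ^ k) * c)               ≡⟨ ∑-const xs (+ (length xs ^ k) * c) ⟩
  + length xs * (+ (length xs ^ k) * c)            ≡⟨ sym (ℤₚ.*-assoc (+ length xs) (+ (length xs ^ k)) c) ⟩
  + length xs * + (length xs ^ k) * c              ≡⟨ cong (_* c) (sym (ℤₚ.pos-* (length xs) (length xs ^ k))) ⟩
  + (length xs ^ suc k) * c ∎

-- For `c` beyond the range no index matches, and `vanish` supplies the value zero on the other
-- side.
∑-upTo-value : ∀ N (K : ℕ → ℤ) → (∀ m → N < m → K m ≡ 0ℤ) → ∀ c → 1 ≤ c → ∑ (upTo N) (λ k → ⟦ does (c ℕ.≟ suc k) ⟧ * K (suc k)) ≡ K c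
∑-upTo-value N K vanish c 1≤c = trans (∑-upTo-allFin N (λ k → ⟦ does (c ℕ.≟ suc k) ⟧ * K (suc k))) (cases (c ℕ.≤? N))
  where
  cases : Dec (c ≤ N) → ∑ (allFin N) (λ i → ⟦ does (c ℕ.≟ value i) ⟧ * K (value i)) ≡ K c
  cases (yes c≤N) = let (i , i≡) = value-surjective 1≤c c≤N in
    trans (∑-unique (allFin-enum N) (λ i → does (c ℕ.≟ value i)) (K ∘ value) i (dec-true (c ℕ.≟ value i) (sym i≡))
      (λ i′ h → value-injective (trans (sym (does-true (c ℕ.≟ value i′) h)) (sym i≡)))) (cong K i≡)
  cases (no c≰N) = trans (∑-zero (allFin N) (λ i → ⟦⟧-supported (K (value i)) (λ h → c≰N (subst (_≤ N) (sym (does-true (c ℕ.≟ value i) h)) (Finₚ.toℕ<n i)))))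
    (sym (vanish c (ℕₚ.≰⇒> c≰N)))

module Total (N t : ℕ) where

  open WeightedTests N (bFun 1) t public

  -- Adding a layer of length e multiplies the size by e and can be done in e^r ways, so the
  -- weighted number of test sets of a given size evolves by convolution with `twisted r`. The
  -- support condition on `K` makes the cutoff lossless.
  testSum-size : ∀ r (K : ℕ → ℤ) → (∀ m → N < m → K m ≡ 0ℤ) →
    testSum r (λ F → K (TestSet.size F)) ≡ ∑ (upTo N) (λ d → bFun r (suc d) * K (suc d))
  testSum-size zero K vanish = sym (trans (∑-cong (upTo N) (λ d → cong (_* K (suc d)) (trans (bFun-0 (suc d) (s≤s z≤n))
      (cong ⟦_⟧ (does-⇔ (suc d ℕ.≟ 1) (1 ℕ.≟ suc d) sym sym)))))
    (∑-upTo-value N K vanish 1 (s≤s z≤n)))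
  testSum-size (suc r) K vanish = begin
    ∑ (upTo N) (λ e → bFun 1 (suc e) * ∑ (vecs (allFin (suc e)) r) (λ _ → testSum r (λ F → K (TestSet.size F ℕ.* suc e))))
      ≡⟨ ∑-cong (upTo N) (λ e → trans (cong (bFun 1 (suc e) *_) (trans (∑-vecs-const (allFin (suc e)) r (testSum r (λ F → K (TestSet.size F ℕ.* suc e))))
           (cong₂ (λ l z → + (l ^ r) * z) (length-allFin (suc e)) (testSum-size r (λ m → K (m ℕ.* suc e))
             (λ m N<m → vanish (m ℕ.* suc e) (ℕₚ.<-≤-trans N<m (ℕₚ.m≤m*n m (suc e))))))))
           (sym (ℤₚ.*-assoc (bFun 1 (suc e)) (+ (suc e ^ r)) (∑ (upTo N) (λ d → bFun r (suc d) * K (suc d ℕ.* suc e)))))) ⟩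
    ∑ (upTo N) (λ e → twisted r (suc e) * ∑ (upTo N) (λ d → bFun r (suc d) * K (suc d ℕ.* suc e)))
      ≡⟨ ∑-cong (upTo N) (λ e → trans (sym (∑-*ˡ (upTo N) (twisted r (suc e)) (λ d → bFun r (suc d) * K (suc d ℕ.* suc e))))
           (∑-cong (upTo N) (λ d → trans (sym (ℤₚ.*-assoc (twisted r (suc e)) (bFun r (suc d)) (K (suc d ℕ.* suc e))))
             (cong (λ m → twisted r (suc e) * bFun r (suc d) * K m) (ℕₚ.*-comm (suc d) (suc e)))))) ⟩
    ∑ (upTo N) (λ e → ∑ (upTo N) (λ d → twisted r (suc e) * bFun r (suc d) * K (suc e ℕ.* suc d)))
      ≡⟨ ∑-cong (upTo N) (λ e → ∑-cong (upTo N) (λ d → trans (cong (twisted r (suc e) * bFun r (suc d) *_) (sym (∑-upTo-value N K vanish (suc e ℕ.* suc d) (s≤s z≤n))))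
           (trans (sym (∑-*ˡ (upTo N) (twisted r (suc e) * bFun r (suc d)) (λ k → ⟦ does (suc e ℕ.* suc d ℕ.≟ suc k) ⟧ * K (suc k))))
             (∑-cong (upTo N) (λ k → rearrange (twisted r (suc e) * bFun r (suc d)) ⟦ does (suc e ℕ.* suc d ℕ.≟ suc k) ⟧ (K (suc k))))))) ⟩
    ∑ (upTo N) (λ e → ∑ (upTo N) (λ d → ∑ (upTo N) (λ k → entry e d k * K (suc k))))
      ≡⟨ trans (∑-cong (upTo N) (λ e → ∑-swap (upTo N) (upTo N) (λ d k → entry e d k * K (suc k)))) (∑-swap (upTo N) (upTo N) (λ e k → ∑ (upTo N) (λ d → entry e d k * K (suc k)))) ⟩
    ∑ (upTo N) (λ k → ∑ (upTo N) (λ e → ∑ (upTo N) (λ d → entry e d k * K (suc k))))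
      ≡⟨ ∑-cong (upTo N) (λ k → trans (∑-cong (upTo N) (λ e → ∑-*ʳ (upTo N) (K (suc k)) (λ d → entry e d k))) (∑-*ʳ (upTo N) (K (suc k)) (λ e → ∑ (upTo N) (λ d → entry e d k)))) ⟩
    ∑ (upTo N) (λ k → convolve N (twisted r) (bFun r) (suc k) * K (suc k))
      ≡⟨ trans (∑-upTo-allFin N (λ k → convolve N (twisted r) (bFun r) (suc k) * K (suc k))) (trans (∑-cong (allFin N) (λ i → cong (_* K (value i)) (sym (bFun-suc r N (value i) (s≤s z≤n) (Finₚ.toℕ<n i))))) (sym (∑-upTo-allFin N (λ k → bFun (suc r) (suc k) * K (suc k))))) ⟩
    ∑ (upTo N) (λ d → bFun (suc r) (suc d) * K (suc d)) ∎
    where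
    entry : ℕ → ℕ → ℕ → ℤ
    entry e d k = ⟦ does (suc e ℕ.* suc d ℕ.≟ suc k) ⟧ * (twisted r (suc e) * bFun r (suc d))
    rearrange : ∀ a b c → a * (b * c) ≡ b * a * c
    rearrange = solve-∀

  mod²-testSum : ∀ r {G G′ : TestSet t r → ℤ} → (∀ F → G F ≡ G′ F mod² t) → testSum r G ≡ testSum r G′ mod² t
  mod²-testSum r {G} {G′} h = congruent (testSum r quotients) (trans (testSum-cong r (λ F → _≡_mod²_.equation (h F)))
    (trans (testSum-+ r G′ (λ F → + t * + t * quotients F)) (cong (_+_ (testSum r G′)) (testSum-*ˡ r (+ t * + t) quotients))))
    where
    quotients : TestSet t r → ℤ
    quotients F = _≡_mod²_.quotient (h F)

-- The linear term of binomial coefficients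

binomial : ℕ → ℕ → ℤ
binomial n k = + (n C k)

binomial-pascal : ∀ n k → binomial (suc n) (suc k) ≡ binomial n k + binomial n (suc k)
binomial-pascal n k = cong +_ (sym (Comb.nCk+nC[k+1]≡[n+1]C[k+1] n k))

binomial-0 : ∀ n → binomial n 0 ≡ 1ℤ
binomial-0 n = cong +_ (trans (Comb.nCk≡nC[n∸k] {0} {n} z≤n) (Comb.nCn≡1 n))

-- The absorption identity. With `suc n` as the number of copies, it exposes that number as a factor
-- of the count of component sets weighted by their size.
binomial-absorb : ∀ n k → + suc k * binomial (suc n) (suc k) ≡ + suc n * binomial n k
binomial-absorb zero zero = refl
binomial-absorb zero (suc k) = trans (cong (+ suc (suc k) *_) (binomial-pascal 0 (suc k))) (ℤₚ.*-zeroʳ (+ suc (suc k)))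
binomial-absorb (suc n) zero = begin
  1ℤ * binomial (suc (suc n)) 1
    ≡⟨ cong (1ℤ *_) (binomial-pascal (suc n) 0) ⟩
  1ℤ * (binomial (suc n) 0 + binomial (suc n) 1)
    ≡⟨ distribute (binomial (suc n) 0) (binomial (suc n) 1) ⟩
  binomial (suc n) 0 + 1ℤ * binomial (suc n) 1
    ≡⟨ cong (_+_ (binomial (suc n) 0)) (binomial-absorb n 0) ⟩
  binomial (suc n) 0 + + suc n * binomial n 0
    ≡⟨ cong₂ (λ a b → a + + suc n * b) (binomial-0 (suc n)) (trans (binomial-0 n) (sym (binomial-0 (suc n)))) ⟩
  1ℤ + + suc n * binomial (suc n) 0
    ≡⟨ cong (λ z → 1ℤ + + suc n * z) (binomial-0 (suc n)) ⟩
  1ℤ + + suc n * 1ℤ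
    ≡⟨ trans (cong (_+_ 1ℤ) (ℤₚ.*-identityʳ (+ suc n))) (sym (ℤₚ.*-identityʳ (+ suc (suc n)))) ⟩
  + suc (suc n) * 1ℤ
    ≡⟨ cong (+ suc (suc n) *_) (sym (binomial-0 (suc n))) ⟩
  + suc (suc n) * binomial (suc n) 0 ∎
  where
  distribute : ∀ a b → 1ℤ * (a + b) ≡ a + 1ℤ * b
  distribute = solve-∀
binomial-absorb (suc n) (suc k) = begin
  + suc (suc k) * binomial (suc (suc n)) (suc (suc k))
    ≡⟨ cong (+ suc (suc k) *_) (binomial-pascal (suc n) (suc k)) ⟩
  + suc (suc k) * (b₁ + b₂)
    ≡⟨ distribute (+ suc k) b₁ b₂ ⟩
  + suc k * b₁ + b₁ + + suc (suc k) * b₂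
    ≡⟨ cong₂ (λ x y → x + b₁ + y) (binomial-absorb n k) (binomial-absorb n (suc k)) ⟩
  + suc n * binomial n k + b₁ + + suc n * binomial n (suc k)
    ≡⟨ collect (+ suc n) (binomial n k) b₁ (binomial n (suc k)) ⟩
  + suc n * (binomial n k + binomial n (suc k)) + b₁
    ≡⟨ cong (λ z → + suc n * z + b₁) (sym (binomial-pascal n k)) ⟩
  + suc n * b₁ + b₁
    ≡⟨ one-more (+ suc n) b₁ ⟩
  + suc (suc n) * b₁ ∎
  where
  b₁ = binomial (suc n) (suc k)
  b₂ = binomial (suc n) (suc (suc k))
  distribute : ∀ a b c → (1ℤ + a) * (b + c) ≡ a * b + b + (1ℤ + a) * c
  distribute = solve-∀
  collect : ∀ a b c d → a * b + c + a * d ≡ a * (b + d) + c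
  collect = solve-∀
  one-more : ∀ a b → a * b + b ≡ (1ℤ + a) * b
  one-more = solve-∀

-- (t−1 choose k) ≡ (−1)ᵏ mod t as soon as the denominators 1,…,k are cleared.
binomial-mod : ∀ n t k → k ≤ n → ∃ λ q → + (n !) * binomial t k ≡ + (n !) * sign k + + suc t * q
binomial-mod n t zero _ = 0ℤ , trans (cong (+ (n !) *_) (binomial-0 t)) (lem (+ (n !)) (+ suc t))
  where
  lem : ∀ a t → a * 1ℤ ≡ a * 1ℤ + t * 0ℤ
  lem = solve-∀
binomial-mod n t (suc k) k<n with binomial-mod n t k (ℕₚ.<⇒≤ k<n) | Dv.∣-trans (Dv.m∣m*n (k !)) (Dv.m≤n⇒m!∣n! k<n)
... | q , ih | Dv.divides w n!≡ = + w * binomial t k - q , (begin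
  + (n !) * binomial t (suc k)
    ≡⟨ difference (+ (n !)) (binomial t k) (binomial t (suc k)) ⟩
  + (n !) * (binomial t k + binomial t (suc k)) - + (n !) * binomial t k
    ≡⟨ cong₂ _-_ (trans (cong₂ _*_ (trans (cong +_ n!≡) (ℤₚ.pos-* w (suc k))) (sym (binomial-pascal t k)))
         (trans (ℤₚ.*-assoc (+ w) (+ suc k) (binomial (suc t) (suc k))) (cong (+ w *_) (binomial-absorb t k)))) ih ⟩
  + w * (+ suc t * binomial t k) - (+ (n !) * sign k + + suc t * q)
    ≡⟨ collect (+ w) (+ suc t) (binomial t k) (+ (n !)) (sign k) q ⟩
  + (n !) * - sign k + + suc t * (+ w * binomial t k - q) ∎)
  where
  difference : ∀ a b c → a * c ≡ a * (b + c) - a * b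
  difference = solve-∀
  collect : ∀ w t b a s q → w * (t * b) - (a * s + t * q) ≡ a * - s + t * (w * b - q)
  collect = solve-∀

∑-card≡ : ∀ t m → ∑ (vecs bools t) (λ A → ⟦ does (card A ℕ.≟ m) ⟧) ≡ binomial t m
∑-card≡ zero zero = refl
∑-card≡ zero (suc m) = refl
∑-card≡ (suc t) zero = trans (∑-vecs-suc bools t (λ A → ⟦ does (card A ℕ.≟ 0) ⟧)) (trans (cong₂ (λ a b → a + (b + 0ℤ)) (∑-zero (vecs bools t) (λ A → refl)) (∑-card≡ t zero))
  (trans (trans (ℤₚ.+-identityˡ _) (ℤₚ.+-identityʳ (binomial t 0))) (trans (binomial-0 t) (sym (binomial-0 (suc t))))))
∑-card≡ (suc t) (suc m) = trans (∑-vecs-suc bools t (λ A → ⟦ does (card A ℕ.≟ suc m) ⟧)) (trans (cong₂ (λ a b → a + (b + 0ℤ))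
    (trans (∑-cong (vecs bools t) (λ A → cong ⟦_⟧ (does-⇔ (suc (card A) ℕ.≟ suc m) (card A ℕ.≟ m) ℕₚ.suc-injective (cong suc)))) (∑-card≡ t m)) (∑-card≡ t (suc m)))
  (trans (cong (_+_ (binomial t m)) (ℤₚ.+-identityʳ (binomial t (suc m)))) (sym (binomial-pascal t m))))

-- For positive `N` and `d` this is a(N/d) if `d` divides `N`, and 0 otherwise; the sum form avoids
-- a division.
alternating : ℕ → ℕ → ℤ
alternating N d = ∑ (allFin N) (λ i → ⟦ does (value i ℕ.* d ℕ.≟ N) ⟧ * sign (toℕ i))

alternating-vanish : ∀ N d → N < d → alternating N d ≡ 0ℤ
alternating-vanish N d N<d = ∑-zero (allFin N) (λ i → ⟦⟧-supported (sign (toℕ i)) (λ h →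
  ℕₚ.<⇒≢ (ℕₚ.<-≤-trans N<d (ℕₚ.m≤n*m d (value i))) (sym (does-true (value i ℕ.* d ℕ.≟ N) h))))

module Fillings (n t : ℕ) where

  N : ℕ
  N = suc n

  fillings : ℕ → ℤ
  fillings d = ∑ (vecs bools (suc t)) (λ A → ⟦ does (card A ℕ.* d ℕ.≟ N) ⟧ * (+ card A * + (n !)))

  -- Component sets are grouped by their size m; there are binomially many of each, and absorption
  -- turns the weight m into the factor `suc t`.
  fillings-binomial : ∀ d → fillings d ≡ ∑ (allFin N) (λ i → ⟦ does (value i ℕ.* d ℕ.≟ N) ⟧ * (+ suc t * (+ (n !) * binomial t (toℕ i))))
  fillings-binomial d = begin
    fillings d
      ≡⟨ ∑-cong As by-size ⟩
    ∑ As (λ A → ∑ (allFin N) (λ i → ⟦ does (card A ℕ.≟ value i) ⟧ * weight i))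
      ≡⟨ ∑-swap As (allFin N) (λ A i → ⟦ does (card A ℕ.≟ value i) ⟧ * weight i) ⟩
    ∑ (allFin N) (λ i → ∑ As (λ A → ⟦ does (card A ℕ.≟ value i) ⟧ * weight i))
      ≡⟨ ∑-cong (allFin N) (λ i → trans (∑-*ʳ As (weight i) (λ A → ⟦ does (card A ℕ.≟ value i) ⟧)) (cong (_* weight i) (∑-card≡ (suc t) (value i)))) ⟩
    ∑ (allFin N) (λ i → binomial (suc t) (value i) * weight i)
      ≡⟨ ∑-cong (allFin N) (λ i → trans (rearrange (binomial (suc t) (value i)) ⟦ does (value i ℕ.* d ℕ.≟ N) ⟧ (+ value i) (+ (n !)))
           (cong (⟦ does (value i ℕ.* d ℕ.≟ N) ⟧ *_) (trans (cong (+ (n !) *_) (binomial-absorb t (toℕ i))) (*-swapˡ (+ (n !)) (+ suc t) (binomial t (toℕ i)))))) ⟩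
    ∑ (allFin N) (λ i → ⟦ does (value i ℕ.* d ℕ.≟ N) ⟧ * (+ suc t * (+ (n !) * binomial t (toℕ i)))) ∎
    where
    As = vecs bools (suc t)
    weight : Fin N → ℤ
    weight i = ⟦ does (value i ℕ.* d ℕ.≟ N) ⟧ * (+ value i * + (n !))
    rearrange : ∀ a b c d → a * (b * (c * d)) ≡ b * (d * (c * a))
    rearrange = solve-∀
    by-size : ∀ A → ⟦ does (card A ℕ.* d ℕ.≟ N) ⟧ * (+ card A * + (n !)) ≡ ∑ (allFin N) (λ i → ⟦ does (card A ℕ.≟ value i) ⟧ * weight i)
    by-size A = cases (card A ℕ.* d ℕ.≟ N)
      where
      cases : Dec (card A ℕ.* d ≡ N) → ⟦ does (card A ℕ.* d ℕ.≟ N) ⟧ * (+ card A * + (n !)) ≡ ∑ (allFin N) (λ i → ⟦ does (card A ℕ.≟ value i) ⟧ * weight i)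
      cases (yes eq) = sym (trans (∑-unique (allFin-enum N) (λ i → does (card A ℕ.≟ value i)) weight i (dec-true (card A ℕ.≟ value i) (sym i≡))
          (λ i′ h → value-injective (trans (sym (does-true (card A ℕ.≟ value i′) h)) (sym i≡))))
          (cong (λ c → ⟦ does (c ℕ.* d ℕ.≟ N) ⟧ * (+ c * + (n !))) i≡))
        where
        1≤c : 1 ≤ card A
        1≤c = ℕₚ.n≢0⇒n>0 (λ z → 0≢N (trans (cong (ℕ._* d) (sym z)) eq))
          where
          0≢N : 0 ≢ N
          0≢N ()
        1≤d : 1 ≤ d
        1≤d = ℕₚ.n≢0⇒n>0 (λ z → 0≢N (trans (sym (ℕₚ.*-zeroʳ (card A))) (trans (cong (card A ℕ.*_) (sym z)) eq)))
          where
          0≢N : 0 ≢ N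
          0≢N ()
        witness : ∃ λ (i : Fin N) → value i ≡ card A
        witness = value-surjective 1≤c (ℕₚ.≤-trans (ℕₚ.m≤m*n (card A) d {{ℕ.>-nonZero 1≤d}}) (ℕₚ.≤-reflexive eq))
        i = proj₁ witness
        i≡ = proj₂ witness
      cases (no ¬eq) = trans (cong (λ b → ⟦ b ⟧ * (+ card A * + (n !))) (dec-false (card A ℕ.* d ℕ.≟ N) ¬eq))
        (sym (∑-zero (allFin N) (λ i → trans (⟦⟧-cong {does (card A ℕ.≟ value i)} (λ h → ⟦⟧-supported (+ value i * + (n !)) (λ h′ →
          ¬eq (trans (cong (ℕ._* d) (does-true (card A ℕ.≟ value i) h)) (does-true (value i ℕ.* d ℕ.≟ N) h′))))) (ℤₚ.*-zeroʳ ⟦ does (card A ℕ.≟ value i) ⟧))))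

  fillings-mod² : ∀ d → fillings d ≡ + suc t * (+ (n !) * alternating N d) mod² suc t
  fillings-mod² d = mod²-substˡ (fillings-binomial d) (mod²-substʳ (mod²-∑ (allFin N) (λ i → mod²-*ˡ ⟦ does (value i ℕ.* d ℕ.≟ N) ⟧ (pointwise i)))
    (trans (∑-cong (allFin N) (λ i → rearrange ⟦ does (value i ℕ.* d ℕ.≟ N) ⟧ (+ suc t) (+ (n !)) (sign (toℕ i))))
      (trans (∑-*ˡ (allFin N) (+ suc t * + (n !)) (λ i → ⟦ does (value i ℕ.* d ℕ.≟ N) ⟧ * sign (toℕ i))) (ℤₚ.*-assoc (+ suc t) (+ (n !)) (alternating N d)))))
    where
    rearrange : ∀ a b c d → a * (b * (c * d)) ≡ b * c * (a * d)
    rearrange = solve-∀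
    distribute : ∀ a b c → a * (b + a * c) ≡ a * b + a * a * c
    distribute = solve-∀
    pointwise : ∀ i → + suc t * (+ (n !) * binomial t (toℕ i)) ≡ + suc t * (+ (n !) * sign (toℕ i)) mod² suc t
    pointwise i = let (q , eq) = binomial-mod n t (toℕ i) (ℕₚ.≤-pred (Finₚ.toℕ<n i)) in
      congruent q (trans (cong (+ suc t *_) eq) (distribute (+ suc t) (+ (n !) * sign (toℕ i)) q))

-- Each row of an equivalence relation is a compatible two-valued function, so points identified by
-- all such functions are already related.
connected-equivalence : ∀ {n} (R : Rel n) → Equivalence R → connected (rel R) ≡ isIndiscrete R
connected-equivalence {n} R e = bool-ext
  (λ h → isIndiscrete-intro {R = R} (λ i j → related i j (connected-true {R = rel R} h i j)))
  (λ h → connected-intro {R = rel R} (λ i j → generates λ c comp → comp i j (isIndiscrete-true {R = R} h i j)))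
  where
  open Equivalence e
  row : Fin n → Vec Bool n
  row = lookup R
  row-compatible : ∀ i → Compatible (rel R) (row i)
  row-compatible i a b ab = bool-ext (λ ia → transitive i a b ia ab) (λ ib → transitive i b a ib (symmetric a b ab))
  related : ∀ i j → Generated (rel R) i j → rel R i j ≡ true
  related i j h = trans (sym (Generated.agree h (row i) (row-compatible i))) (reflexive i)

-- From equivariant maps to the top Möbius value

module Bridge {n r} (X : Vec (Perm (suc n)) r) (X-admissible : isAdmissible X ≡ true) (i₁ : Fin (suc n)) (0≢i₁ : zero ≢ i₁) where

  N : ℕ
  N = suc n

  X-inj : ∀ j → Injectiveᵖ (lookup X j)
  X-inj = proj₁ (isAdmissible-true {X = X} X-admissible)

  X-comm : ∀ j k → Commute (lookup X j) (lookup X k)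
  X-comm = proj₂ (isAdmissible-true {X = X} X-admissible)

  open FixedPartitions X X-inj zero i₁ 0≢i₁

  invariant-preserved : ∀ R → isInvariant R ≡ true → ∀ j → Preserves (app (lookup X j)) (rel R)
  invariant-preserved R h j a b ab = trans (fixedBy-true {σ = lookup X j} {R = R}
    (all-toList-true X (proj₂ (isInvariant-elim R h)) j) a b) ab

  module _ {t} (F : TestSet t r) where

    open TestSet F
    open EquivariantInjections F n using (fs; isEmbedding; injective?)

    module _ (f : Vec Z N) (eqv : Equivariant F X f) where

      same : Fin N → Fin N → Bool
      same i j = does (Enum._≟_ enum (lookup f i) (lookup f j))

      same-true : ∀ i j → same i j ≡ true → lookup f i ≡ lookup f j
      same-true i j = does-true (Enum._≟_ enum (lookup f i) (lookup f j))

      same-intro : ∀ i j → lookup f i ≡ lookup f j → same i j ≡ true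
      same-intro i j = dec-true (Enum._≟_ enum (lookup f i) (lookup f j))

      kernel : Rel N
      kernel = relFrom same

      kernel-true : ∀ i j → rel kernel i j ≡ true → lookup f i ≡ lookup f j
      kernel-true i j h = same-true i j (trans (sym (rel-relFrom same i j)) h)

      kernel-intro : ∀ i j → lookup f i ≡ lookup f j → rel kernel i j ≡ true
      kernel-intro i j eq = trans (rel-relFrom same i j) (same-intro i j eq)

      -- Invariance is an equality of relations: equivariance carries coincidences of values
      -- forward, and injectivity of the action on the test set carries them back.
      kernel-invariant : isInvariant kernel ≡ true
      kernel-invariant = ∧-intro
        (isEquivalence-intro {R = kernel} record
          { reflexive = λ i → kernel-intro i i refl
          ; symmetric = λ i j h → kernel-intro j i (sym (kernel-true i j h))
          ; transitive = λ i j k h h′ → kernel-intro i k (trans (kernel-true i j h) (kernel-true j k h′)) })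
        (all-toList-intro X (λ k → fixedBy-intro {σ = lookup X k} {R = kernel} (λ i j → bool-ext
          (λ h → kernel-intro i j (acts-injective k _ _ (trans (sym (eqv k i)) (trans (kernel-true _ _ h) (eqv k j)))))
          (λ h → kernel-intro _ _ (trans (eqv k i) (trans (cong (acts k) (kernel-true i j h)) (sym (eqv k j))))))))

      refines-kernel : ∀ R → refines R kernel ≡ does (compatible? (Enum._≟_ enum) (rel R) f)
      refines-kernel R = bool-ext
        (λ h → dec-true (compatible? (Enum._≟_ enum) (rel R) f) (λ i j Rij → kernel-true i j (refines-true {R = R} {kernel} h i j Rij)))
        (λ h → refines-intro {R = R} {kernel} (λ i j Rij → kernel-intro i j (does-true (compatible? (Enum._≟_ enum) (rel R) f) h i j Rij)))

      kernel-discrete : isDiscrete kernel ≡ does (injective? f)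
      kernel-discrete = bool-ext
        (λ h → dec-true (injective? f) (λ i j eq → ==F-true (trans (sym (isDiscrete-true {R = kernel} h i j)) (kernel-intro i j eq))))
        (λ h → isDiscrete-intro {R = kernel} (λ i j → bool-ext
          (λ k → subst (λ z → (i ==F z) ≡ true) (does-true (injective? f) h i j (kernel-true i j k)) (==F-refl i))
          (λ k → kernel-intro i j (cong (lookup f) (==F-true k)))))

      -- A map factors through the quotient by `R` when `R` refines its kernel, and its kernel is
      -- discrete when the map is injective; so this is `∑-below` at the kernel.
      ∑-compatible : ∑ (allRels N) (λ R → ⟦ isInvariant R ⟧ * (⟦ does (compatible? (Enum._≟_ enum) (rel R) f) ⟧ * μ R)) ≡ ⟦ does (injective? f) ⟧
      ∑-compatible = trans (∑-cong (allRels N) (λ R → cong (λ b → ⟦ isInvariant R ⟧ * (⟦ b ⟧ * μ R)) (sym (refines-kernel R))))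
        (trans (∑-below kernel kernel-invariant) (cong ⟦_⟧ kernel-discrete))

    ∑-maps : ∑ (allRels N) (λ R → ⟦ isInvariant R ⟧ * (μ R * #maps F X (rel R))) ≡ ∑ fs (λ f → ⟦ isEmbedding X f ⟧)
    ∑-maps = begin
      ∑ (allRels N) (λ R → ⟦ isInvariant R ⟧ * (μ R * #maps F X (rel R)))
        ≡⟨ ∑-cong (allRels N) (λ R → trans (sym (ℤₚ.*-assoc ⟦ isInvariant R ⟧ (μ R) (#maps F X (rel R))))
             (sym (∑-*ˡ fs (⟦ isInvariant R ⟧ * μ R) (λ f → ⟦ does (pointedMap? F X (rel R) f) ⟧)))) ⟩
      ∑ (allRels N) (λ R → ∑ fs (λ f → ⟦ isInvariant R ⟧ * μ R * ⟦ does (pointedMap? F X (rel R) f) ⟧))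
        ≡⟨ ∑-swap (allRels N) fs (λ R f → ⟦ isInvariant R ⟧ * μ R * ⟦ does (pointedMap? F X (rel R) f) ⟧) ⟩
      ∑ fs (λ f → ∑ (allRels N) (λ R → ⟦ isInvariant R ⟧ * μ R * ⟦ does (pointedMap? F X (rel R) f) ⟧))
        ≡⟨ ∑-cong fs collapse ⟩
      ∑ fs (λ f → ⟦ isEmbedding X f ⟧) ∎
      where
      rearrange : ∀ a b c d e → a * b * (c * (d * e)) ≡ c * d * (a * (e * b))
      rearrange = solve-∀
      module _ (f : Vec Z N) where
        eqv? base? : Bool
        eqv? = does (equivariant? F X f)
        base? = isBase (lookup f zero)
        comp? : Rel N → Bool
        comp? R = does (compatible? (Enum._≟_ enum) (rel R) f)
        base-does : does (isBase (lookup f zero) Bool.≟ true) ≡ base?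
        base-does = bool-ext (does-true (isBase (lookup f zero) Bool.≟ true)) (dec-true (isBase (lookup f zero) Bool.≟ true))
        indicator : ∀ R → ⟦ does (pointedMap? F X (rel R) f) ⟧ ≡ ⟦ eqv? ⟧ * (⟦ base? ⟧ * ⟦ comp? R ⟧)
        indicator R = trans (cong (λ b → ⟦ eqv? ∧ (b ∧ comp? R) ⟧) base-does)
          (trans (⟦∧⟧ eqv? (base? ∧ comp? R)) (cong (⟦ eqv? ⟧ *_) (⟦∧⟧ base? (comp? R))))
        combine : ∀ a b c → ⟦ a ⟧ * ⟦ b ⟧ * ⟦ c ⟧ ≡ ⟦ b ∧ (c ∧ a) ⟧
        combine true true true = refl
        combine true true false = refl
        combine true false c = refl
        combine false true true = refl
        combine false true false = refl
        combine false false c = refl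
        collapse : ∑ (allRels N) (λ R → ⟦ isInvariant R ⟧ * μ R * ⟦ does (pointedMap? F X (rel R) f) ⟧) ≡ ⟦ isEmbedding X f ⟧
        collapse = begin
          ∑ (allRels N) (λ R → ⟦ isInvariant R ⟧ * μ R * ⟦ does (pointedMap? F X (rel R) f) ⟧)
            ≡⟨ ∑-cong (allRels N) (λ R → trans (cong (⟦ isInvariant R ⟧ * μ R *_) (indicator R)) (rearrange ⟦ isInvariant R ⟧ (μ R) ⟦ eqv? ⟧ ⟦ base? ⟧ ⟦ comp? R ⟧)) ⟩
          ∑ (allRels N) (λ R → ⟦ eqv? ⟧ * ⟦ base? ⟧ * (⟦ isInvariant R ⟧ * (⟦ comp? R ⟧ * μ R)))
            ≡⟨ ∑-*ˡ (allRels N) (⟦ eqv? ⟧ * ⟦ base? ⟧) (λ R → ⟦ isInvariant R ⟧ * (⟦ comp? R ⟧ * μ R)) ⟩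
          ⟦ eqv? ⟧ * ⟦ base? ⟧ * total
            ≡⟨ trans (ℤₚ.*-assoc ⟦ eqv? ⟧ ⟦ base? ⟧ total) (⟦⟧-cong {eqv?} (λ h → cong (⟦ base? ⟧ *_) (∑-compatible f (does-true (equivariant? F X f) h)))) ⟩
          ⟦ eqv? ⟧ * (⟦ base? ⟧ * ⟦ does (injective? f) ⟧)
            ≡⟨ trans (sym (ℤₚ.*-assoc ⟦ eqv? ⟧ ⟦ base? ⟧ ⟦ does (injective? f) ⟧)) (combine eqv? base? (does (injective? f))) ⟩
          ⟦ isEmbedding X f ⟧ ∎
          where
          total : ℤ
          total = ∑ (allRels N) (λ R → ⟦ isInvariant R ⟧ * (⟦ comp? R ⟧ * μ R))

  module _ (t : ℕ) where

    open Total N (suc t)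
    open Detection n (bFun 1) (möbius-inversion N) t using (testSum-#maps)

    -- Detection applied to every invariant `R` leaves the connected ones, and a connected
    -- equivalence relation is the indiscrete one, where `μ` is the reduced Euler characteristic.
    testSum-embeddings : testSum r (λ F → ∑ (EquivariantInjections.fs F n) (λ f → ⟦ EquivariantInjections.isEmbedding F n X f ⟧)) ≡
      + suc t * redEuler (fixedPoints X) strictlyRefines mod² suc t
    testSum-embeddings = mod²-substˡ
      (trans (testSum-cong r (λ F → sym (∑-maps F))) (trans (testSum-∑ r (allRels N) (λ R F → ⟦ isInvariant R ⟧ * (μ R * #maps F X (rel R))))
        (∑-cong (allRels N) (λ R → trans (testSum-*ˡ r ⟦ isInvariant R ⟧ (λ F → μ R * #maps F X (rel R)))
          (cong (⟦ isInvariant R ⟧ *_) (testSum-*ˡ r (μ R) (λ F → #maps F X (rel R))))))))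
      (mod²-substʳ (mod²-∑ (allRels N) (λ R → mod²-⟦⟧ (isInvariant R) (λ h → mod²-*ˡ (μ R)
          (testSum-#maps r X (rel R) X-inj X-comm (invariant-preserved R h)))))
        (trans (∑-cong (allRels N) (λ R → trans (⟦⟧-cong {isInvariant R} (λ h → cong (λ b → μ R * (+ suc t * ⟦ b ⟧)) (connected-equivalence R (proj₁ (isInvariant-elim R h)))))
            (rearrange ⟦ isInvariant R ⟧ (μ R) (+ suc t) ⟦ isIndiscrete R ⟧)))
          (trans (∑-*ˡ (allRels N) (+ suc t) (λ R → ⟦ isInvariant R ⟧ * (⟦ isIndiscrete R ⟧ * μ R))) (cong (+ suc t *_) ∑-top))))
      where
      rearrange : ∀ a b c d → a * (b * (c * d)) ≡ c * (a * (d * b))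
      rearrange = solve-∀

-- Comparing the two evaluations of the weighted count

totalEuler : ℕ → ℕ → ℤ
totalEuler n r = ∑ (tuples n r) (λ X → ⟦ isAdmissible X ⟧ * redEuler (fixedPoints X) strictlyRefines)

module _ (n r : ℕ) (i₁ : Fin (suc n)) (0≢i₁ : zero ≢ i₁) where

  private
    N : ℕ
    N = suc n

    open Fillings n using (fillings-mod²)

    divisorSum : ℤ
    divisorSum = ∑ (upTo N) (λ d → bFun r (suc d) * alternating N (suc d))

    module _ (t : ℕ) where

      open Total N (suc t)

      embeddings : ℤ
      embeddings = testSum r (λ F → ∑ (tuples N r) (λ X → ⟦ isAdmissible X ⟧ *
        ∑ (EquivariantInjections.fs F n) (λ f → ⟦ EquivariantInjections.isEmbedding F n X f ⟧)))

      embeddings-euler : embeddings ≡ + suc t * totalEuler N r mod² suc t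
      embeddings-euler = mod²-substˡ
        (trans (testSum-∑ r (tuples N r) (λ X F → ⟦ isAdmissible X ⟧ * inner X F))
          (∑-cong (tuples N r) (λ X → testSum-*ˡ r ⟦ isAdmissible X ⟧ (inner X))))
        (mod²-substʳ (mod²-∑ (tuples N r) (λ X → mod²-⟦⟧ (isAdmissible X) (λ h → Bridge.testSum-embeddings X h i₁ 0≢i₁ t)))
          (trans (∑-cong (tuples N r) (λ X → *-swapˡ ⟦ isAdmissible X ⟧ (+ suc t) (redEuler (fixedPoints X) strictlyRefines)))
            (∑-*ˡ (tuples N r) (+ suc t) (λ X → ⟦ isAdmissible X ⟧ * redEuler (fixedPoints X) strictlyRefines))))
        where
        inner : Vec (Perm N) r → TestSet (suc t) r → ℤ
        inner X F = ∑ (EquivariantInjections.fs F n) (λ f → ⟦ EquivariantInjections.isEmbedding F n X f ⟧)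

      embeddings-divisors : embeddings ≡ + suc t * (+ (n !) * divisorSum) mod² suc t
      embeddings-divisors = mod²-substˡ (testSum-cong r (λ F → EquivariantInjections.∑-embeddings F n))
        (mod²-substʳ (mod²-testSum r (λ F → fillings-mod² t (TestSet.size F)))
          (trans (testSum-*ˡ r (+ suc t) (λ F → + (n !) * alternating N (TestSet.size F)))
            (cong (+ suc t *_) (trans (testSum-*ˡ r (+ (n !)) (λ F → alternating N (TestSet.size F)))
              (cong (+ (n !) *_) (testSum-size r (alternating N) (alternating-vanish N)))))))

  totalEuler-divisors : totalEuler N r ≡ + (n !) * divisorSum
  totalEuler-divisors = mod²-equal (totalEuler N r) (+ (n !) * divisorSum) (λ t → mod²-trans-sym (embeddings-euler t) (embeddings-divisors t))

  divisorSum-convAB : divisorSum ≡ convAB r N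
  divisorSum-convAB = begin
    ∑ (upTo N) (λ d → bFun r (suc d) * alternating N (suc d))
      ≡⟨ ∑-cong (upTo N) (λ d → trans (cong (bFun r (suc d) *_) (sym (∑-upTo-allFin N (λ m → ⟦ does (suc m ℕ.* suc d ℕ.≟ N) ⟧ * sign m))))
           (sym (∑-*ˡ (upTo N) (bFun r (suc d)) (λ m → ⟦ does (suc m ℕ.* suc d ℕ.≟ N) ⟧ * sign m)))) ⟩
    ∑ (upTo N) (λ d → ∑ (upTo N) (λ m → bFun r (suc d) * (⟦ does (suc m ℕ.* suc d ℕ.≟ N) ⟧ * sign m)))
      ≡⟨ ∑-swap (upTo N) (upTo N) (λ d m → bFun r (suc d) * (⟦ does (suc m ℕ.* suc d ℕ.≟ N) ⟧ * sign m)) ⟩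
    ∑ (upTo N) (λ m → ∑ (upTo N) (λ d → bFun r (suc d) * (⟦ does (suc m ℕ.* suc d ℕ.≟ N) ⟧ * sign m)))
      ≡⟨ ∑-cong (upTo N) (λ m → ∑-cong (upTo N) (λ d → entry≡ m d)) ⟩
    ∑ (upTo N) (λ m → ∑ (upTo N) (λ d → entry (suc m) (suc d)))
      ≡⟨ sym (trans (∑-range1 N (λ a → ∑ (range1 N) (entry a))) (∑-cong (upTo N) (λ m → ∑-range1 N (entry (suc m))))) ⟩
    ∑ (range1 N) (λ a → ∑ (range1 N) (entry a))
      ≡⟨ ∑-cong (range1 N) (λ a → sym (∑-map (entry a) (range1 N) id)) ⟩
    ∑ (range1 N) (λ a → ∑ (map (entry a) (range1 N)) id)
      ≡⟨ sym (∑-concatMap (λ a → map (entry a) (range1 N)) (range1 N) id) ⟩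
    ∑ (concatMap (λ a → map (entry a) (range1 N)) (range1 N)) id
      ≡⟨ sym (trans (cong sumℤ (sym (Listₚ.map-id (concatMap (λ a → map (entry a) (range1 N)) (range1 N))))) (sumℤ-map id (concatMap (λ a → map (entry a) (range1 N)) (range1 N)))) ⟩
    convAB r N ∎
    where
    entry : ℕ → ℕ → ℤ
    entry a b = if ⌊ a ℕ.* b ℕ.≟ N ⌋ then aFun a * bFun r b else + 0
    entry≡ : ∀ m d → bFun r (suc d) * (⟦ does (suc m ℕ.* suc d ℕ.≟ N) ⟧ * sign m) ≡ entry (suc m) (suc d)
    entry≡ m d = cases (suc m ℕ.* suc d ℕ.≟ N)
      where
      -- By its offset `aFun (suc m)` unfolds to `sign m` negated twice.
      found : ∀ s b → b * (1ℤ * s) ≡ - - s * b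
      found = solve-∀
      cases : (e : Dec (suc m ℕ.* suc d ≡ N)) → bFun r (suc d) * (⟦ does e ⟧ * sign m) ≡ (if ⌊ e ⌋ then aFun (suc m) * bFun r (suc d) else + 0)
      cases (yes _) = found (sign m) (bFun r (suc d))
      cases (no _) = ℤₚ.*-zeroʳ (bFun r (suc d))

divℚ-cong : ∀ z w a b → a ≢ 0 → b ≢ 0 → z * + b ≡ w * + a → divℚ z a ≡ divℚ w b
divℚ-cong z w zero b a≢0 _ _ = ⊥-elim (a≢0 refl)
divℚ-cong z w (suc a) zero _ b≢0 _ = ⊥-elim (b≢0 refl)
divℚ-cong z w (suc a) (suc b) _ _ eq = ℚₚ.fromℚᵘ-cong {ℚᵘ.mkℚᵘ z a} {ℚᵘ.mkℚᵘ w b} (ℚᵘ.*≡* eq)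

theorem1p1 : (n r : ℕ) → 2 ≤ n → 1 ≤ r →
    equivEulerPartitions r n ≡ divℚ (convAB r n) n
theorem1p1 (suc (suc n)) r (s≤s (s≤s z≤n)) _ =
  divℚ-cong total (convAB r N) (length (perms N)) N perms≢0 (λ ()) (begin
    total * + N
      ≡⟨ cong (_* + N) (trans (sumℤ-map _ (commutingTuples N r)) (∑-commutingTuples N r _)) ⟩
    totalEuler N r * + N
      -- The points `zero` and `suc zero` are distinct because the set has at least two elements.
      ≡⟨ cong (_* + N) (trans (totalEuler-divisors (suc n) r (suc zero) (λ ())) (cong (+ (suc n !) *_) (divisorSum-convAB (suc n) r (suc zero) (λ ())))) ⟩
    + (suc n !) * convAB r N * + N
      ≡⟨ rearrange (+ (suc n !)) (convAB r N) (+ N) ⟩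
    convAB r N * (+ N * + (suc n !))
      -- The missing factor `N` completes the factorial to the order of the symmetric group; this is
      -- the origin of the denominator `N`.
      ≡⟨ cong (convAB r N *_) (trans (sym (ℤₚ.pos-* N (suc n !))) (cong +_ (sym (length-perms N)))) ⟩
    convAB r N * + length (perms N) ∎)
  where
  N = suc (suc n)
  total : ℤ
  total = sumℤ (map (λ X → redEuler (fixedPoints X) strictlyRefines) (commutingTuples N r))
  perms≢0 : length (perms N) ≢ 0
  perms≢0 eq = ℕₚ.<⇒≢ (ℕₚ.1≤n! N) (sym (trans (sym (length-perms N)) eq))
  rearrange : ∀ a b c → a * b * c ≡ b * (c * a)
  rearrange = solve-∀
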